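{- Let $P$ and $P'$ be Minkowski equivalent, smooth, 3-dimensional prismatoids in $\mathbb{R}^3$. Then the pair $(P,P')$ is IDP: every lattice point of $P+P'$ is the sum of a lattice point of $P$ and a lattice point of $P'$.
   Context: A $d$-dimensional prism is a polytope affinely equivalent to $Q \times [0,1]$ for a $(d-1)$-dimensional polytope $Q$; its top and bottom facets are those corresponding to $Q\times\{1\}$ and $Q\times\{0\}$. A prismatoid is a polytope whose face lattice is isomorphic to that of a prism and whose facets corresponding to the top and bottom are parallel (lie in parallel hyperplanes). A $d$-dimensional polytope in $\mathbb{R}^d$ is smooth if it is a lattice polytope, each vertex lies on exactly $d$ edges, and the primitive edge directions (smallest lattice vectors along the incident edges) at each vertex form a basis of $\mathbb{Z}^d$. Two polytopes are Minkowski equivalent if they have the same normal fan. A pair $(P,Q)$ is IDP if every lattice point of $P+Q$ is the sum of a lattice point of $P$ and a lattice point of $Q$. -}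

module Defs where

open import Level using (0ℓ)
open import Data.Nat using (ℕ; zero; suc)
open import Data.Fin using (Fin; zero; suc)
open import Data.List using (List; []; _∷_; length; map; _++_; lookup)
open import Data.List.Membership.Propositional using (_∈_)
open import Data.Integer as ℤ using (ℤ; +_)
open import Data.Rational as ℚ using (ℚ; 0ℚ; 1ℚ)
open import Data.Product using (Σ; ∃; ∃-syntax; _×_; _,_)
open import Data.Sum using (_⊎_)
open import Relation.Nullary using (¬_)
open import Relation.Binary.PropositionalEquality using (_≡_)
open import Function.Bundles using (_⇔_)

V3 : Set
V3 = ℤ × ℤ × ℤ

Q3 : Set
Q3 = ℚ × ℚ × ℚ

_+v_ : V3 → V3 → V3
(a , b , c) +v (x , y , z) = (a ℤ.+ x , b ℤ.+ y , c ℤ.+ z)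

_-v_ : V3 → V3 → V3
(a , b , c) -v (x , y , z) = (a ℤ.- x , b ℤ.- y , c ℤ.- z)

_·v_ : ℤ → V3 → V3
k ·v (x , y , z) = (k ℤ.* x , k ℤ.* y , k ℤ.* z)

dot : V3 → V3 → ℤ
dot (a , b , c) (x , y , z) = a ℤ.* x ℤ.+ b ℤ.* y ℤ.+ c ℤ.* z

0v : V3
0v = (+ 0 , + 0 , + 0)

det3 : V3 → V3 → V3 → ℤ
det3 (a , b , c) (d , e , f) (g , h , i) =
  a ℤ.* (e ℤ.* i ℤ.- f ℤ.* h) ℤ.- b ℤ.* (d ℤ.* i ℤ.- f ℤ.* g)
  ℤ.+ c ℤ.* (d ℤ.* h ℤ.- e ℤ.* g)

toQ : V3 → Q3
toQ (x , y , z) = (x ℚ./ 1 , y ℚ./ 1 , z ℚ./ 1)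

_+q_ : Q3 → Q3 → Q3
(a , b , c) +q (x , y , z) = (a ℚ.+ x , b ℚ.+ y , c ℚ.+ z)

_·q_ : ℚ → Q3 → Q3
k ·q (x , y , z) = (k ℚ.* x , k ℚ.* y , k ℚ.* z)

0q : Q3
0q = (0ℚ , 0ℚ , 0ℚ)

sumFin : ∀ {n} → (Fin n → ℚ) → ℚ
sumFin {zero}  w = 0ℚ
sumFin {suc n} w = w zero ℚ.+ sumFin (λ i → w (suc i))

sumFinQ3 : ∀ {n} → (Fin n → Q3) → Q3
sumFinQ3 {zero}  w = 0q
sumFinQ3 {suc n} w = w zero +q sumFinQ3 (λ i → w (suc i))

-- Lattice polytopes: P = conv(V) for a finite list V of points of ℤ³.

inConv : List V3 → Q3 → Set
inConv V x =
  Σ (Fin (length V) → ℚ) λ w →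
    (∀ i → 0ℚ ℚ.≤ w i) × (sumFin w ≡ 1ℚ)
    × (sumFinQ3 (λ i → w i ·q toQ (lookup V i)) ≡ x)

inMinkowskiSum : List V3 → List V3 → Q3 → Set
inMinkowskiSum V W x = ∃[ p ] ∃[ q ] (inConv V p × inConv W q × (p +q q ≡ x))

-- v ∈ V maximises the linear functional c over V (hence over conv V).
maximises : List V3 → V3 → V3 → Set
maximises V c v = v ∈ V × (∀ w → w ∈ V → dot c w ℤ.≤ dot c v)

isVertex : List V3 → V3 → Set
isVertex V v = ∃[ c ] (maximises V c v × (∀ w → maximises V c w → w ≡ v))

-- A (vertex set of a) face of conv V: either the empty face, or the
-- set of vertices lying in the face F_c = argmax_{conv V} c for some c.
isFace : List V3 → (V3 → Set) → Set
isFace V S =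
  (∀ v → ¬ S v)
  ⊎ (∃[ c ] (∀ v → S v ⇔ (isVertex V v × maximises V c v)))

isEdge : List V3 → V3 → V3 → Set
isEdge V u w =
  isVertex V u × isVertex V w × ¬ (u ≡ w)
  × ∃[ c ] (∀ x → (isVertex V x × maximises V c x) ⇔ (x ≡ u ⊎ x ≡ w))

fullDim : List V3 → Set
fullDim V = ∃[ a ] ∃[ b ] ∃[ c ] ∃[ d ]
  (a ∈ V × b ∈ V × c ∈ V × d ∈ V
   × ¬ (det3 (b -v a) (c -v a) (d -v a) ≡ + 0))

primitiveDir : V3 → V3 → Set
primitiveDir d e =
  (∃[ k ] (d ≡ (+ (suc k)) ·v e))
  × (∀ (m : ℕ) (e' : V3) → ¬ (e ≡ (+ (suc (suc m))) ·v e'))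

isBasis : V3 → V3 → V3 → Set
isBasis e₁ e₂ e₃ =
  (∀ z → ∃[ a ] ∃[ b ] ∃[ c ] (((a ·v e₁) +v (b ·v e₂)) +v (c ·v e₃) ≡ z))
  × (∀ a b c → ((a ·v e₁) +v (b ·v e₂)) +v (c ·v e₃) ≡ 0v
       → (a ≡ + 0) × (b ≡ + 0) × (c ≡ + 0))

Smooth : List V3 → Set
Smooth V =
  fullDim V ×
  (∀ v → isVertex V v →
    ∃[ w₁ ] ∃[ w₂ ] ∃[ w₃ ]
      (isEdge V v w₁ × isEdge V v w₂ × isEdge V v w₃
       × ¬ (w₁ ≡ w₂) × ¬ (w₁ ≡ w₃) × ¬ (w₂ ≡ w₃)
       × (∀ w → isEdge V v w → (w ≡ w₁ ⊎ w ≡ w₂ ⊎ w ≡ w₃))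
       × ∃[ e₁ ] ∃[ e₂ ] ∃[ e₃ ]
           (primitiveDir (w₁ -v v) e₁ × primitiveDir (w₂ -v v) e₂
            × primitiveDir (w₃ -v v) e₃ × isBasis e₁ e₂ e₃)))

prism : List (ℤ × ℤ) → List V3
prism Qs = map (λ { (x , y) → (x , y , + 0) }) Qs
        ++ map (λ { (x , y) → (x , y , + 1) }) Qs

height : V3 → ℤ
height (_ , _ , z) = z

image : (V3 → V3) → (V3 → Set) → (V3 → Set)
image f S y = ∃[ x ] (S x × f x ≡ y)

FaceIso : List V3 → List V3 → (V3 → V3) → Set₁
FaceIso T V f =
  Σ (V3 → V3) λ g →
    ((∀ x → isVertex T x → isVertex V (f x))
     × (∀ y → isVertex V y → isVertex T (g y))
     × (∀ x → isVertex T x → g (f x) ≡ x)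
     × (∀ y → isVertex V y → f (g y) ≡ y)
     × (∀ (S : V3 → Set) → (∀ x → S x → isVertex T x) →
          isFace T S ⇔ isFace V (image f S)))

Prismatoid : List V3 → Set₁
Prismatoid V =
  Σ (List (ℤ × ℤ)) λ Qs → (fullDim (prism Qs) ×
    Σ (V3 → V3) λ f → (FaceIso (prism Qs) V f ×
      ∃[ a ] ∃[ α ] ∃[ β ]
        (¬ (a ≡ 0v)
         × (∀ x → isVertex (prism Qs) x → height x ≡ + 1 → dot a (f x) ≡ α)
         × (∀ x → isVertex (prism Qs) x → height x ≡ + 0 → dot a (f x) ≡ β))))

-- Normal fans.  The normal cone of the face F_c(conv V) is
-- { d : F_c ⊆ F_d }; cones are rational, so integer points suffice.

faceLe : List V3 → V3 → V3 → Set
faceLe V c d = ∀ v → isVertex V v → maximises V c v → maximises V d v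

-- Same normal fan: every normal cone of one is a normal cone of the other.
MinkowskiEquivalent : List V3 → List V3 → Set
MinkowskiEquivalent V W =
  (∀ c → ∃[ c' ] (∀ d → faceLe V c d ⇔ faceLe W c' d))
  × (∀ c' → ∃[ c ] (∀ d → faceLe V c d ⇔ faceLe W c' d))

IDP : List V3 → List V3 → Set
IDP V W =
  ∀ z → inMinkowskiSum V W (toQ z) →
    ∃[ p ] ∃[ q ] (inConv V (toQ p) × inConv W (toQ q) × (p +v q ≡ z))

{-# OPTIONS --safe #-}
-- Along each edge joining the two parallel facets of a smooth prismatoid, consecutive lattice points are
-- at lattice height one, so the slices at integer heights are lattice polygons; a lattice point z of
-- P + P' lies over such a slice A of P and such a slice B of P'. The quadrilateral facets force bottom
-- and top of P to have the same normal fan, which P' shares, so A and B have the same edge normals. It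
-- remains to find a lattice point in A ∩ R, where R = z − B.
--
-- In the plane, put a point of A ∩ R into a lattice triangle of A and subdivide it down to a unimodular
-- one. If none of its vertices is in R, the lines separating them from R show that R crosses some edge
-- of the triangle strictly between its end points. Walking through adjacent unimodular triangles in both
-- directions, one reaches edges f and g of A, each crossed by R strictly inside a primitive segment.
-- By equivalence R has lattice edges parallel to f and g beyond them, and the convex hull of these two
-- edges would have to pass strictly inside both primitive segments, which is impossible.
module Submission where

open import Defs
open import Data.Nat as ℕ using (ℕ; zero; suc)
open import Data.Fin using (Fin; zero; suc; _↑ˡ_; _↑ʳ_)
open import Data.Integer hiding (suc; pred; _⊖_)
open import Data.Integer.Properties
import Data.Integer.Tactic.RingSolver as RingSolver
open RingSolver using (solve-∀)
open import Tactic.RingSolver.NonReflective RingSolver.ring using (Expr; _⊕_; _⊗_; ⊝_; Κ; Ι; module Ops)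
open import Data.Product using (Σ; ∃; ∃-syntax; _×_; _,_; proj₁; proj₂; map₂)
open import Data.Sum using (_⊎_; inj₁; inj₂; swap)
open import Data.Empty using (⊥; ⊥-elim)
open import Relation.Nullary using (¬_; Dec; yes; no)
open import Relation.Binary.PropositionalEquality
open import Function using (_∘_; case_of_)
open import Data.Product.Properties using (≡-dec)
open import Data.Integer.DivMod using (_/ℕ_; _%ℕ_; a≡a%ℕn+[a/ℕn]*n; n%ℕd<d)
open import Data.List.Membership.Propositional using (_∈_)
open import Data.List.Relation.Unary.Any using (here; there; index)
open import Function.Bundles using (_⇔_; Equivalence; mk⇔)
open import Relation.Binary.Definitions using (tri<; tri≈; tri>)
open import Data.Bool using (Bool; true; false; not)
open import Data.List.Membership.Propositional.Properties using (∈-++⁺ˡ; ∈-++⁺ʳ; ∈-++⁻; ∈-map⁺; ∈-map⁻; ∈-filter⁺; ∈-filter⁻; ∈-lookup)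
import Data.List.Membership.DecPropositional as DecMembership
open import Data.List.Relation.Unary.Any.Properties using (lookup-index)
open import Relation.Nullary.Decidable using (¬?)
open import Data.Maybe using (nothing)
open import Data.Rational as ℚ using (ℚ; 0ℚ; 1ℚ)
import Data.Rational.Properties as ℚₚ
import Data.Rational.Unnormalised as ℚᵘ
import Data.Rational.Unnormalised.Properties as ℚᵘₚ
open import Tactic.RingSolver.Core.AlmostCommutativeRing using (AlmostCommutativeRing; fromCommutativeRing)
import Tactic.RingSolver as RingTactic

-- The obstacle is that A and R may well meet in rational points only, so convexity alone yields no
-- lattice point; a rational point is carried in homogeneous integer coordinates. Integrality enters
-- decisively in three places. A vertex of R on the line of a crossed edge would have an integer
-- position strictly between 0 and 1. Separating lines arranged cyclically round a unimodular
-- triangle would give a vertex of R three positive integer barycentric coordinates with sum 1. A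
-- vertex of R beyond an edge lies at depth at least one, so the next triangle of a walk cannot
-- swallow it. The vertices of P, P', A and B carry common labels. Equality of normal fans then
-- reads: a functional that is maximal at a label on one of these polygons is maximal there on the
-- others. Hence z lies in the hull of the sums `A j ⊞ B j`, and the certificate for this gives a
-- point of A ∩ R with the same labels and weights on both sides. The height of z may be split
-- between P and P' in any admissible way.

module Plane where
  open import Data.Vec using (Vec; []; _∷_; tabulate; _++_)


  -- Signs of integers and extrema over finite index sets

  0<-resp : ∀ {x y} → 0ℤ < x → x ≡ y → 0ℤ < y
  0<-resp p refl = p

  0≤-resp : ∀ {x y} → 0ℤ ≤ x → x ≡ y → 0ℤ ≤ y
  0≤-resp p refl = p

  0≤+ : ∀ {x y} → 0ℤ ≤ x → 0ℤ ≤ y → 0ℤ ≤ x + y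
  0≤+ = +-mono-≤

  0<+≤ : ∀ {x y} → 0ℤ < x → 0ℤ ≤ y → 0ℤ < x + y
  0<+≤ = +-mono-<-≤

  0≤+< : ∀ {x y} → 0ℤ ≤ x → 0ℤ < y → 0ℤ < x + y
  0≤+< = +-mono-≤-<

  0<+ : ∀ {x y} → 0ℤ < x → 0ℤ < y → 0ℤ < x + y
  0<+ = +-mono-<

  0≤* : ∀ {x y} → 0ℤ ≤ x → 0ℤ ≤ y → 0ℤ ≤ x * y
  0≤* {+ m} {+ n} _ _ = subst (0ℤ ≤_) (pos-* m n) (+≤+ ℕ.z≤n)

  0<* : ∀ {x y} → 0ℤ < x → 0ℤ < y → 0ℤ < x * y
  0<* {+[1+ m ]} {+[1+ n ]} _ _ = +<+ ℕ.z<s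
  0<* {+0} (+<+ ()) _
  0<* {+[1+ m ]} {+0} _ (+<+ ())

  0<0-absurd : ∀ {ℓ} {A : Set ℓ} → 0ℤ < 0ℤ → A
  0<0-absurd (+<+ ())

  0<*-cancel : ∀ {x y} → 0ℤ < x → 0ℤ < x * y → 0ℤ < y
  0<*-cancel {+0} (+<+ ()) _
  0<*-cancel {+[1+ m ]} {+0} _ q = 0<0-absurd (subst (0ℤ <_) (*-zeroʳ +[1+ m ]) q)
  0<*-cancel {+[1+ m ]} {+[1+ n ]} _ _ = +<+ ℕ.z<s
  0<*-cancel {+[1+ m ]} { -[1+ n ]} _ ()

  0≤*-cancel : ∀ {x y} → 0ℤ < x → 0ℤ ≤ x * y → 0ℤ ≤ y
  0≤*-cancel {+0} (+<+ ()) _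
  0≤*-cancel {+[1+ m ]} {+ n} _ _ = +≤+ ℕ.z≤n
  0≤*-cancel {+[1+ m ]} { -[1+ n ]} _ ()

  ≡0*-cancel : ∀ {x y} → 0ℤ < x → x * y ≡ 0ℤ → y ≡ 0ℤ
  ≡0*-cancel {+0} (+<+ ()) _
  ≡0*-cancel {+[1+ m ]} {y} _ q = *-cancelˡ-≡ +[1+ m ] y 0ℤ (trans q (sym (*-zeroʳ +[1+ m ])))

  0≤-≡ : ∀ {x} → x ≡ 0ℤ → 0ℤ ≤ x
  0≤-≡ refl = ≤-refl

  0<⇒0≤ : ∀ {x} → 0ℤ < x → 0ℤ ≤ x
  0<⇒0≤ = <⇒≤

  0<⇒0≤-1 : ∀ {x} → 0ℤ < x → 0ℤ ≤ x - 1ℤ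
  0<⇒0≤-1 {+0} (+<+ ())
  0<⇒0≤-1 {+[1+ n ]} _ = +≤+ ℕ.z≤n

  <⇒0< : ∀ {x y} → x < y → 0ℤ < y - x
  <⇒0< {x} {y} p = subst (_< y - x) (+-inverseʳ x) (+-monoˡ-< (- x) p)

  0<⇒< : ∀ {x y} → 0ℤ < y - x → x < y
  0<⇒< {x} {y} p = subst₂ _<_ (+-identityˡ x) (lem x y) (+-monoˡ-< x p)
    where
    lem : ∀ x y → y - x + x ≡ y
    lem = solve-∀

  clash : ∀ {ℓ} {A : Set ℓ} {x y} → 0ℤ < x → 0ℤ ≤ y → x + y ≡ 0ℤ → A
  clash p q e = 0<0-absurd (subst (0ℤ <_) e (0<+≤ p q))

  ¬neg : ∀ {ℓ} {A : Set ℓ} {x} → 0ℤ < - x → 0ℤ ≤ x → A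
  ¬neg {x = x} p q = clash p q (+-inverseˡ x)

  ¬pos : ∀ {ℓ} {A : Set ℓ} {x} → 0ℤ < x → 0ℤ ≤ - x → A
  ¬pos {x = x} p q = clash p q (+-inverseʳ x)

  x-x : ∀ x → x + (- x) ≡ 0ℤ
  x-x = +-inverseʳ

  data Sgn (x : ℤ) : Set where
    is+ : 0ℤ < x → Sgn x
    is0 : x ≡ 0ℤ → Sgn x
    is- : 0ℤ < - x → Sgn x

  sgn : ∀ x → Sgn x
  sgn +0 = is0 refl
  sgn +[1+ n ] = is+ (+<+ ℕ.z<s)
  sgn -[1+ n ] = is- (+<+ ℕ.z<s)

  0≤⊎ : ∀ x → 0ℤ ≤ x ⊎ 0ℤ < - x
  0≤⊎ (+ n) = inj₁ (+≤+ ℕ.z≤n)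
  0≤⊎ -[1+ n ] = inj₂ (+<+ ℕ.z<s)

  0<⊎ : ∀ x → 0ℤ < x ⊎ 0ℤ ≤ - x
  0<⊎ x with sgn x
  ... | is+ p = inj₁ p
  ... | is0 refl = inj₂ ≤-refl
  ... | is- p = inj₂ (0<⇒0≤ p)

  0≤-antisym : ∀ {x} → 0ℤ ≤ x → 0ℤ ≤ - x → x ≡ 0ℤ
  0≤-antisym {+0} _ _ = refl
  0≤-antisym {+[1+ n ]} _ ()

  ≡-from-0 : ∀ {x y} → x - y ≡ 0ℤ → x ≡ y
  ≡-from-0 = i-j≡0⇒i≡j _ _

  0-from-≡ : ∀ {x y} → x ≡ y → x - y ≡ 0ℤ
  0-from-≡ = i≡j⇒i-j≡0

  ∀-or-∃ : ∀ {n} {P Q : Fin n → Set} → (∀ j → P j ⊎ Q j) → (∀ j → P j) ⊎ ∃ Q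
  ∀-or-∃ {zero} h = inj₁ λ ()
  ∀-or-∃ {suc n} h with h zero | ∀-or-∃ (h ∘ suc)
  ... | inj₂ q | _ = inj₂ (zero , q)
  ... | inj₁ p | inj₂ (j , q) = inj₂ (suc j , q)
  ... | inj₁ p | inj₁ ps = inj₁ λ { zero → p ; (suc j) → ps j }

  strict-lower-bound : ∀ {n} (g : Fin n → ℤ) → ∃[ K ] (0ℤ < K × (∀ j → 0ℤ < K + g j))
  strict-lower-bound {zero} g = 1ℤ , +<+ ℕ.z<s , λ ()
  strict-lower-bound {suc n} g with strict-lower-bound (g ∘ suc)
  ... | K , 0<K , h = K + + ∣ g zero ∣ , 0<+≤ 0<K (+≤+ ℕ.z≤n) , go
    where
    0≤∣x∣+x : ∀ x → 0ℤ ≤ + ∣ x ∣ + x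
    0≤∣x∣+x (+ n) = +≤+ ℕ.z≤n
    0≤∣x∣+x -[1+ n ] = 0≤-≡ (+-inverseˡ -[1+ n ])
    lem : ∀ a b c → a + (b + c) ≡ a + b + c
    lem = solve-∀
    lem' : ∀ a b c → (a + c) + b ≡ a + b + c
    lem' = solve-∀
    go : ∀ j → 0ℤ < K + + ∣ g zero ∣ + g j
    go zero = subst (0ℤ <_) (lem K _ (g zero)) (0<+≤ 0<K (0≤∣x∣+x (g zero)))
    go (suc j) = subst (0ℤ <_) (lem' K _ (g (suc j))) (0<+≤ (h j) (+≤+ ℕ.z≤n))

  -- The ratio `C j / D j` is maximised by cross multiplication; the condition where `D j` vanishes
  -- excludes infinite ratios. It is the tool for tilting one functional by another until a second
  -- maximiser ties, and for finding the subtriangle that contains a point.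
  best-ratio : ∀ {n} (C D : Fin n → ℤ) → (∀ j → 0ℤ ≤ D j) → (∀ j → D j ≡ 0ℤ → 0ℤ ≤ - C j)
    → (∀ j → 0ℤ ≤ - C j)
    ⊎ ∃[ m ] (0ℤ < C m × 0ℤ < D m × (∀ j → 0ℤ ≤ C m * D j - C j * D m))
  best-ratio {zero} C D _ _ = inj₁ λ ()
  best-ratio {suc n} C D 0≤D zeroD with best-ratio (C ∘ suc) (D ∘ suc) (0≤D ∘ suc) (zeroD ∘ suc)
  ... | inj₁ all with 0<⊎ (C zero)
  ...   | inj₂ c₀ = inj₁ λ { zero → c₀ ; (suc j) → all j }
  ...   | inj₁ c₀ = inj₂ (zero , c₀ , D₀ , λ
            { zero → 0≤-≡ (x-x (C zero * D zero))
            ; (suc j) → subst (0ℤ ≤_) (lem (C zero) (D (suc j)) (C (suc j)) (D zero))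
                          (0≤+ (0≤* (0<⇒0≤ c₀) (0≤D (suc j))) (0≤* (all j) (0≤D zero))) })
    where
    lem : ∀ a b c d → a * b + (- c) * d ≡ a * b - c * d
    lem = solve-∀
    D₀ : 0ℤ < D zero
    D₀ with sgn (D zero)
    ... | is+ p = p
    ... | is0 e = clash c₀ (zeroD zero e) (x-x (C zero))
    ... | is- p = clash p (0≤D zero) (+-inverseˡ (D zero))
  best-ratio {suc n} C D 0≤D zeroD | inj₂ (m , Cm , Dm , best) with 0≤⊎ (C (suc m) * D zero - C zero * D (suc m))
  ... | inj₁ p = inj₂ (suc m , Cm , Dm , λ { zero → p ; (suc j) → best j })
  ... | inj₂ p = inj₂ (zero , C₀ , D₀ , λ
          { zero → 0≤-≡ (x-x (C zero * D zero))
          ; (suc j) → 0≤*-cancel Dm (subst (0ℤ ≤_)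
              (lem (C zero) (D zero) (C (suc m)) (D (suc m)) (C (suc j)) (D (suc j)))
              (0≤+ (0≤* (0<⇒0≤ p) (0≤D (suc j))) (0≤* (best j) (0<⇒0≤ D₀)))) })
    where
    lem : ∀ c₀ d₀ c d cⱼ dⱼ → (- (c * d₀ - c₀ * d)) * dⱼ + (c * dⱼ - cⱼ * d) * d₀ ≡ d * (c₀ * dⱼ - cⱼ * d₀)
    lem = solve-∀
    lem₁ : ∀ c₀ d₀ c d → - (c * d₀ - c₀ * d) + c * d₀ ≡ d * c₀
    lem₁ = solve-∀
    C₀ : 0ℤ < C zero
    C₀ = 0<*-cancel Dm (subst (0ℤ <_) (lem₁ (C zero) (D zero) (C (suc m)) (D (suc m))) (0<+≤ p (0≤* (0<⇒0≤ Cm) (0≤D zero))))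
    D₀ : 0ℤ < D zero
    D₀ with sgn (D zero)
    ... | is+ q = q
    ... | is0 e = clash C₀ (zeroD zero e) (x-x (C zero))
    ... | is- q = clash q (0≤D zero) (+-inverseˡ (D zero))

  argmax : ∀ {n} (g : Fin (suc n) → ℤ) → ∃[ m ] (∀ j → 0ℤ ≤ g m - g j)
  argmax {zero} g = zero , λ { zero → 0≤-≡ (x-x (g zero)) }
  argmax {suc n} g with argmax (g ∘ suc)
  ... | m , h with 0≤⊎ (g (suc m) - g zero)
  ...   | inj₁ p = suc m , λ { zero → p ; (suc j) → h j }
  ...   | inj₂ p = zero , λ { zero → 0≤-≡ (x-x (g zero))
                             ; (suc j) → subst (0ℤ ≤_) (lem (g (suc m)) (g zero) (g (suc j))) (0≤+ (0<⇒0≤ p) (h j)) }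
    where
    lem : ∀ a b c → - (a - b) + (a - c) ≡ b - c
    lem = solve-∀

  -- The plane over an arbitrary signature, used both for ℤ and for the
  -- polynomial expressions of the ring solver.

  module PlaneOps {X : Set} (_✚_ _✱_ : X → X → X) (━_ : X → X) where

    infixl 6 _⊞_ _⊟_
    infixl 7 _⊡_

    _⊞_ _⊟_ : X × X → X × X → X × X
    (a , b) ⊞ (c , d) = (a ✚ c) , (b ✚ d)
    (a , b) ⊟ (c , d) = (a ✚ (━ c)) , (b ✚ (━ d))

    _⊡_ : X → X × X → X × X
    k ⊡ (a , b) = (k ✱ a) , (k ✱ b)

    det dot₂ : X × X → X × X → X
    det (a , b) (c , d) = (a ✱ d) ✚ (━ (b ✱ c))
    dot₂ (a , b) (c , d) = (a ✱ c) ✚ (b ✱ d)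

    -- Twice the signed area of the triangle abc.
    br : X × X → X × X → X × X → X
    br a b c = det (b ⊟ a) (c ⊟ a)

    -- br with the last point given in homogeneous coordinates (w : x).
    hbr : X × X → X × X → X → X × X → X
    hbr a b w x = det (b ⊟ a) (x ⊟ w ⊡ a)

  V2 : Set
  V2 = ℤ × ℤ

  open PlaneOps _+_ _*_ -_
  module E {n : ℕ} where
    infixl 6 _⊖_
    _⊖_ : Expr ℤ n → Expr ℤ n → Expr ℤ n
    x ⊖ y = x ⊕ (⊝ y)
    open PlaneOps (_⊕_ {A = ℤ} {n = n}) _⊗_ ⊝_ public

  flatten : ∀ {k} → Vec V2 k → Vec ℤ (k ℕ.* 2)
  flatten [] = []
  flatten ((x , y) ∷ ps) = x ∷ y ∷ flatten ps

  points : ∀ {n} k → (Fin (k ℕ.* 2) → Fin n) → Vec (Expr ℤ n × Expr ℤ n) k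
  points zero _ = []
  points (suc k) ι = (Ι (ι zero) , Ι (ι (suc zero))) ∷ points k (λ i → ι (suc (suc i)))

  infix 4 _≋_
  _≋_ : ∀ {A : Set} → A → A → A × A
  _≋_ = _,_

  module _ {m k : ℕ} (ss : Vec ℤ m) (ps : Vec V2 k) where

    private
      n = m ℕ.+ k ℕ.* 2
      ρ : Vec ℤ n
      ρ = ss ++ flatten ps
      close : ∀ {A : Set} → (Vec (Expr ℤ n) m → Vec (Expr ℤ n × Expr ℤ n) k → A) → A
      close f = f (tabulate (λ i → Ι (i ↑ˡ k ℕ.* 2))) (points k (m ↑ʳ_))
      open Ops using (⟦_⇓⟧; ⟦_⟧; correct)
      prove : (t : Expr ℤ n × Expr ℤ n) → ⟦ proj₁ t ⇓⟧ ρ ≡ ⟦ proj₂ t ⇓⟧ ρ → ⟦ proj₁ t ⟧ ρ ≡ ⟦ proj₂ t ⟧ ρ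
      prove t eq = trans (sym (correct (proj₁ t) ρ)) (trans eq (correct (proj₂ t) ρ))

    -- The ring solver for identities in scalars ss and points ps; f builds both sides from the reified variables.
    by-ring : (f : Vec (Expr ℤ n) m → Vec (Expr ℤ n × Expr ℤ n) k → Expr ℤ n × Expr ℤ n) →
      ⟦ proj₁ (close f) ⇓⟧ ρ ≡ ⟦ proj₂ (close f) ⇓⟧ ρ → ⟦ proj₁ (close f) ⟧ ρ ≡ ⟦ proj₂ (close f) ⟧ ρ
    by-ring f = prove (close f)

    by-ring² : (f : Vec (Expr ℤ n) m → Vec (Expr ℤ n × Expr ℤ n) k → (Expr ℤ n × Expr ℤ n) × (Expr ℤ n × Expr ℤ n)) →
      let l = proj₁ (close f) ; r = proj₂ (close f) in
      ⟦ proj₁ l ⇓⟧ ρ ≡ ⟦ proj₁ r ⇓⟧ ρ → ⟦ proj₂ l ⇓⟧ ρ ≡ ⟦ proj₂ r ⇓⟧ ρ →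
      (⟦ proj₁ l ⟧ ρ , ⟦ proj₂ l ⟧ ρ) ≡ (⟦ proj₁ r ⟧ ρ , ⟦ proj₂ r ⟧ ρ)
    by-ring² f e e' = cong₂ _,_ (prove (proj₁ (proj₁ (close f)) , proj₁ (proj₂ (close f))) e)
                                (prove (proj₂ (proj₁ (close f)) , proj₂ (proj₂ (close f))) e')

  -- Nonnegative linear dependences in the plane

  0₂ : V2
  0₂ = 0ℤ , 0ℤ

  comb₂ : ℤ → V2 → ℤ → V2 → ℤ → V2 → V2
  comb₂ w₁ x w₂ y w₃ z = (w₁ ⊡ x ⊞ w₂ ⊡ y) ⊞ w₃ ⊡ z

  record Weights (w₁ w₂ w₃ : ℤ) : Set where
    constructor weights
    field
      w₁≥0 : 0ℤ ≤ w₁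
      w₂≥0 : 0ℤ ≤ w₂
      w₃≥0 : 0ℤ ≤ w₃
      sum>0 : 0ℤ < w₁ + w₂ + w₃
  open Weights

  Balanced : ∀ {n} → (Fin n → V2) → Set
  Balanced d = ∃[ i ] ∃[ j ] ∃[ k ] ∃[ w₁ ] ∃[ w₂ ] ∃[ w₃ ]
    (Weights w₁ w₂ w₃ × comb₂ w₁ (d i) w₂ (d j) w₃ (d k) ≡ 0₂)

  sum-of-squares : ∀ x → 0ℤ < dot₂ x x ⊎ x ≡ 0₂
  sum-of-squares (x , y) with sq x | sq y
    where
    sq : ∀ x → 0ℤ < x * x ⊎ x ≡ 0ℤ
    sq x with sgn x
    ... | is+ p = inj₁ (0<* p p)
    ... | is0 e = inj₂ e
    ... | is- p = inj₁ (subst (0ℤ <_) (lem x) (0<* p p))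
      where
      lem : ∀ x → - x * - x ≡ x * x
      lem = solve-∀
  ... | inj₁ p | inj₁ q = inj₁ (0<+ p q)
  ... | inj₁ p | inj₂ refl = inj₁ (0<+≤ p ≤-refl)
  ... | inj₂ refl | inj₁ q = inj₁ (0≤+< ≤-refl q)
  ... | inj₂ refl | inj₂ refl = inj₂ refl

  -- Gordan's alternative in the plane, with a certificate of Carathéodory size.
  gordan : ∀ {n} (d : Fin n → V2) → (∃[ c ] (∀ j → 0ℤ < - dot₂ c (d j))) ⊎ Balanced d
  gordan {zero} d = inj₁ (0₂ , λ ())
  gordan {suc n} d with gordan (d ∘ suc)
  ... | inj₂ (i , j , k , ws) = inj₂ (suc i , suc j , suc k , ws)
  ... | inj₁ (c , c-neg) with 0≤⊎ (dot₂ c (d zero))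
  ...   | inj₂ p = inj₁ (c , λ { zero → p ; (suc j) → c-neg j })
  ...   | inj₁ c·d₀≥0 = go
    where
    d₀ = d zero
    K = strict-lower-bound (λ j → dot₂ d₀ (d (suc j)))
    -- The combination with these weights equals the determinant times `c` turned by a right angle.
    collinear : ∀ j → det d₀ (d (suc j)) ≡ 0ℤ → Balanced d
    collinear j e = zero , suc j , zero , - dot₂ c (d (suc j)) , dot₂ c d₀ , 0ℤ ,
        weights (0<⇒0≤ (c-neg j)) c·d₀≥0 ≤-refl
          (subst (0ℤ <_) (sym (+-identityʳ _)) (0<+≤ (c-neg j) c·d₀≥0)) ,
        cong₂ _,_ (trans (lem₁ (proj₁ c) (proj₂ c) (proj₁ d₀) (proj₂ d₀) (proj₁ (d (suc j))) (proj₂ (d (suc j)))) (trans (cong (- proj₂ c *_) e) (*-zeroʳ (- proj₂ c))))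
                  (trans (lem₂ (proj₁ c) (proj₂ c) (proj₁ d₀) (proj₂ d₀) (proj₁ (d (suc j))) (proj₂ (d (suc j)))) (trans (cong (proj₁ c *_) e) (*-zeroʳ (proj₁ c))))
      where
      lem₁ : ∀ c₁ c₂ x y u v → (- (c₁ * u + c₂ * v)) * x + (c₁ * x + c₂ * y) * u + 0ℤ * x ≡ - c₂ * (x * v - y * u)
      lem₁ = solve-∀
      lem₂ : ∀ c₁ c₂ x y u v → (- (c₁ * u + c₂ * v)) * y + (c₁ * x + c₂ * y) * v + 0ℤ * y ≡ c₁ * (x * v - y * u)
      lem₂ = solve-∀
    lemK : ∀ a b k x y → k * (a * y - b * x - 1ℤ) + (k + (a * x + b * y)) ≡ - ((- (k * (- b) + a)) * x + (- (k * a + b)) * y)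
    lemK = solve-∀
    lemK' : ∀ a b k x y → k * (- (a * y - b * x) - 1ℤ) + (k + (a * x + b * y)) ≡ - ((k * (- b) + - a) * x + (k * a + - b) * y)
    lemK' = solve-∀
    lem₀ : ∀ a b k → a * a + b * b ≡ - ((- (k * (- b) + a)) * a + (- (k * a + b)) * b)
    lem₀ = solve-∀
    lem₀' : ∀ a b k → a * a + b * b ≡ - ((k * (- b) + - a) * a + (k * a + - b) * b)
    lem₀' = solve-∀
    -- The dependence is Cramer's rule for three plane vectors. Applying `c` to it (`l₃`) shows that
    -- the coefficient of `d₀` is positive too.
    opposite : ∀ j k → 0ℤ < - det d₀ (d (suc j)) → 0ℤ < det d₀ (d (suc k)) → Balanced d
    opposite j k p q = zero , suc j , suc k , - det (d (suc j)) (d (suc k)) , det d₀ (d (suc k)) , - det d₀ (d (suc j)) ,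
        weights (0<⇒0≤ r) (0<⇒0≤ q) (0<⇒0≤ p) (0<+ (0<+ r q) p) ,
        cong₂ _,_ (l₁ (proj₁ d₀) (proj₂ d₀) (proj₁ (d (suc j))) (proj₂ (d (suc j))) (proj₁ (d (suc k))) (proj₂ (d (suc k))))
                  (l₂ (proj₁ d₀) (proj₂ d₀) (proj₁ (d (suc j))) (proj₂ (d (suc j))) (proj₁ (d (suc k))) (proj₂ (d (suc k))))
      where
      l₁ : ∀ x y u v s t → (- (u * t - v * s)) * x + (x * t - y * s) * u + (- (x * v - y * u)) * s ≡ 0ℤ
      l₁ = solve-∀
      l₂ : ∀ x y u v s t → (- (u * t - v * s)) * y + (x * t - y * s) * v + (- (x * v - y * u)) * t ≡ 0ℤ
      l₂ = solve-∀
      l₃ : ∀ c₁ c₂ x y u v s t → (x * t - y * s) * (- (c₁ * u + c₂ * v)) + (- (x * v - y * u)) * (- (c₁ * s + c₂ * t)) + (u * t - v * s) * (c₁ * x + c₂ * y) ≡ 0ℤ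
      l₃ = solve-∀
      r : 0ℤ < - det (d (suc j)) (d (suc k))
      r with 0≤⊎ (det (d (suc j)) (d (suc k)))
      ... | inj₂ r = r
      ... | inj₁ r = clash (0<+ (0<* q (c-neg j)) (0<* p (c-neg k))) (0≤* r c·d₀≥0)
                       (l₃ (proj₁ c) (proj₂ c) (proj₁ d₀) (proj₂ d₀) (proj₁ (d (suc j))) (proj₂ (d (suc j))) (proj₁ (d (suc k))) (proj₂ (d (suc k))))
    go : (∃[ c ] (∀ j → 0ℤ < - dot₂ c (d j))) ⊎ Balanced d
    go with sum-of-squares d₀
    ... | inj₂ d₀≡0 = inj₂ (zero , zero , zero , 1ℤ , 0ℤ , 0ℤ , weights (+≤+ ℕ.z≤n) ≤-refl ≤-refl (+<+ ℕ.z<s) ,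
            subst (λ v → comb₂ 1ℤ v 0ℤ v 0ℤ v ≡ 0₂) (sym d₀≡0) refl)
    ... | inj₁ sq with ∀-or-∃ (λ j → 0<⊎ (det d₀ (d (suc j))))
    -- All other vectors are strictly to the left of `d₀`. Take `K` times `d₀` turned left, plus
    -- `d₀`, and negate: the determinants are at least one, so `K` outweighs the inner products with
    -- `d₀`, while on `d₀` itself the squared length remains.
    ...   | inj₁ all = inj₁ ((- (proj₁ K * (- proj₂ d₀) + proj₁ d₀) , - (proj₁ K * proj₁ d₀ + proj₂ d₀)) , λ
              { zero → subst (0ℤ <_) (lem₀ (proj₁ d₀) (proj₂ d₀) (proj₁ K)) sq
              ; (suc j) → subst (0ℤ <_) (lemK (proj₁ d₀) (proj₂ d₀) (proj₁ K) (proj₁ (d (suc j))) (proj₂ (d (suc j))))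
                  (0≤+< (0≤* (0<⇒0≤ (proj₁ (proj₂ K))) (0<⇒0≤-1 (all j))) (proj₂ (proj₂ K) j)) })
    ...   | inj₂ (j , dⱼ≤0) with ∀-or-∃ (λ j → 0≤⊎ (det d₀ (d (suc j))))
    ...     | inj₁ all≥0 = inj₂ (collinear j (0≤-antisym (all≥0 j) dⱼ≤0))
    ...     | inj₂ (k , dₖ<0) = opp
      where
      opp : (∃[ c ] (∀ j → 0ℤ < - dot₂ c (d j))) ⊎ Balanced d
      opp with ∀-or-∃ (λ j → swap (0≤⊎ (det d₀ (d (suc j)))))
      ... | inj₁ all = inj₁ ((proj₁ K * (- proj₂ d₀) + - proj₁ d₀ , proj₁ K * proj₁ d₀ + - proj₂ d₀) , λ
              { zero → subst (0ℤ <_) (lem₀' (proj₁ d₀) (proj₂ d₀) (proj₁ K)) sq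
              ; (suc j) → subst (0ℤ <_) (lemK' (proj₁ d₀) (proj₂ d₀) (proj₁ K) (proj₁ (d (suc j))) (proj₂ (d (suc j))))
                  (0≤+< (0≤* (0<⇒0≤ (proj₁ (proj₂ K))) (0<⇒0≤-1 (all j))) (proj₂ (proj₂ K) j)) })
      ... | inj₂ (m , dₘ≥0) with sgn (det d₀ (d (suc m)))
      ...   | is+ p = inj₂ (opposite k m dₖ<0 p)
      ...   | is0 e = inj₂ (collinear m e)
      ...   | is- p = ¬neg p dₘ≥0

-- Lattice points of convex hulls and supporting lines

module Convexity where
  open import Data.Vec using ([]; _∷_)
  open Plane
  open PlaneOps _+_ _*_ -_
  open Weights

  -- Integer weights replace rational coefficients, and only lattice points occur. Three summands
  -- suffice in the plane by Carathéodory; `in-or-separated` shows that no lattice point of the hull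
  -- is lost.
  data Conv {n} (A : Fin n → V2) : V2 → Set where
    gen : ∀ i → Conv A (A i)
    mix : ∀ {w₁ w₂ w₃ x y z p} → Weights w₁ w₂ w₃ → Conv A x → Conv A y → Conv A z
      → comb₂ w₁ x w₂ y w₃ z ≡ (w₁ + w₂ + w₃) ⊡ p → Conv A p

  ⊡-cancel : ∀ {w x y} → 0ℤ < w → w ⊡ x ≡ w ⊡ y → x ≡ y
  ⊡-cancel {+0} (+<+ ()) _
  ⊡-cancel {+[1+ n ]} _ e = cong₂ _,_ (*-cancelˡ-≡ +[1+ n ] _ _ (cong proj₁ e)) (*-cancelˡ-≡ +[1+ n ] _ _ (cong proj₂ e))

  affine-comb : ∀ m c w₁ w₂ w₃ x y z p → comb₂ w₁ x w₂ y w₃ z ≡ (w₁ + w₂ + w₃) ⊡ p →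
    (w₁ + w₂ + w₃) * (m + dot₂ c p) ≡ w₁ * (m + dot₂ c x) + w₂ * (m + dot₂ c y) + w₃ * (m + dot₂ c z)
  affine-comb m c w₁ w₂ w₃ x y z p e = trans
    (by-ring (m ∷ w₁ ∷ w₂ ∷ w₃ ∷ []) (c ∷ p ∷ []) (λ { (m ∷ w₁ ∷ w₂ ∷ w₃ ∷ []) (c ∷ p ∷ []) →
      (w₁ ⊕ w₂ ⊕ w₃) ⊗ (m ⊕ E.dot₂ c p) ≋ (w₁ ⊕ w₂ ⊕ w₃) ⊗ m ⊕ E.dot₂ c ((w₁ ⊕ w₂ ⊕ w₃) E.⊡ p) }) refl)
    (trans (cong (λ v → (w₁ + w₂ + w₃) * m + dot₂ c v) (sym e))
    (by-ring (m ∷ w₁ ∷ w₂ ∷ w₃ ∷ []) (c ∷ x ∷ y ∷ z ∷ []) (λ { (m ∷ w₁ ∷ w₂ ∷ w₃ ∷ []) (c ∷ x ∷ y ∷ z ∷ []) →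
      (w₁ ⊕ w₂ ⊕ w₃) ⊗ m ⊕ E.dot₂ c ((w₁ E.⊡ x E.⊞ w₂ E.⊡ y) E.⊞ w₃ E.⊡ z) ≋
      w₁ ⊗ (m ⊕ E.dot₂ c x) ⊕ w₂ ⊗ (m ⊕ E.dot₂ c y) ⊕ w₃ ⊗ (m ⊕ E.dot₂ c z) }) refl))

  module _ {n} {A : Fin n → V2} (m : ℤ) (c : V2) (A≥0 : ∀ i → 0ℤ ≤ m + dot₂ c (A i)) where

    Conv-≥0 : ∀ {p} → Conv A p → 0ℤ ≤ m + dot₂ c p
    Conv-≥0 (gen i) = A≥0 i
    Conv-≥0 (mix {w₁} {w₂} {w₃} {x} {y} {z} {p} w X Y Z e) = 0≤*-cancel (sum>0 w)
      (subst (0ℤ ≤_) (sym (affine-comb m c w₁ w₂ w₃ x y z p e))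
        (0≤+ (0≤+ (0≤* (w₁≥0 w) (Conv-≥0 X)) (0≤* (w₂≥0 w) (Conv-≥0 Y))) (0≤* (w₃≥0 w) (Conv-≥0 Z))))

    Conv-vertex : ∀ {s p} → (∀ i → m + dot₂ c (A i) ≡ 0ℤ → A i ≡ s) → Conv A p → m + dot₂ c p ≡ 0ℤ → p ≡ s
    Conv-vertex only (gen i) e₀ = only i e₀
    Conv-vertex {s} only (mix {w₁} {w₂} {w₃} {x} {y} {z} {p} w X Y Z e) e₀ =
      ⊡-cancel (sum>0 w) (trans (sym e) (trans (cong₂ _⊞_ (cong₂ _⊞_ (term w₁ X (proj₁ zs)) (term w₂ Y (proj₁ (proj₂ zs)))) (term w₃ Z (proj₂ (proj₂ zs))))
        (by-ring² (w₁ ∷ w₂ ∷ w₃ ∷ []) (s ∷ []) (λ { (w₁ ∷ w₂ ∷ w₃ ∷ []) (s ∷ []) →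
          (w₁ E.⊡ s E.⊞ w₂ E.⊡ s) E.⊞ w₃ E.⊡ s ≋ (w₁ ⊕ w₂ ⊕ w₃) E.⊡ s }) refl refl)))
      where
      split : ∀ {a b c} → 0ℤ ≤ a → 0ℤ ≤ b → 0ℤ ≤ c → a + b + c ≡ 0ℤ → a ≡ 0ℤ × b ≡ 0ℤ × c ≡ 0ℤ
      split {+0} {+0} {+ c} _ _ _ e = refl , refl , e
      split {+0} {+[1+ b ]} {+ c} _ _ _ ()
      split {+[1+ a ]} {+ b} {+ c} _ _ _ ()
      zs = split (0≤* (w₁≥0 w) (Conv-≥0 X)) (0≤* (w₂≥0 w) (Conv-≥0 Y)) (0≤* (w₃≥0 w) (Conv-≥0 Z))
             (trans (sym (affine-comb m c w₁ w₂ w₃ x y z p e)) (trans (cong ((w₁ + w₂ + w₃) *_) e₀) (*-zeroʳ (w₁ + w₂ + w₃))))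
      term : ∀ w {x} → Conv A x → w * (m + dot₂ c x) ≡ 0ℤ → w ⊡ x ≡ w ⊡ s
      term w X e with i*j≡0⇒i≡0∨j≡0 w e
      ... | inj₁ refl = refl
      ... | inj₂ e' = cong (w ⊡_) (Conv-vertex only X e')

  in-or-separated : ∀ {n} (R : Fin n → V2) t → Conv R t ⊎ (∃[ c ] (∀ j → 0ℤ < - dot₂ c (R j ⊟ t)))
  in-or-separated R t with gordan (λ j → R j ⊟ t)
  ... | inj₁ s = inj₂ s
  ... | inj₂ (i , j , k , w₁ , w₂ , w₃ , w , e) = inj₁ (mix w (gen i) (gen j) (gen k) (trans
        (by-ring² (w₁ ∷ w₂ ∷ w₃ ∷ []) (R i ∷ R j ∷ R k ∷ t ∷ []) (λ { (w₁ ∷ w₂ ∷ w₃ ∷ []) (x ∷ y ∷ z ∷ t ∷ []) →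
           (w₁ E.⊡ x E.⊞ w₂ E.⊡ y) E.⊞ w₃ E.⊡ z ≋
           ((w₁ E.⊡ (x E.⊟ t) E.⊞ w₂ E.⊡ (y E.⊟ t)) E.⊞ w₃ E.⊡ (z E.⊟ t)) E.⊞ (w₁ ⊕ w₂ ⊕ w₃) E.⊡ t }) refl refl)
        (trans (cong (_⊞ ((w₁ + w₂ + w₃) ⊡ t)) e)
          (cong₂ _,_ (+-identityˡ ((w₁ + w₂ + w₃) * proj₁ t)) (+-identityˡ ((w₁ + w₂ + w₃) * proj₂ t))))))

  br-affine : ∀ a b x → br a b x ≡ br a b 0₂ + dot₂ (proj₂ a - proj₂ b , proj₁ b - proj₁ a) x
  br-affine a b x = by-ring [] (a ∷ b ∷ x ∷ []) (λ { [] (a ∷ b ∷ x ∷ []) →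
    E.br a b x ≋ E.br a b (Κ 0ℤ , Κ 0ℤ) ⊕ E.dot₂ (proj₂ a E.⊖ proj₂ b , proj₁ b E.⊖ proj₁ a) x }) refl

  Conv-br : ∀ {n} {A : Fin n → V2} a b → (∀ i → 0ℤ ≤ br a b (A i)) → ∀ {p} → Conv A p → 0ℤ ≤ br a b p
  Conv-br {A = A} a b h {p} P = subst (0ℤ ≤_) (sym (br-affine a b p))
    (Conv-≥0 (br a b 0₂) (proj₂ a - proj₂ b , proj₁ b - proj₁ a) (λ i → subst (0ℤ ≤_) (br-affine a b (A i)) (h i)) P)

  Conv-br-bound : ∀ {n} {A : Fin n → V2} a b → ∃[ K ] (∀ {p} → Conv A p → 0ℤ ≤ K + br a b p)
  Conv-br-bound {A = A} a b with strict-lower-bound (λ i → br a b (A i))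
  ... | K , _ , h = K , λ {p} P → subst (0ℤ ≤_) (eq p)
      (Conv-≥0 (K + br a b 0₂) c (λ i → subst (0ℤ ≤_) (sym (eq (A i))) (0<⇒0≤ (h i))) P)
    where
    c = proj₂ a - proj₂ b , proj₁ b - proj₁ a
    eq : ∀ p → K + br a b 0₂ + dot₂ c p ≡ K + br a b p
    eq p = trans (+-assoc K (br a b 0₂) (dot₂ c p)) (cong (_+_ K) (sym (br-affine a b p)))

  br-aba : ∀ a b → br a b a ≡ 0ℤ
  br-aba a b = by-ring [] (a ∷ b ∷ []) (λ { [] (a ∷ b ∷ []) → E.br a b a ≋ Κ 0ℤ }) refl

  br-abb : ∀ a b → br a b b ≡ 0ℤ
  br-abb a b = by-ring [] (a ∷ b ∷ []) (λ { [] (a ∷ b ∷ []) → E.br a b b ≋ Κ 0ℤ }) refl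

  module _ {n} {A : Fin n → V2} (m : ℤ) (c : V2) (A≥0 : ∀ i → 0ℤ ≤ m + dot₂ c (A i)) where

    private
      g : V2 → ℤ
      g x = m + dot₂ c x

      attained? : ∀ i → 0ℤ < g (A i) ⊎ g (A i) ≡ 0ℤ
      attained? i = case sgn (g (A i)) of λ
        { (is+ p) → inj₁ p
        ; (is0 e) → inj₂ e
        ; (is- p) → ¬neg p (A≥0 i) }

      other? : ∀ i j → (g (A j) ≡ 0ℤ → A j ≡ A i) ⊎ (g (A j) ≡ 0ℤ × ¬ A i ≡ A j)
      other? i j = case (g (A j) ≟ 0ℤ) of λ
        { (no ¬e) → inj₁ λ e → ⊥-elim (¬e e)
        ; (yes e) → case ≡-dec _≟_ _≟_ (A j) (A i) of λ
            { (yes q) → inj₁ λ _ → q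
            ; (no ¬q) → inj₂ (e , ¬q ∘ sym) } }

      shift : ∀ x → g x - 1ℤ ≡ m - 1ℤ + dot₂ c x
      shift x = lem m (dot₂ c x)
        where
        lem : ∀ x y → x + y - 1ℤ ≡ x - 1ℤ + y
        lem = solve-∀

    -- With no generator on the supporting line, integrality would make the functional at least one
    -- on the whole hull; with a single generator there, the face would be that one point. Both
    -- contradict the presence of `a` and `b`.
    Conv-edge : ∀ {a b} → ¬ a ≡ b → Conv A a → Conv A b → g a ≡ 0ℤ → g b ≡ 0ℤ →
      ∃[ i ] ∃[ j ] (¬ A i ≡ A j × g (A i) ≡ 0ℤ × g (A j) ≡ 0ℤ)
    Conv-edge {a} {b} a≢b a∈ b∈ ga gb = case ∀-or-∃ attained? of λ
      { (inj₁ all>0) → case subst (λ t → 0ℤ ≤ t - 1ℤ) ga (subst (0ℤ ≤_) (sym (shift a))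
                         (Conv-≥0 (m - 1ℤ) c (λ i → subst (0ℤ ≤_) (shift (A i)) (0<⇒0≤-1 (all>0 i))) a∈)) of λ ()
      ; (inj₂ (i , eᵢ)) → case ∀-or-∃ (other? i) of λ
          { (inj₂ (j , eⱼ , i≢j)) → i , j , i≢j , eᵢ , eⱼ
          ; (inj₁ only) → ⊥-elim (a≢b (trans (Conv-vertex m c A≥0 only a∈ ga) (sym (Conv-vertex m c A≥0 only b∈ gb)))) } }

-- Walking through adjacent unimodular triangles

module Walks where
  open import Data.Vec using ([]; _∷_)
  open Plane
  open Convexity
  open PlaneOps _+_ _*_ -_

  divide : ∀ {N} → 0ℤ < N → ∀ X → ∃[ ρ ] ∃[ t ] (X ≡ ρ + t * N × 0ℤ ≤ ρ × 0ℤ < N - ρ)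
  divide {+0} (+<+ ())
  divide {+[1+ n ]} _ X = + (X %ℕ suc n) , X /ℕ suc n , a≡a%ℕn+[a/ℕn]*n X (suc n) , +≤+ ℕ.z≤n ,
    <⇒0< (+<+ (n%ℕd<d X (suc n)))

  ⊞-drop : ∀ {k} y v → k ≡ 0ℤ → y ⊞ k ⊡ v ≡ y
  ⊞-drop y v refl = cong₂ _,_ (+-identityʳ (proj₁ y)) (+-identityʳ (proj₂ y))

  -- As `br a b q ≡ 1`, the lattice points on the line at depth one are spaced by `b ⊟ a`, and the
  -- triangle `a b s` cuts out of it a segment of `(N - 1) / N` times that length. In units of one
  -- N-th the offset of a lattice point is a residue `ρ ≤ N - 1`, so one always fits: its weights
  -- are `N - ρ - 1`, `ρ` and `1`.
  below-edge : ∀ {n} {A : Fin n → V2} a b q s → br a b q ≡ 1ℤ → Conv A a → Conv A b → Conv A s →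
    0ℤ < - br a b s → ∃[ p ] (Conv A p × br a b p ≡ -1ℤ)
  below-edge a b q s e a∈ b∈ s∈ N>0 with divide N>0 (- br a s q)
  ... | ρ , t , eρ , 0≤ρ , ρ<N = p , mix (weights (0<⇒0≤-1 ρ<N) 0≤ρ (+≤+ ℕ.z≤n) (subst (0ℤ <_) (sum N ρ) N>0)) a∈ b∈ s∈
        (trans (by-ring² (ρ ∷ t ∷ []) (a ∷ b ∷ q ∷ s ∷ []) (λ { (ρ ∷ t ∷ []) (a ∷ b ∷ q ∷ s ∷ []) →
            let N = ⊝ E.br a b s ; w = (N E.⊖ ρ) ⊕ Κ -1ℤ in
            (w E.⊡ a E.⊞ ρ E.⊡ b) E.⊞ Κ 1ℤ E.⊡ s ≋
            ((w ⊕ ρ) ⊕ Κ 1ℤ) E.⊡ (a E.⊟ (q E.⊟ a) E.⊞ (⊝ t) E.⊡ (b E.⊟ a))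
              E.⊞ (Κ 1ℤ E.⊖ E.br a b q) E.⊡ (s E.⊟ a) E.⊞ (⊝ ((⊝ E.br a s q) E.⊖ (ρ ⊕ t ⊗ N))) E.⊡ (b E.⊟ a) }) refl refl)
          (trans (⊞-drop _ (b ⊟ a) (cong -_ (0-from-≡ eρ))) (⊞-drop _ (s ⊟ a) (0-from-≡ (sym e))))) ,
        trans (by-ring (t ∷ []) (a ∷ b ∷ q ∷ []) (λ { (t ∷ []) (a ∷ b ∷ q ∷ []) →
          E.br a b (a E.⊟ (q E.⊟ a) E.⊞ (⊝ t) E.⊡ (b E.⊟ a)) ≋ ⊝ E.br a b q }) refl) (cong -_ e)
    where
    N = - br a b s
    p = a ⊟ (q ⊟ a) ⊞ (- t) ⊡ (b ⊟ a)
    sum : ∀ N ρ → N ≡ N - ρ - 1ℤ + ρ + 1ℤ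
    sum = solve-∀

  Common : ∀ {n} (A R : Fin n → V2) → Set
  Common A R = ∃[ p ] (Conv A p × Conv R p)

  -- All segments from a vertex of `R` in `U` to one in `L` cross the line `ab` strictly between `a`
  -- and `b`. The sets are parameters, not defined by `ab`: a walk keeps them fixed while `ab`
  -- changes, which makes its successive crossings comparable.
  record Gate {n} (A R : Fin n → V2) (U L : Fin n → Set) (a b : V2) : Set where
    field
      a∈ : Conv A a
      b∈ : Conv A b
      up : ∀ {u} → U u → 0ℤ < br a b (R u)
      down : ∀ {l} → L l → 0ℤ < - br a b (R l)
      left : ∀ {u l} → U u → L l → 0ℤ < - br (R u) (R l) a
      right : ∀ {u l} → U u → L l → 0ℤ < br (R u) (R l) b
  open Gate

  -- The point where the segment ul meets the line through p parallel to ab lies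
  -- on the side of p determined by the sign of c on b - a.
  side-identity : ∀ c a b p u l → br u l p * dot₂ c (b ⊟ a) ≡
    (br a b u - br a b p) * (- dot₂ c (l ⊟ p)) + (- (br a b l - br a b p)) * (- dot₂ c (u ⊟ p))
  side-identity c a b p u l = by-ring [] (c ∷ a ∷ b ∷ p ∷ u ∷ l ∷ []) (λ { [] (c ∷ a ∷ b ∷ p ∷ u ∷ l ∷ []) →
    E.br u l p ⊗ E.dot₂ c (b E.⊟ a) ≋
    (E.br a b u E.⊖ E.br a b p) ⊗ (⊝ E.dot₂ c (l E.⊟ p)) ⊕ (⊝ (E.br a b l E.⊖ E.br a b p)) ⊗ (⊝ E.dot₂ c (u E.⊟ p)) }) refl

  signs-from-product : ∀ {x k} → 0ℤ < x * k → (0ℤ < k → 0ℤ < x) × (0ℤ < - k → 0ℤ < - x)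
  signs-from-product {x} {k} p =
    (λ q → 0<*-cancel q (subst (0ℤ <_) (*-comm x k) p)) ,
    (λ q → 0<*-cancel q (subst (0ℤ <_) (lem x k) p))
    where
    lem : ∀ x k → x * k ≡ - k * - x
    lem = solve-∀

  gate-flip : ∀ {n} {A R : Fin n → V2} {U L a b} → Gate A R U L a b → Gate A R L U b a
  gate-flip {R = R} {a = a} {b} G = record
    { a∈ = b∈ G
    ; b∈ = a∈ G
    ; up = λ {l} l∈ → subst (0ℤ <_) (lem a b (R l)) (down G l∈)
    ; down = λ {u} u∈ → subst (0ℤ <_) (lem' b a (R u)) (up G u∈)
    ; left = λ {l} {u} l∈ u∈ → subst (0ℤ <_) (lem' (R l) (R u) b) (right G u∈ l∈)
    ; right = λ {l} {u} l∈ u∈ → subst (0ℤ <_) (lem (R u) (R l) a) (left G u∈ l∈)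
    }
    where
    lem : ∀ a b x → - br a b x ≡ br b a x
    lem a b x = by-ring [] (a ∷ b ∷ x ∷ []) (λ { [] (a ∷ b ∷ x ∷ []) → ⊝ E.br a b x ≋ E.br b a x }) refl
    lem' : ∀ a b x → br b a x ≡ - br a b x
    lem' a b x = sym (lem a b x)

  module Walk {n} (A R : Fin n → V2) (U L : Fin n → Set) {u₀ l₀ : Fin n} (u₀∈ : U u₀) (l₀∈ : L l₀) where

    private
      G = Gate A R U L

    -- `p` is the apex of the unimodular triangle beyond `ab`. Vertices in `L` have integer depth at
    -- least one, so every segment from `U` to `L` still reaches the line through `p` parallel to
    -- `ab`. The functional separating `p` from `R` puts all these meeting points on one side of
    -- `p`, and that side decides which of `pb` and `ap` is crossed next.
    step : ∀ {a b p} → G a b → Conv A p → br a b p ≡ -1ℤ → (∃[ c ] (∀ j → 0ℤ < - dot₂ c (R j ⊟ p))) → G p b ⊎ G a p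
    step {a} {b} {p} g p∈ e (c , sep) = case sgn κ of λ
      { (is+ k) → inj₂ (replace-b k)
      ; (is0 k) → 0<0-absurd (subst (0ℤ <_) (trans (cong (br (R u₀) (R l₀) p *_) k) (*-zeroʳ (br (R u₀) (R l₀) p))) (key u₀∈ l₀∈))
      ; (is- k) → inj₁ (replace-a k) }
      where
      κ = dot₂ c (b ⊟ a)
      -m>0 : 0ℤ < - br a b p
      -m>0 = subst (λ t → 0ℤ < - t) (sym e) (+<+ ℕ.z<s)
      up-1 : ∀ {u} → U u → 0ℤ < br a b (R u) - br a b p
      up-1 {u} U∋u = subst (λ t → 0ℤ < br a b (R u) - t) (sym e) (0<+ (up g U∋u) (+<+ ℕ.z<s))
      down-1 : ∀ {l} → L l → 0ℤ ≤ - br a b (R l) + br a b p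
      down-1 {l} L∋l = subst (λ t → 0ℤ ≤ - br a b (R l) + t) (sym e) (0<⇒0≤-1 (down g L∋l))
      lem : ∀ x y → - x + y ≡ - (x - y)
      lem = solve-∀
      key : ∀ {u l} → U u → L l → 0ℤ < br (R u) (R l) p * κ
      key {u} {l} U∋u L∋l = subst (0ℤ <_) (sym (side-identity c a b p (R u) (R l)))
        (0<+≤ (0<* (up-1 U∋u) (sep l)) (0≤* (subst (0ℤ ≤_) (lem (br a b (R l)) (br a b p)) (down-1 L∋l)) (0<⇒0≤ (sep u))))
      width>0 : ∀ {u l} → U u → L l → 0ℤ < br a b (R u) - br a b (R l)
      width>0 U∋u L∋l = 0<+ (up g U∋u) (down g L∋l)

      replace-a : 0ℤ < - κ → G p b
      replace-a k = record
        { a∈ = p∈ ; b∈ = b∈ g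
        ; up = λ {u} U∋u → 0<*-cancel (width>0 U∋u l₀∈) (subst (0ℤ <_) (sym (up-id (R u) (R l₀)))
            (0<+ (0<* -m>0 (right g U∋u l₀∈)) (0<* (up g U∋u) (0<+ (right g U∋u l₀∈) (p-left U∋u l₀∈)))))
        ; down = λ {l} L∋l → 0<*-cancel (width>0 u₀∈ L∋l) (subst (0ℤ <_) (sym (down-id (R u₀) (R l)))
            (0≤+< (0≤* (down-1 L∋l) (0<⇒0≤ (0<+ (right g u₀∈ L∋l) (p-left u₀∈ L∋l)))) (0<* -m>0 (p-left u₀∈ L∋l))))
        ; left = p-left ; right = right g }
        where
        p-left : ∀ {u l} → U u → L l → 0ℤ < - br (R u) (R l) p
        p-left {u} {l} U∋u L∋l = proj₂ (signs-from-product {br (R u) (R l) p} {κ} (key U∋u L∋l)) k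
        up-id : ∀ u l → (br a b u - br a b l) * br p b u ≡ - br a b p * br u l b + br a b u * (br u l b - br u l p)
        up-id u l = by-ring [] (a ∷ b ∷ p ∷ u ∷ l ∷ []) (λ { [] (a ∷ b ∷ p ∷ u ∷ l ∷ []) →
          (E.br a b u E.⊖ E.br a b l) ⊗ E.br p b u ≋
          (⊝ E.br a b p) ⊗ E.br u l b ⊕ E.br a b u ⊗ (E.br u l b E.⊖ E.br u l p) }) refl
        down-id : ∀ u l → (br a b u - br a b l) * (- br p b l) ≡
          (- br a b l + br a b p) * (br u l b - br u l p) + - br a b p * (- br u l p)
        down-id u l = by-ring [] (a ∷ b ∷ p ∷ u ∷ l ∷ []) (λ { [] (a ∷ b ∷ p ∷ u ∷ l ∷ []) →
          (E.br a b u E.⊖ E.br a b l) ⊗ (⊝ E.br p b l) ≋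
          ((⊝ E.br a b l) ⊕ E.br a b p) ⊗ (E.br u l b E.⊖ E.br u l p) ⊕ (⊝ E.br a b p) ⊗ (⊝ E.br u l p) }) refl

      replace-b : 0ℤ < κ → G a p
      replace-b k = record
        { a∈ = a∈ g ; b∈ = p∈
        ; up = λ {u} U∋u → 0<*-cancel (width>0 U∋u l₀∈) (subst (0ℤ <_) (sym (up-id (R u) (R l₀)))
            (0<+ (0<* -m>0 (left g U∋u l₀∈)) (0<* (up g U∋u) (0<+ (p-right U∋u l₀∈) (left g U∋u l₀∈)))))
        ; down = λ {l} L∋l → 0<*-cancel (width>0 u₀∈ L∋l) (subst (0ℤ <_) (sym (down-id (R u₀) (R l)))
            (0≤+< (0≤* (down-1 L∋l) (0<⇒0≤ (0<+ (p-right u₀∈ L∋l) (left g u₀∈ L∋l)))) (0<* -m>0 (p-right u₀∈ L∋l))))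
        ; left = left g ; right = p-right }
        where
        p-right : ∀ {u l} → U u → L l → 0ℤ < br (R u) (R l) p
        p-right {u} {l} U∋u L∋l = proj₁ (signs-from-product {br (R u) (R l) p} {κ} (key U∋u L∋l)) k
        up-id : ∀ u l → (br a b u - br a b l) * br a p u ≡ - br a b p * (- br u l a) + br a b u * (br u l p - br u l a)
        up-id u l = by-ring [] (a ∷ b ∷ p ∷ u ∷ l ∷ []) (λ { [] (a ∷ b ∷ p ∷ u ∷ l ∷ []) →
          (E.br a b u E.⊖ E.br a b l) ⊗ E.br a p u ≋
          (⊝ E.br a b p) ⊗ (⊝ E.br u l a) ⊕ E.br a b u ⊗ (E.br u l p E.⊖ E.br u l a) }) refl
        down-id : ∀ u l → (br a b u - br a b l) * (- br a p l) ≡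
          (- br a b l + br a b p) * (br u l p - br u l a) + - br a b p * br u l p
        down-id u l = by-ring [] (a ∷ b ∷ p ∷ u ∷ l ∷ []) (λ { [] (a ∷ b ∷ p ∷ u ∷ l ∷ []) →
          (E.br a b u E.⊖ E.br a b l) ⊗ (⊝ E.br a p l) ≋
          ((⊝ E.br a b l) ⊕ E.br a b p) ⊗ (E.br u l p E.⊖ E.br u l a) ⊕ (⊝ E.br a b p) ⊗ E.br u l p }) refl

    private
      -- `depth / width` is the fraction of the segment from `R l₀` to `R u₀` that precedes its
      -- crossing with the line `ab`.
      width depth : V2 → V2 → ℤ
      width a b = br a b (R u₀) - br a b (R l₀)
      depth a b = - br a b (R l₀)

      K₁ = Conv-br-bound {A = A} (R u₀) (R l₀)
      K₂ = Conv-br-bound {A = A} (R l₀) (R u₀)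
      M : ℤ
      M = proj₁ K₁ + proj₁ K₂

      width>0 : ∀ {a b} → G a b → 0ℤ < width a b
      width>0 g = 0<+ (up g u₀∈) (down g l₀∈)

      -- The width is the sum of the distances of `a` and `b` from the line through `R u₀` and
      -- `R l₀`, in determinant units. These are bounded on the hull of `A`, so one `M` serves all
      -- gates.
      width≤M : ∀ {a b} → G a b → 0ℤ ≤ M - width a b
      width≤M {a} {b} g = subst (0ℤ ≤_)
        (by-ring (proj₁ K₁ ∷ proj₁ K₂ ∷ []) (a ∷ b ∷ R u₀ ∷ R l₀ ∷ []) (λ { (k₁ ∷ k₂ ∷ []) (a ∷ b ∷ u ∷ l ∷ []) →
          (k₁ ⊕ E.br u l a) ⊕ (k₂ ⊕ E.br l u b) ≋ (k₁ ⊕ k₂) E.⊖ (E.br a b u E.⊖ E.br a b l) }) refl)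
        (0≤+ (proj₂ K₁ (a∈ g)) (proj₂ K₂ (b∈ g)))

      -- The crossing parameter of the segment l₀u₀ decreases by at least 1/M² in each step.
      progress : ∀ k {n D n' D'} → 0ℤ < D → 0ℤ < D' → 0ℤ ≤ M - D → 0ℤ ≤ M - D' →
        0ℤ < n * D' - n' * D → 0ℤ ≤ (1ℤ + k) * D - n * (M * M) → 0ℤ ≤ k * D' - n' * (M * M)
      progress k {n} {D} {n'} {D'} D>0 D'>0 D≤M D'≤M δ h = 0≤*-cancel D>0 (subst (0ℤ ≤_) (lem k n D n' D' M)
        (0≤+ (0≤+ (0≤* (0<⇒0≤ D'>0) h) (0≤* (0<⇒0≤-1 δ) (0≤* M≥0 M≥0))) (0≤+ (0≤* M≥0 D≤M) (0≤* (0<⇒0≤ D>0) D'≤M))))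
        where
        M≥0 : 0ℤ ≤ M
        M≥0 = subst (0ℤ ≤_) (lem₀ D M) (0≤+ (0<⇒0≤ D>0) D≤M)
          where
          lem₀ : ∀ D M → D + (M - D) ≡ M
          lem₀ = solve-∀
        lem : ∀ k n D n' D' M → D' * ((1ℤ + k) * D - n * (M * M)) + (n * D' - n' * D - 1ℤ) * (M * M)
          + (M * (M - D) + D * (M - D')) ≡ D * (k * D' - n' * (M * M))
        lem = solve-∀

    Exit : Set
    Exit = ∃[ a ] ∃[ b ] ∃[ q ] (G a b × br a b q ≡ 1ℤ × (∀ i → 0ℤ ≤ br a b (A i)))

    private
      -- The fuel bounds the crossing parameter: `depth / width` is at most `k / M²`. At `k` zero
      -- this contradicts the positive depth of `R l₀`.
      go : ∀ k a b q → br a b q ≡ 1ℤ → G a b → 0ℤ ≤ + k * width a b - depth a b * (M * M) → Common A R ⊎ Exit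
      go zero a b q e g h = ¬neg {x = 0ℤ * width a b - depth a b * (M * M)}
          (subst (0ℤ <_) (lem (width a b) (depth a b) (M * M)) (0<* (down g l₀∈) (0<* M>0 M>0))) h
        where
        lem : ∀ w d m → d * m ≡ - (0ℤ * w - d * m)
        lem = solve-∀
        lem₀ : ∀ D M → D + (M - D) ≡ M
        lem₀ = solve-∀
        M>0 : 0ℤ < M
        M>0 = subst (0ℤ <_) (lem₀ (width a b) M) (0<+≤ (width>0 g) (width≤M g))
      go (suc k) a b q e g h = case ∀-or-∃ (λ i → 0≤⊎ (br a b (A i))) of λ
        { (inj₁ all) → inj₂ (a , b , q , g , e , all)
        ; (inj₂ (s , s<0)) → case below-edge a b q (A s) e (a∈ g) (b∈ g) (gen s) s<0 of λ
          { (p , p∈ , m) → case in-or-separated R p of λ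
            { (inj₁ p∈R) → inj₁ (p , p∈ , p∈R)
            ; (inj₂ sep) → case step g p∈ m sep of λ
              -- The discarded end becomes the apex of the new gate, since the triangle `a b p` is
              -- unimodular as well.
              { (inj₁ g') → go k p b a (trans (flip₁ p) (cong -_ m)) g'
                  (progress (+ k) {depth a b} {width a b} {depth p b} {width p b} (width>0 g) (width>0 g') (width≤M g) (width≤M g')
                    (subst (0ℤ <_) (gain₁ p) (0<* (subst (λ t → 0ℤ < - t) (sym m) (+<+ ℕ.z<s)) (right g u₀∈ l₀∈))) h)
              ; (inj₂ g') → go k a p b (trans (flip₂ p) (cong -_ m)) g'
                  (progress (+ k) {depth a b} {width a b} {depth a p} {width a p} (width>0 g) (width>0 g') (width≤M g) (width≤M g')
                    (subst (0ℤ <_) (gain₂ p) (0<* (subst (λ t → 0ℤ < - t) (sym m) (+<+ ℕ.z<s)) (left g u₀∈ l₀∈))) h) } } } }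
        where
        flip₁ : ∀ p → br p b a ≡ - br a b p
        flip₁ p = by-ring [] (a ∷ b ∷ p ∷ []) (λ { [] (a ∷ b ∷ p ∷ []) → E.br p b a ≋ ⊝ E.br a b p }) refl
        flip₂ : ∀ p → br a p b ≡ - br a b p
        flip₂ p = by-ring [] (a ∷ b ∷ p ∷ []) (λ { [] (a ∷ b ∷ p ∷ []) → E.br a p b ≋ ⊝ E.br a b p }) refl
        gain₁ : ∀ p → - br a b p * br (R u₀) (R l₀) b ≡ depth a b * width p b - depth p b * width a b
        gain₁ p = by-ring [] (a ∷ b ∷ p ∷ R u₀ ∷ R l₀ ∷ []) (λ { [] (a ∷ b ∷ p ∷ u ∷ l ∷ []) →
          (⊝ E.br a b p) ⊗ E.br u l b ≋ (⊝ E.br a b l) ⊗ (E.br p b u E.⊖ E.br p b l) E.⊖ (⊝ E.br p b l) ⊗ (E.br a b u E.⊖ E.br a b l) }) refl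
        gain₂ : ∀ p → - br a b p * (- br (R u₀) (R l₀) a) ≡ depth a b * width a p - depth a p * width a b
        gain₂ p = by-ring [] (a ∷ b ∷ p ∷ R u₀ ∷ R l₀ ∷ []) (λ { [] (a ∷ b ∷ p ∷ u ∷ l ∷ []) →
          (⊝ E.br a b p) ⊗ (⊝ E.br u l a) ≋ (⊝ E.br a b l) ⊗ (E.br a p u E.⊖ E.br a p l) E.⊖ (⊝ E.br a p l) ⊗ (E.br a b u E.⊖ E.br a b l) }) refl

    walk : ∀ a b q → br a b q ≡ 1ℤ → G a b → Common A R ⊎ Exit
    walk a b q e g = go ∣ N ∣ a b q e g (subst (λ t → 0ℤ ≤ t * width a b - N) (sym (0≤i⇒+∣i∣≡i N≥0))
        (subst (0ℤ ≤_) (lem N (width a b)) (0≤* N≥0 (0<⇒0≤-1 (width>0 g)))))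
      where
      N = depth a b * (M * M)
      lem₀ : ∀ D M → D + (M - D) ≡ M
      lem₀ = solve-∀
      M≥0 : 0ℤ ≤ M
      M≥0 = subst (0ℤ ≤_) (lem₀ (width a b) M) (0≤+ (0<⇒0≤ (width>0 g)) (width≤M g))
      N≥0 : 0ℤ ≤ N
      N≥0 = 0≤* (0<⇒0≤ (down g l₀∈)) (0≤* M≥0 M≥0)
      lem : ∀ N w → N * (w - 1ℤ) ≡ N * w - N
      lem = solve-∀

-- Crossing positions in two gates and the edges of R beyond them

module Edges where
  open import Data.Vec using ([]; _∷_)
  open Plane
  open Convexity
  open Walks
  open PlaneOps _+_ _*_ -_
  open Gate

  record Crossing (a b g f : V2) : Set where
    constructor crossing
    field
      left>0 : 0ℤ < - br g f a
      right>0 : 0ℤ < br g f b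
      above : 0ℤ < br a b g
      below : 0ℤ < - br a b f
  open Crossing

  right-of-gate : ∀ a b g f → br g f b ≡ (br a b g + - br a b f) - (- br g f a)
  right-of-gate a b g f = by-ring [] (a ∷ b ∷ g ∷ f ∷ []) (λ { [] (a ∷ b ∷ g ∷ f ∷ []) →
    E.br g f b ≋ (E.br a b g ⊕ (⊝ E.br a b f)) E.⊖ (⊝ E.br g f a) }) refl

  -- `- br g f a` over the width is the position of the crossing in `ab`. The functional of the
  -- second line, measured from `a`, grows along `ab` at rate `D = det (b ⊟ a) (b' ⊟ a')`;
  -- interpolating it between `g` and `f` at the crossing gives the right side.
  position : ∀ a b a' b' g f → det (b ⊟ a) (b' ⊟ a') * (- br g f a) ≡
    (- br a b f) * (- br a' b' g + br a' b' a) - br a b g * (br a' b' f - br a' b' a)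
  position a b a' b' g f = by-ring [] (a ∷ b ∷ a' ∷ b' ∷ g ∷ f ∷ []) (λ { [] (a ∷ b ∷ a' ∷ b' ∷ g ∷ f ∷ []) →
    E.det (b E.⊟ a) (b' E.⊟ a') ⊗ (⊝ E.br g f a) ≋
    (⊝ E.br a b f) ⊗ ((⊝ E.br a' b' g) ⊕ E.br a' b' a) E.⊖ E.br a b g ⊗ (E.br a' b' f E.⊖ E.br a' b' a) }) refl

  along : ∀ k a b x → br a b (x ⊞ k ⊡ (b ⊟ a)) ≡ br a b x
  along k a b x = by-ring (k ∷ []) (a ∷ b ∷ x ∷ []) (λ { (k ∷ []) (a ∷ b ∷ x ∷ []) →
    E.br a b (x E.⊞ k E.⊡ (b E.⊟ a)) ≋ E.br a b x }) refl

  across : ∀ k a b a' b' x → - br a' b' (x ⊞ k ⊡ (b ⊟ a)) ≡ - br a' b' x + k * det (b ⊟ a) (b' ⊟ a')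
  across k a b a' b' x = by-ring (k ∷ []) (a ∷ b ∷ a' ∷ b' ∷ x ∷ []) (λ { (k ∷ []) (a ∷ b ∷ a' ∷ b' ∷ x ∷ []) →
    ⊝ E.br a' b' (x E.⊞ k E.⊡ (b E.⊟ a)) ≋ (⊝ E.br a' b' x) ⊕ k ⊗ E.det (b E.⊟ a) (b' E.⊟ a') }) refl

  det-antisym : ∀ x y → det x y ≡ - det y x
  det-antisym x y = by-ring [] (x ∷ y ∷ []) (λ { [] (x ∷ y ∷ []) → E.det x y ≋ ⊝ E.det y x }) refl

  positions-clash⁺ : ∀ D k w₁ w₂ P P' X → 0ℤ < D * ((w₂ - P') * w₁ + P * w₂) + X → 0ℤ ≤ (k - 1ℤ) * D * (w₁ * w₂) →
    D * P * w₂ - D * P' * w₁ + w₁ * w₂ * (k * D) + X ≡ 0ℤ → ⊥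
  positions-clash⁺ D k w₁ w₂ P P' X p q e = 0<0-absurd (subst (0ℤ <_) e (subst (0ℤ <_) (lem D k w₁ w₂ P P' X) (0<+≤ p q)))
    where
    lem : ∀ D k w₁ w₂ P P' X → D * ((w₂ - P') * w₁ + P * w₂) + X + (k - 1ℤ) * D * (w₁ * w₂) ≡
      D * P * w₂ - D * P' * w₁ + w₁ * w₂ * (k * D) + X
    lem = solve-∀

  positions-clash⁻ : ∀ D k w₁ w₂ P P' X → 0ℤ < - D * (P' * w₁ + (w₁ - P) * w₂) + X → 0ℤ ≤ (- k - 1ℤ) * (- D) * (w₁ * w₂) →
    D * P * w₂ - D * P' * w₁ + w₁ * w₂ * (k * D) + X ≡ 0ℤ → ⊥
  positions-clash⁻ D k w₁ w₂ P P' X p q e = 0<0-absurd (subst (0ℤ <_) e (subst (0ℤ <_) (lem D k w₁ w₂ P P' X) (0<+≤ p q)))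
    where
    lem : ∀ D k w₁ w₂ P P' X → - D * (P' * w₁ + (w₁ - P) * w₂) + X + (- k - 1ℤ) * (- D) * (w₁ * w₂) ≡
      D * P * w₂ - D * P' * w₁ + w₁ * w₂ * (k * D) + X
    lem = solve-∀

  -- P/w₁ and P'/w₂ are the positions in a gate of two segments; the hypotheses
  -- force their distance to be at least |k|, but both lie in the open unit interval.
  positions-clash : ∀ D k w₁ w₂ P P' X →
    D * P * w₂ - D * P' * w₁ + w₁ * w₂ * (k * D) + X ≡ 0ℤ → 0ℤ < w₁ → 0ℤ < w₂ → 0ℤ < P → 0ℤ < P' →
    0ℤ < w₁ - P → 0ℤ < w₂ - P' → 0ℤ ≤ X → 0ℤ < k * D → ⊥
  positions-clash D k w₁ w₂ P P' X e w₁>0 w₂>0 P>0 P'>0 Q₁>0 Q₂>0 X≥0 K>0 = by-sign (sgn D)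
    where
    w≥0 : 0ℤ ≤ w₁ * w₂
    w≥0 = 0<⇒0≤ (0<* w₁>0 w₂>0)
    neg-neg : ∀ k D → k * D ≡ - D * - k
    neg-neg = solve-∀
    by-sign : Sgn D → ⊥
    by-sign (is+ D>0) = positions-clash⁺ D k w₁ w₂ P P' X
        (0<+≤ (0<* D>0 (0<+ (0<* Q₂>0 w₁>0) (0<* P>0 w₂>0))) X≥0)
        (0≤* (0≤* (0<⇒0≤-1 (0<*-cancel {D} {k} D>0 (subst (0ℤ <_) (*-comm k D) K>0))) (0<⇒0≤ D>0)) w≥0) e
    by-sign (is0 D≡0) = 0<0-absurd (subst (0ℤ <_) (trans (cong (k *_) D≡0) (*-zeroʳ k)) K>0)
    by-sign (is- D<0) = positions-clash⁻ D k w₁ w₂ P P' X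
        (0<+≤ (0<* D<0 (0<+ (0<* P'>0 w₁>0) (0<* Q₁>0 w₂>0))) X≥0)
        (0≤* (0≤* (0<⇒0≤-1 (0<*-cancel { - D} { - k} D<0 (subst (0ℤ <_) (neg-neg k D) K>0))) (0<⇒0≤ D<0)) w≥0) e
  positions-identity : ∀ K K' m t s m' θ →
    (t * (s + θ) - m * (m' - θ)) * (m + (t + K')) - ((t + K') * ((s + K) + θ) - m * (m' - θ)) * (m + t)
     + (m + t) * (m + (t + K')) * K + m * (K' * (s + m') - K * (m + t)) ≡ 0ℤ
  positions-identity = solve-∀

  positions-equation : ∀ D P P' w₁ w₂ K X {α α'} → D * P ≡ α → D * P' ≡ α' →
    α * w₂ - α' * w₁ + w₁ * w₂ * K + X ≡ 0ℤ → D * P * w₂ - D * P' * w₁ + w₁ * w₂ * K + X ≡ 0ℤ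
  positions-equation D P P' w₁ w₂ K X refl refl e = e

  -- Moving `g` parallel to `ab` preserves its distance to `ab`, and moving `f` parallel to `a'b'`
  -- preserves its distance to `a'b'`; the other two distances grow by `k * D` and `- (k' * D)`. The
  -- last hypothesis says that the width across `ab` grows by at least the same proportion as the
  -- width across `a'b'`. This pushes the two crossings of `ab` apart by at least the length of
  -- `ab`.
  no-crossing : ∀ a b a' b' g f k k' {g' f'} → g' ≡ g ⊞ k ⊡ (b ⊟ a) → f' ≡ f ⊞ k' ⊡ (b' ⊟ a') →
    Crossing a b g f → Crossing a b g' f' →
    let D = det (b ⊟ a) (b' ⊟ a') in 0ℤ < k * D → 0ℤ < - (k' * D) →
    0ℤ ≤ (- (k' * D)) * (- br a' b' g + br a' b' f) - k * D * (br a b g + - br a b f) → ⊥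
  no-crossing a b a' b' g f k k' {g'} {f'} eg ef X X' K>0 K'>0 h =
    positions-clash D k (m + t) (m + (t + K')) (- br g f a) (- br g' f' a) Y
      (positions-equation D (- br g f a) (- br g' f' a) (m + t) (m + (t + K')) (k * D) Y
        (position a b a' b' g f) eP' (positions-identity (k * D) K' m t s m' θ))
      (0<+ (above X) (below X)) (0<+ (above X) (0<+ (below X) K'>0)) (left>0 X) (left>0 X')
      (subst (0ℤ <_) (right-of-gate a b g f) (right>0 X))
      (subst (0ℤ <_) (trans (right-of-gate a b g' f') (cong (_- (- br g' f' a)) (cong₂ _+_ em et))) (right>0 X'))
      (0≤* (0<⇒0≤ (above X)) h) K>0
    where
    D = det (b ⊟ a) (b' ⊟ a')
    K' = - (k' * D)
    m = br a b g
    t = - br a b f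
    s = - br a' b' g
    m' = br a' b' f
    θ = br a' b' a
    Y = m * (K' * (s + m') - k * D * (m + t))
    em : br a b g' ≡ m
    em = trans (cong (br a b) eg) (along k a b g)
    em' : br a' b' f' ≡ m'
    em' = trans (cong (br a' b') ef) (along k' a' b' f)
    es : - br a' b' g' ≡ s + k * D
    es = trans (cong (λ x → - br a' b' x) eg) (across k a b a' b' g)
    et : - br a b f' ≡ t + K'
    et = trans (cong (λ x → - br a b x) ef) (trans (across k' a' b' a b f)
      (cong (_+_ t) (trans (cong (k' *_) (det-antisym (b' ⊟ a') (b ⊟ a))) (sym (neg-distribʳ-* k' D)))))
    eP' : D * (- br g' f' a) ≡ (t + K') * ((s + k * D) + θ) - m * (m' - θ)
    eP' = trans (position a b a' b' g' f') (cong₂ _-_ (cong₂ (λ x y → x * (y + θ)) et es) (cong₂ (λ z w → z * (w - θ)) em em'))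

  +0* : ∀ x y {d} → d ≡ 0ℤ → x + y * d ≡ x
  +0* x y refl = trans (cong (_+_ x) (*-zeroʳ y)) (+-identityʳ x)

  shifted-position : ∀ k k' a b a' b' g f → det (b ⊟ a) (b' ⊟ a') ≡ 0ℤ → - br (g ⊞ k ⊡ (b ⊟ a)) (f ⊞ (- k') ⊡ (b' ⊟ a')) a ≡
    - br g f a + k * (- br a b f) + k' * (- det (b' ⊟ a') (g ⊟ a))
  shifted-position k k' a b a' b' g f e = trans
    (by-ring (k ∷ k' ∷ []) (a ∷ b ∷ a' ∷ b' ∷ g ∷ f ∷ []) (λ { (k ∷ k' ∷ []) (a ∷ b ∷ a' ∷ b' ∷ g ∷ f ∷ []) →
      ⊝ E.br (g E.⊞ k E.⊡ (b E.⊟ a)) (f E.⊞ (⊝ k') E.⊡ (b' E.⊟ a')) a ≋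
      ((⊝ E.br g f a) ⊕ k ⊗ (⊝ E.br a b f) ⊕ k' ⊗ (⊝ E.det (b' E.⊟ a') (g E.⊟ a))) ⊕ (k ⊗ k') ⊗ E.det (b E.⊟ a) (b' E.⊟ a') }) refl)
    (+0* (- br g f a + k * (- br a b f) + k' * (- det (b' ⊟ a') (g ⊟ a))) (k * k') e)

  -- `b ⊟ a` and `q ⊟ a` form a lattice basis, so the remaining coordinate of `v` is an integer.
  parallel : ∀ a b q v → br a b q ≡ 1ℤ → det (b ⊟ a) v ≡ 0ℤ → v ≡ det v (q ⊟ a) ⊡ (b ⊟ a)
  parallel a b q v e e₀ = trans
    (by-ring² [] (a ∷ b ∷ q ∷ v ∷ []) (λ { [] (a ∷ b ∷ q ∷ v ∷ []) → v ≋
      E.det v (q E.⊟ a) E.⊡ (b E.⊟ a) E.⊞ E.det (b E.⊟ a) v E.⊡ (q E.⊟ a) E.⊞ (Κ 1ℤ E.⊖ E.br a b q) E.⊡ v }) refl refl)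
    (trans (⊞-drop _ v (0-from-≡ (sym e))) (⊞-drop _ (q ⊟ a) e₀))

  -- `S` is a positive integer multiple of `m`, hence at least `m`. The shift `k * t + K' * S` is
  -- thus at least `m + t`, the full width of the gate.
  parallel-clash : ∀ m t P P' k K' S ε → P' ≡ P + k * t + K' * S → S ≡ - ε * m → 0ℤ < m → 0ℤ < t → 0ℤ < P →
    0ℤ < m + t - P' → 0ℤ < k → 0ℤ < K' → 0ℤ < S → ⊥
  parallel-clash m t P P' k K' S ε eP eS m>0 t>0 P>0 Q'>0 k>0 K'>0 S>0 =
    0<0-absurd (subst (0ℤ <_) (lem m t P k K' S)
      (0<+ (subst (λ x → 0ℤ < m + t - x) eP Q'>0) (0<+≤ (0<+≤ P>0 (0≤* (0<⇒0≤-1 k>0) (0<⇒0≤ t>0)))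
        (0≤+ (0≤* (0<⇒0≤-1 K'>0) (0<⇒0≤ S>0)) S≥m))))
    where
    -ε>0 : 0ℤ < - ε
    -ε>0 = 0<*-cancel {m} { - ε} m>0 (subst (0ℤ <_) (trans eS (*-comm (- ε) m)) S>0)
    S≥m : 0ℤ ≤ S - m
    S≥m = subst (λ x → 0ℤ ≤ x - m) (sym eS) (subst (0ℤ ≤_) (l m ε) (0≤* (0<⇒0≤-1 -ε>0) (0<⇒0≤ m>0)))
      where
      l : ∀ m ε → (- ε - 1ℤ) * m ≡ - ε * m - m
      l = solve-∀
    lem : ∀ m t P k K' S → m + t - (P + k * t + K' * S) + (P + (k - 1ℤ) * t + ((K' - 1ℤ) * S + (S - m))) ≡ 0ℤ
    lem = solve-∀

  flat-clash : ∀ a b a' b' q g f k k' → br a b q ≡ 1ℤ → det (b ⊟ a) (b' ⊟ a') ≡ 0ℤ → Crossing a b g f →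
    0ℤ < br (g ⊞ k ⊡ (b ⊟ a)) (f ⊞ (- k') ⊡ (b' ⊟ a')) b → 0ℤ < k → 0ℤ < k' → 0ℤ < - det (b' ⊟ a') (g ⊟ a) → ⊥
  flat-clash a b a' b' q g f k k' e D≡0 X Q'>0 k>0 k'>0 S>0 =
    parallel-clash (br a b g) (- br a b f) (- br g f a) (- br g' f' a) k k' (- det (b' ⊟ a') (g ⊟ a)) ε
      (shifted-position k k' a b a' b' g f D≡0) eS (above X) (below X) (left>0 X)
      (subst (0ℤ <_) eQ Q'>0) k>0 k'>0 S>0
    where
    g' f' : V2
    g' = g ⊞ k ⊡ (b ⊟ a)
    f' = f ⊞ (- k') ⊡ (b' ⊟ a')
    ε : ℤ
    ε = det (b' ⊟ a') (q ⊟ a)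
    eS : - det (b' ⊟ a') (g ⊟ a) ≡ - ε * br a b g
    eS = trans (cong (λ v → - det v (g ⊟ a)) (parallel a b q (b' ⊟ a') e D≡0)) (lem ε a b g)
      where
      lem : ∀ ε a b x → - det (ε ⊡ (b ⊟ a)) (x ⊟ a) ≡ - ε * br a b x
      lem ε a b x = by-ring (ε ∷ []) (a ∷ b ∷ x ∷ []) (λ { (ε ∷ []) (a ∷ b ∷ x ∷ []) →
        ⊝ E.det (ε E.⊡ (b E.⊟ a)) (x E.⊟ a) ≋ (⊝ ε) ⊗ E.br a b x }) refl
    et : - br a b f' ≡ - br a b f
    et = trans (across (- k') a' b' a b f) (+0* (- br a b f) (- k') (trans (det-antisym (b' ⊟ a') (b ⊟ a)) (cong -_ D≡0)))
    eQ : br g' f' b ≡ br a b g + - br a b f - (- br g' f' a)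
    eQ = trans (right-of-gate a b g' f') (cong (_- (- br g' f' a)) (cong₂ _+_ (along k a b g) et))

  -- R stands for a reflection z − B, so that corresponding edges of A and R are antiparallel.
  ParallelEdges : ∀ {n} (A R : Fin n → V2) → Set
  ParallelEdges A R = ∀ c i j → ¬ A i ≡ A j → (∀ l → 0ℤ ≤ dot₂ c (A i) - dot₂ c (A l)) → dot₂ c (A j) ≡ dot₂ c (A i) →
    ¬ R i ≡ R j × (∀ l → 0ℤ ≤ dot₂ c (R l) - dot₂ c (R i)) × dot₂ c (R j) ≡ dot₂ c (R i)

  br-normal : ∀ a b x y → dot₂ (proj₂ b - proj₂ a , proj₁ a - proj₁ b) x - dot₂ (proj₂ b - proj₂ a , proj₁ a - proj₁ b) y ≡ br a b y - br a b x
  br-normal a b x y = by-ring [] (a ∷ b ∷ x ∷ y ∷ []) (λ { [] (a ∷ b ∷ x ∷ y ∷ []) →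
    let c = proj₂ b E.⊖ proj₂ a , proj₁ a E.⊖ proj₁ b in
    E.dot₂ c x E.⊖ E.dot₂ c y ≋ E.br a b y E.⊖ E.br a b x }) refl

  ⊟-⊞ : ∀ x y → x ≡ y ⊞ (x ⊟ y)
  ⊟-⊞ x y = by-ring² [] (x ∷ y ∷ []) (λ { [] (x ∷ y ∷ []) → x ≋ y E.⊞ (x E.⊟ y) }) refl refl

  ⊞-reverse : ∀ {x y v} k → y ≡ x ⊞ k ⊡ v → x ≡ y ⊞ (- k) ⊡ v
  ⊞-reverse {x} {v = v} k refl = by-ring² (k ∷ []) (x ∷ v ∷ []) (λ { (k ∷ []) (x ∷ v ∷ []) → x ≋ (x E.⊞ k E.⊡ v) E.⊞ (⊝ k) E.⊡ v }) refl refl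

  module _ {n} {A R : Fin n → V2} {U L : Fin n → Set} (H : ParallelEdges A R) (split : ∀ j → U j ⊎ L j) (∃U : ∃ U)
    {a b : V2} (q : V2) (g : Gate A R U L a b) (e : br a b q ≡ 1ℤ) (A≥0 : ∀ i → 0ℤ ≤ br a b (A i)) where

    FarEdge : Set
    FarEdge = ∃[ i ] ∃[ j ] ∃[ k ] (U i × U j × 0ℤ < k × R j ≡ R i ⊞ k ⊡ (b ⊟ a))

    private
      c : V2
      c = proj₂ b - proj₂ a , proj₁ a - proj₁ b

      a≢b : ¬ a ≡ b
      a≢b a≡b = case trans (sym e) (trans (cong (λ x → br x b q) a≡b) (br-aab b q)) of λ ()
        where
        br-aab : ∀ a q → br a a q ≡ 0ℤ
        br-aab a q = by-ring [] (a ∷ q ∷ []) (λ { [] (a ∷ q ∷ []) → E.br a a q ≋ Κ 0ℤ }) refl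

      module Edge {i j} (i≢j : ¬ A i ≡ A j) (eᵢ : br a b (A i) ≡ 0ℤ) (eⱼ : br a b (A j) ≡ 0ℤ) where

        Aᵢ-max : ∀ l → 0ℤ ≤ dot₂ c (A i) - dot₂ c (A l)
        Aᵢ-max l = subst (0ℤ ≤_) (sym (br-normal a b (A i) (A l)))
          (subst (λ x → 0ℤ ≤ br a b (A l) - x) (sym eᵢ) (0≤+ (A≥0 l) ≤-refl))

        edge : ¬ R i ≡ R j × (∀ l → 0ℤ ≤ dot₂ c (R l) - dot₂ c (R i)) × dot₂ c (R j) ≡ dot₂ c (R i)
        edge = H c i j i≢j Aᵢ-max (≡-from-0 (trans (br-normal a b (A j) (A i)) (cong₂ _-_ eᵢ eⱼ)))

        same : br a b (R i) - br a b (R j) ≡ 0ℤ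
        same = trans (sym (br-normal a b (R j) (R i))) (0-from-≡ (proj₂ (proj₂ edge)))

        top : ∀ l → 0ℤ ≤ br a b (R i) - br a b (R l)
        top l = subst (0ℤ ≤_) (br-normal a b (R l) (R i)) (proj₁ (proj₂ edge) l)

        high : ∀ {l} → br a b (R i) - br a b (R l) ≡ 0ℤ → U l
        high {l} e₀ = case split l of λ
          { (inj₁ U∋l) → U∋l
          ; (inj₂ L∋l) → 0<0-absurd (subst (0ℤ <_) e₀ (subst (0ℤ <_) (lem (br a b (R i)) (br a b (R l)) (br a b (R (proj₁ ∃U))))
              (0<+≤ (0<+ (down g L∋l) (up g (proj₂ ∃U))) (top (proj₁ ∃U))))) }
          where
          lem : ∀ x y z → - y + z + (x - z) ≡ x - y
          lem = solve-∀

        k : ℤ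
        k = det (R j ⊟ R i) (q ⊟ a)

        eⱼᵢ : R j ≡ R i ⊞ k ⊡ (b ⊟ a)
        eⱼᵢ = trans (⊟-⊞ (R j) (R i)) (cong (R i ⊞_) (parallel a b q (R j ⊟ R i) e (trans (lem a b (R i) (R j)) (cong -_ same))))
          where
          lem : ∀ a b x y → det (b ⊟ a) (y ⊟ x) ≡ - (br a b x - br a b y)
          lem a b x y = by-ring [] (a ∷ b ∷ x ∷ y ∷ []) (λ { [] (a ∷ b ∷ x ∷ y ∷ []) →
            E.det (b E.⊟ a) (y E.⊟ x) ≋ ⊝ (E.br a b x E.⊖ E.br a b y) }) refl

        ordered : Sgn k → FarEdge
        ordered (is+ k>0) = i , j , k , high (x-x (br a b (R i))) , high same , k>0 , eⱼᵢ
        ordered (is0 k≡0) = ⊥-elim (proj₁ edge (sym (trans eⱼᵢ (⊞-drop (R i) (b ⊟ a) k≡0))))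
        ordered (is- k<0) = j , i , - k , high same , high (x-x (br a b (R i))) , k<0 , ⊞-reverse k eⱼᵢ

    abstract
      -- `Conv-edge` finds two different vertices of `A` on the supporting line `ab`. The equally
      -- labelled vertices of `R` are extreme in the opposite sense: they attain the maximum of
      -- `br a b`, so they belong to `U`. Primitivity of `ab` makes their difference an integer
      -- multiple of `b ⊟ a`, and the order is chosen to make the factor positive.
      far-edge : FarEdge
      far-edge = case Conv-edge (br a b 0₂) (proj₂ a - proj₂ b , proj₁ b - proj₁ a)
          (λ i → subst (0ℤ ≤_) (br-affine a b (A i)) (A≥0 i)) a≢b (a∈ g) (b∈ g)
          (trans (sym (br-affine a b a)) (br-aba a b)) (trans (sym (br-affine a b b)) (br-abb a b)) of λ
        { (i , j , i≢j , eᵢ , eⱼ) → let open Edge i≢j (trans (br-affine a b (A i)) eᵢ) (trans (br-affine a b (A j)) eⱼ) in ordered (sgn k) }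

  gate-crossing : ∀ {n} {A R : Fin n → V2} {U L a b} → Gate A R U L a b → ∀ {u l} → U u → L l → Crossing a b (R u) (R l)
  gate-crossing g U∋u L∋l = crossing (left g U∋u L∋l) (right g U∋u L∋l) (up g U∋u) (down g L∋l)

  -- The comparison of growths required by `no-crossing` holds either as it stands or with the two
  -- gates exchanged. In each case the crossings of one gate are too far apart.
  transversal-clash : ∀ a b a' b' k k' D → D ≡ det (b ⊟ a) (b' ⊟ a') → ∀ {g f g' f'} → g' ≡ g ⊞ k ⊡ (b ⊟ a) → f' ≡ f ⊞ k' ⊡ (b' ⊟ a') →
    Crossing a b g f → Crossing a b g' f' → Crossing a' b' f g → Crossing a' b' f' g' →
    0ℤ < k * D → 0ℤ < - (k' * D) → ⊥
  transversal-clash a b a' b' k k' _ refl {g} {f} {g'} {f'} eg ef X X' Y Y' K>0 K'>0 =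
    case 0≤⊎ (K' * (- br a' b' g + br a' b' f) - K * (br a b g + - br a b f)) of λ
    { (inj₁ h) → no-crossing a b a' b' g f k k' eg ef X X' K>0 K'>0 h
    ; (inj₂ h) → no-crossing a' b' a b f g k' k ef eg Y Y' (subst (0ℤ <_) e₁ K'>0) (subst (0ℤ <_) e₂ K>0)
        (subst₂ (λ x y → 0ℤ ≤ x * (- br a b f + br a b g) - y * (br a' b' f + - br a' b' g)) e₂ e₁
          (0<⇒0≤ (subst (0ℤ <_) (lem K K' (br a' b' g) (br a' b' f) (br a b g) (br a b f)) h))) }
    where
    D = det (b ⊟ a) (b' ⊟ a')
    D' = det (b' ⊟ a') (b ⊟ a)
    K = k * D
    K' = - (k' * D)
    e₁ : K' ≡ k' * D'
    e₁ = trans (neg-distribʳ-* k' D) (cong (k' *_) (sym (det-antisym (b' ⊟ a') (b ⊟ a))))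
    e₂ : K ≡ - (k * D')
    e₂ = trans (cong (k *_) (det-antisym (b ⊟ a) (b' ⊟ a'))) (sym (neg-distribʳ-* k D'))
    lem : ∀ K K' s m' m t → - (K' * (- s + m') - K * (m + - t)) ≡ K * (- t + m) - K' * (m' + - s)
    lem = solve-∀

  br-difference : ∀ a a' b' x → - br a' b' x + br a' b' a ≡ - det (b' ⊟ a') (x ⊟ a)
  br-difference a a' b' x = by-ring [] (a ∷ a' ∷ b' ∷ x ∷ []) (λ { [] (a ∷ a' ∷ b' ∷ x ∷ []) →
    (⊝ E.br a' b' x) ⊕ E.br a' b' a ≋ ⊝ E.det (b' E.⊟ a') (x E.⊟ a) }) refl

-- Two exits of opposite walks exclude each other

module Clashes where
  open Plane
  open Convexity
  open Walks
  open Edges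
  open PlaneOps _+_ _*_ -_
  open Gate

  by-sign : ∀ {A : Set} x → (0ℤ < x → A) → (x ≡ 0ℤ → A) → (0ℤ < - x → A) → A
  by-sign x p z m with sgn x
  ... | is+ h = p h
  ... | is0 h = z h
  ... | is- h = m h

  module _ {n} {A R : Fin n → V2} {U L : Fin n → Set} {a b a' b' : V2} (q : V2)
    (g : Gate A R U L a b) (e : br a b q ≡ 1ℤ) (g' : Gate A R L U a' b') (A≥0' : ∀ i → 0ℤ ≤ br a' b' (A i)) where

    private
      X : ∀ {u l} → U u → L l → Crossing a b (R u) (R l)
      X = gate-crossing g
      Y : ∀ {u l} → U u → L l → Crossing a' b' (R l) (R u)
      Y U∋u L∋l = gate-crossing g' L∋l U∋u

    abstract
      flat-edges-clash : ∀ {i j i' j'} k k' → U i → U j → 0ℤ < k → R j ≡ R i ⊞ k ⊡ (b ⊟ a) →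
        L i' → L j' → 0ℤ < k' → R j' ≡ R i' ⊞ k' ⊡ (b' ⊟ a') → det (b ⊟ a) (b' ⊟ a') ≡ 0ℤ → ⊥
      flat-edges-clash {i} {j} {i'} {j'} k k' Ui Uj k>0 eᵢⱼ Li' Lj' k'>0 eᵢⱼ' D≡0 =
        flat-clash a b a' b' q (R i) (R j') k k' e D≡0 (X Ui Lj')
          (subst₂ (λ x y → 0ℤ < br x y b) eᵢⱼ (⊞-reverse {R i'} {R j'} {b' ⊟ a'} k' eᵢⱼ') (right g Uj Li')) k>0 k'>0
          -- `R i` is in `U`, hence strictly below the second gate, whereas `a` belongs to the hull
          -- of `A` and is not below it.
          (0<-resp (0<+≤ (down g' Ui) (Conv-br a' b' A≥0' (a∈ g))) (br-difference a a' b' (R i)))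

    abstract
      -- The sign of `D` decides which ends of the two edges form the first segment: it has to be
      -- the pair from which both growths, `k * D` and `- (k' * D)`, are positive.
      edges-clash : ∀ {i j i' j'} k k' → U i → U j → 0ℤ < k → R j ≡ R i ⊞ k ⊡ (b ⊟ a) →
        L i' → L j' → 0ℤ < k' → R j' ≡ R i' ⊞ k' ⊡ (b' ⊟ a') → ∀ D → D ≡ det (b ⊟ a) (b' ⊟ a') → ⊥
      edges-clash {i} {j} {i'} {j'} k k' Ui Uj k>0 eᵢⱼ Li' Lj' k'>0 eᵢⱼ' D eD = by-sign D case+ (λ D≡0 → flat-edges-clash {i} {j} {i'} {j'} k k' Ui Uj k>0 eᵢⱼ Li' Lj' k'>0 eᵢⱼ' (trans (sym eD) D≡0)) case-
        where
        lem₁ : ∀ k D → k * D ≡ - (- k * D)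
        lem₁ = solve-∀
        lem₂ : ∀ k D → k * - D ≡ - k * D
        lem₂ = solve-∀
        lem₃ : ∀ k D → k * - D ≡ - (k * D)
        lem₃ = solve-∀
        case+ : 0ℤ < D → ⊥
        case+ D>0 = transversal-clash a b a' b' k (- k') D eD {R i} {R j'} {R j} {R i'}
          eᵢⱼ (⊞-reverse {R i'} {R j'} {b' ⊟ a'} k' eᵢⱼ') (X Ui Lj') (X Uj Li') (Y Ui Lj') (Y Uj Li')
          (0<* k>0 D>0) (0<-resp (0<* k'>0 D>0) (lem₁ k' D))
        case- : 0ℤ < - D → ⊥
        case- D<0 = transversal-clash a b a' b' (- k) k' D eD {R j} {R i'} {R i} {R j'}
          (⊞-reverse {R i} {R j} {b ⊟ a} k eᵢⱼ) eᵢⱼ' (X Uj Li') (X Ui Lj') (Y Uj Li') (Y Ui Lj')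
          (0<-resp (0<* k>0 D<0) (lem₂ k D)) (0<-resp (0<* k'>0 D<0) (lem₃ k' D))

  exits-clash : ∀ {n} {A R : Fin n → V2} {U L : Fin n → Set} → ParallelEdges A R → (∀ j → U j ⊎ L j) → ∃ U → ∃ L →
    ∀ {a b a' b'} q q' → Gate A R U L a b → br a b q ≡ 1ℤ → (∀ i → 0ℤ ≤ br a b (A i)) →
    Gate A R L U a' b' → br a' b' q' ≡ 1ℤ → (∀ i → 0ℤ ≤ br a' b' (A i)) → ⊥
  exits-clash H split ∃u ∃l q q' g e A≥0 g' e' A≥0'
    with i , j , k , Ui , Uj , k>0 , eᵢⱼ ← far-edge H split ∃u q g e A≥0
    with i' , j' , k' , Li' , Lj' , k'>0 , eᵢⱼ' ← far-edge H (swap ∘ split) ∃l q' g' e' A≥0'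
    = edges-clash q g e g' A≥0' k k' Ui Uj k>0 eᵢⱼ Li' Lj' k'>0 eᵢⱼ' _ refl

-- Barycentric coordinates in a unimodular triangle

module Barycentric where
  open import Data.Vec using ([]; _∷_)
  open Plane
  open Walks
  open PlaneOps _+_ _*_ -_
  open Weights
  open Gate

  0<-weighted : ∀ {w₁ w₂ w₃ x y z} → Weights w₁ w₂ w₃ → 0ℤ < x → 0ℤ < y → 0ℤ < z → 0ℤ < w₁ * x + w₂ * y + w₃ * z
  0<-weighted {w₁} {w₂} {w₃} {x} {y} {z} w p q r = 0<-resp
    (0<+≤ (sum>0 w) (0≤+ (0≤+ (0≤* (w₁≥0 w) (0<⇒0≤-1 p)) (0≤* (w₂≥0 w) (0<⇒0≤-1 q))) (0≤* (w₃≥0 w) (0<⇒0≤-1 r))))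
    (lem w₁ w₂ w₃ x y z)
    where
    lem : ∀ w₁ w₂ w₃ x y z → w₁ + w₂ + w₃ + (w₁ * (x - 1ℤ) + w₂ * (y - 1ℤ) + w₃ * (z - 1ℤ)) ≡ w₁ * x + w₂ * y + w₃ * z
    lem = solve-∀

  0≤-weighted : ∀ {w₁ w₂ w₃ x y z} → Weights w₁ w₂ w₃ → 0ℤ ≤ x → 0ℤ ≤ y → 0ℤ ≤ z → 0ℤ ≤ w₁ * x + w₂ * y + w₃ * z
  0≤-weighted w p q r = 0≤+ (0≤+ (0≤* (w₁≥0 w) p) (0≤* (w₂≥0 w) q)) (0≤* (w₃≥0 w) r)

  -- The point x/w, given in homogeneous coordinates, lies in the triangle t₁t₂t₃.
  record _∷_∈△ (w : ℤ) (x : V2) (t₁ t₂ t₃ : V2) : Set where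
    constructor inside
    field
      h₁₂ : 0ℤ ≤ hbr t₁ t₂ w x
      h₂₃ : 0ℤ ≤ hbr t₂ t₃ w x
      h₃₁ : 0ℤ ≤ hbr t₃ t₁ w x
  open _∷_∈△

  hbr-comb : ∀ a b w₁ w₂ w₃ x y z → hbr a b (w₁ + w₂ + w₃) (comb₂ w₁ x w₂ y w₃ z) ≡ w₁ * br a b x + w₂ * br a b y + w₃ * br a b z
  hbr-comb a b w₁ w₂ w₃ x y z = by-ring (w₁ ∷ w₂ ∷ w₃ ∷ []) (a ∷ b ∷ x ∷ y ∷ z ∷ []) (λ { (w₁ ∷ w₂ ∷ w₃ ∷ []) (a ∷ b ∷ x ∷ y ∷ z ∷ []) →
    E.hbr a b (w₁ ⊕ w₂ ⊕ w₃) ((w₁ E.⊡ x E.⊞ w₂ E.⊡ y) E.⊞ w₃ E.⊡ z) ≋ w₁ ⊗ E.br a b x ⊕ w₂ ⊗ E.br a b y ⊕ w₃ ⊗ E.br a b z }) refl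

  dot-comb : ∀ c t w₁ w₂ w₃ x y z → - dot₂ c (comb₂ w₁ x w₂ y w₃ z ⊟ (w₁ + w₂ + w₃) ⊡ t) ≡
    w₁ * (- dot₂ c (x ⊟ t)) + w₂ * (- dot₂ c (y ⊟ t)) + w₃ * (- dot₂ c (z ⊟ t))
  dot-comb c t w₁ w₂ w₃ x y z = by-ring (w₁ ∷ w₂ ∷ w₃ ∷ []) (c ∷ t ∷ x ∷ y ∷ z ∷ []) (λ { (w₁ ∷ w₂ ∷ w₃ ∷ []) (c ∷ t ∷ x ∷ y ∷ z ∷ []) →
    ⊝ E.dot₂ c (((w₁ E.⊡ x E.⊞ w₂ E.⊡ y) E.⊞ w₃ E.⊡ z) E.⊟ (w₁ ⊕ w₂ ⊕ w₃) E.⊡ t) ≋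
    w₁ ⊗ (⊝ E.dot₂ c (x E.⊟ t)) ⊕ w₂ ⊗ (⊝ E.dot₂ c (y E.⊟ t)) ⊕ w₃ ⊗ (⊝ E.dot₂ c (z E.⊟ t)) }) refl

  barycentric-dot : ∀ c t₁ t₂ t₃ w x → br t₁ t₂ t₃ * dot₂ c (x ⊟ w ⊡ t₁) ≡
    hbr t₃ t₁ w x * dot₂ c (t₂ ⊟ t₁) + hbr t₁ t₂ w x * dot₂ c (t₃ ⊟ t₁)
  barycentric-dot c t₁ t₂ t₃ w x = by-ring (w ∷ []) (c ∷ t₁ ∷ t₂ ∷ t₃ ∷ x ∷ []) (λ { (w ∷ []) (c ∷ t₁ ∷ t₂ ∷ t₃ ∷ x ∷ []) →
    E.br t₁ t₂ t₃ ⊗ E.dot₂ c (x E.⊟ w E.⊡ t₁) ≋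
    E.hbr t₃ t₁ w x ⊗ E.dot₂ c (t₂ E.⊟ t₁) ⊕ E.hbr t₁ t₂ w x ⊗ E.dot₂ c (t₃ E.⊟ t₁) }) refl

  barycentric-dot₁ : ∀ c t₁ t₂ t₃ x → br t₁ t₂ t₃ * dot₂ c (x ⊟ t₁) ≡
    br t₃ t₁ x * dot₂ c (t₂ ⊟ t₁) + br t₁ t₂ x * dot₂ c (t₃ ⊟ t₁)
  barycentric-dot₁ c t₁ t₂ t₃ x = by-ring [] (c ∷ t₁ ∷ t₂ ∷ t₃ ∷ x ∷ []) (λ { [] (c ∷ t₁ ∷ t₂ ∷ t₃ ∷ x ∷ []) →
    E.br t₁ t₂ t₃ ⊗ E.dot₂ c (x E.⊟ t₁) ≋
    E.br t₃ t₁ x ⊗ E.dot₂ c (t₂ E.⊟ t₁) ⊕ E.br t₁ t₂ x ⊗ E.dot₂ c (t₃ E.⊟ t₁) }) refl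

  barycentric-sum : ∀ t₁ t₂ t₃ x → br t₂ t₃ x + br t₃ t₁ x + br t₁ t₂ x ≡ br t₁ t₂ t₃
  barycentric-sum t₁ t₂ t₃ x = by-ring [] (t₁ ∷ t₂ ∷ t₃ ∷ x ∷ []) (λ { [] (t₁ ∷ t₂ ∷ t₃ ∷ x ∷ []) →
    E.br t₂ t₃ x ⊕ E.br t₃ t₁ x ⊕ E.br t₁ t₂ x ≋ E.br t₁ t₂ t₃ }) refl

  barycentric-hsum : ∀ t₁ t₂ t₃ w x → hbr t₂ t₃ w x + hbr t₃ t₁ w x + hbr t₁ t₂ w x ≡ w * br t₁ t₂ t₃
  barycentric-hsum t₁ t₂ t₃ w x = by-ring (w ∷ []) (t₁ ∷ t₂ ∷ t₃ ∷ x ∷ []) (λ { (w ∷ []) (t₁ ∷ t₂ ∷ t₃ ∷ x ∷ []) →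
    E.hbr t₂ t₃ w x ⊕ E.hbr t₃ t₁ w x ⊕ E.hbr t₁ t₂ w x ≋ w ⊗ E.br t₁ t₂ t₃ }) refl

  br-rotate : ∀ a b c → br b c a ≡ br a b c
  br-rotate a b c = by-ring [] (a ∷ b ∷ c ∷ []) (λ { [] (a ∷ b ∷ c ∷ []) → E.br b c a ≋ E.br a b c }) refl

  SeparatedFrom : ∀ {n} → V2 → (Fin n → V2) → V2 → Set
  SeparatedFrom c R t = ∀ j → 0ℤ < - dot₂ c (R j ⊟ t)

  abstract
    0<-from-≤0 : ∀ {x y} → 0ℤ ≤ x → 0ℤ < - (x * y) → 0ℤ < - y
    0<-from-≤0 {x} {y} x≥0 p = case 0≤⊎ y of λ
      { (inj₂ q) → q
      ; (inj₁ q) → ¬neg p (0≤* x≥0 q) }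

    -- If `α₃` were not positive, the inequality at the second vertex would make `α₁` negative and
    -- then the one at the third would make `α₂` negative, against the sum one.
    positive-coordinate : ∀ α₁ α₂ α₃ κ₂₃ κ₂₁ κ₃₁ κ₃₂ → α₁ + α₂ + α₃ ≡ 1ℤ →
      0ℤ < - κ₂₃ → 0ℤ ≤ κ₂₁ → 0ℤ < - κ₃₁ → 0ℤ ≤ κ₃₂ →
      0ℤ < - (α₃ * κ₂₃ + α₁ * κ₂₁) → 0ℤ < - (α₁ * κ₃₁ + α₂ * κ₃₂) → 0ℤ < α₃
    positive-coordinate α₁ α₂ α₃ κ₂₃ κ₂₁ κ₃₁ κ₃₂ sum p₂₃ p₂₁ p₃₁ p₃₂ c₂ c₃ = case 0<⊎ α₃ of λ
      { (inj₁ p) → p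
      ; (inj₂ α₃≤0) →
          let α₁<0 = 0<-from-≤0 p₂₁ (0<-resp (0<+≤ c₂ (0≤* α₃≤0 (0<⇒0≤ p₂₃))) (l₁ α₃ κ₂₃ α₁ κ₂₁))
              α₂<0 = 0<-from-≤0 p₃₂ (0<-resp (0<+≤ c₃ (0≤* (0<⇒0≤ α₁<0) (0<⇒0≤ p₃₁))) (l₁ α₁ κ₃₁ α₂ κ₃₂))
          in case 0<-resp (0<-resp (0<+≤ (0<+ α₁<0 α₂<0) α₃≤0) (l₂ α₁ α₂ α₃)) (cong -_ sum) of λ () }
      where
      l₁ : ∀ a k b k' → - (a * k + b * k') + - a * - k ≡ - (k' * b)
      l₁ = solve-∀
      l₂ : ∀ a b c → - a + - b + - c ≡ - (a + b + c)
      l₂ = solve-∀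

    -- `κ₁₂` is the value on the edge from vertex 1 to vertex 2 of the functional separating vertex
    -- 1 from `R`. The sign pattern says that each separating line has the next vertex on the side
    -- of `R` and the previous one not. Then all barycentric coordinates of a lattice point of `R`
    -- are positive integers, so their sum is at least three instead of one.
    cyclic-clash : ∀ α₁ α₂ α₃ κ₁₂ κ₁₃ κ₂₃ κ₂₁ κ₃₁ κ₃₂ → α₁ + α₂ + α₃ ≡ 1ℤ →
      0ℤ < - κ₁₂ → 0ℤ ≤ κ₁₃ → 0ℤ < - κ₂₃ → 0ℤ ≤ κ₂₁ → 0ℤ < - κ₃₁ → 0ℤ ≤ κ₃₂ →
      0ℤ < - (α₂ * κ₁₂ + α₃ * κ₁₃) → 0ℤ < - (α₃ * κ₂₃ + α₁ * κ₂₁) → 0ℤ < - (α₁ * κ₃₁ + α₂ * κ₃₂) → ⊥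
    cyclic-clash α₁ α₂ α₃ κ₁₂ κ₁₃ κ₂₃ κ₂₁ κ₃₁ κ₃₂ sum p₁₂ p₁₃ p₂₃ p₂₁ p₃₁ p₃₂ c₁ c₂ c₃ =
      case 0≤-resp (0≤-resp (0≤+ (0≤+ (0<⇒0≤-1 (positive-coordinate α₂ α₃ α₁ κ₃₁ κ₃₂ κ₁₂ κ₁₃ (trans (rot α₁ α₂ α₃) sum) p₃₁ p₃₂ p₁₂ p₁₃ c₃ c₁))
          (0<⇒0≤-1 (positive-coordinate α₃ α₁ α₂ κ₁₂ κ₁₃ κ₂₃ κ₂₁ (trans (rot' α₁ α₂ α₃) sum) p₁₂ p₁₃ p₂₃ p₂₁ c₁ c₂)))
          (0<⇒0≤-1 (positive-coordinate α₁ α₂ α₃ κ₂₃ κ₂₁ κ₃₁ κ₃₂ sum p₂₃ p₂₁ p₃₁ p₃₂ c₂ c₃)))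
        (l α₁ α₂ α₃)) (cong (_+ (- + 3)) sum) of λ ()
      where
      rot : ∀ a b c → b + c + a ≡ a + b + c
      rot = solve-∀
      rot' : ∀ a b c → c + a + b ≡ a + b + c
      rot' = solve-∀
      l : ∀ a b c → a - 1ℤ + (b - 1ℤ) + (c - 1ℤ) ≡ a + b + c + (- + 3)
      l = solve-∀

    +-comm-neg : ∀ {x y} → 0ℤ < - (x + y) → 0ℤ < - (y + x)
    +-comm-neg {x} {y} p = 0<-resp p (cong -_ (+-comm x y))

-- The edge of a unimodular triangle that R crosses

module Localisation where
  open import Data.Vec using ([]; _∷_)
  open Plane
  open Convexity
  open Walks
  open Edges
  open Clashes
  open Barycentric
  open PlaneOps _+_ _*_ -_
  open _∷_∈△

  module Located {n} {A R : Fin n → V2} (H : ParallelEdges A R)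
    {w₁ w₂ w₃ : ℤ} (ws : Weights w₁ w₂ w₃) (i₁ i₂ i₃ : Fin n) where

    w : ℤ
    w = w₁ + w₂ + w₃

    x : V2
    x = comb₂ w₁ (R i₁) w₂ (R i₂) w₃ (R i₃)

    private
      abstract
        separated-x : ∀ c t → SeparatedFrom c R t → 0ℤ < - dot₂ c (x ⊟ w ⊡ t)
        separated-x c t s = 0<-resp (0<-weighted ws (s i₁) (s i₂) (s i₃)) (sym (dot-comb c t w₁ w₂ w₃ (R i₁) (R i₂) (R i₃)))

        hbr-x : ∀ a b → hbr a b w x ≡ w₁ * br a b (R i₁) + w₂ * br a b (R i₂) + w₃ * br a b (R i₃)
        hbr-x a b = hbr-comb a b w₁ w₂ w₃ (R i₁) (R i₂) (R i₃)

    -- `a→b` says that `b` lies on the same side as `R` of the line separating `a` from `R`, and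
    -- `b→a` likewise. Together they confine `R` on the line `ab` to the open segment, which is what
    -- a gate demands.
    module Edge {a b q : V2} (a∈ : Conv A a) (b∈ : Conv A b) (e : br a b q ≡ 1ℤ) (x∈ : (w ∷ x ∈△) a b q)
      {ca cb cq : V2} (sa : SeparatedFrom ca R a) (sb : SeparatedFrom cb R b) (sq : SeparatedFrom cq R q)
      (a→b : 0ℤ < - dot₂ ca (b ⊟ a)) (b→a : 0ℤ < - dot₂ cb (a ⊟ b)) where

      private
        U L : Fin n → Set
        U j = 0ℤ < br a b (R j)
        L j = 0ℤ < - br a b (R j)

        abstract
          -- On the line `ab`, `t` is the coordinate of `R j` from `a` to `b`, an integer because
          -- `a`, `b`, `q` span the lattice. The two separations put it strictly between 0 and 1.
          off-line : ∀ j → br a b (R j) ≡ 0ℤ → ⊥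
          off-line j e₀ = ¬neg {x = t - 1ℤ}
            (0<-resp (0<*-cancel { - κb} {1ℤ - t} b→a (0<-resp (sb j) (trans (cong -_ eb) (l₂ t κb)))) (l₃ t))
            (0<⇒0≤-1 (0<*-cancel { - κa} {t} a→b (0<-resp (sa j) (trans (cong -_ ea) (l₁ t κa)))))
            where
            t κa κb : ℤ
            t = br a (R j) q
            κa = dot₂ ca (b ⊟ a)
            κb = dot₂ cb (a ⊟ b)
            l₁ : ∀ t k → - (t * k) ≡ - k * t
            l₁ = solve-∀
            l₂ : ∀ t k → - ((1ℤ - t) * k) ≡ - k * (1ℤ - t)
            l₂ = solve-∀
            l₃ : ∀ t → 1ℤ - t ≡ - (t - 1ℤ)
            l₃ = solve-∀
            coords : ∀ c r → dot₂ c (r ⊟ a) ≡ br a r q * dot₂ c (b ⊟ a) + dot₂ c (q ⊟ a) * br a b r + dot₂ c (r ⊟ a) * (1ℤ - br a b q)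
            coords c r = by-ring [] (a ∷ b ∷ q ∷ c ∷ r ∷ []) (λ { [] (a ∷ b ∷ q ∷ c ∷ r ∷ []) →
              E.dot₂ c (r E.⊟ a) ≋ E.br a r q ⊗ E.dot₂ c (b E.⊟ a) ⊕ E.dot₂ c (q E.⊟ a) ⊗ E.br a b r ⊕ E.dot₂ c (r E.⊟ a) ⊗ (Κ 1ℤ E.⊖ E.br a b q) }) refl
            coords' : ∀ c r → dot₂ c (r ⊟ b) ≡ (1ℤ - br a r q) * dot₂ c (a ⊟ b) + dot₂ c (q ⊟ a) * br a b r + dot₂ c (r ⊟ a) * (1ℤ - br a b q)
            coords' c r = by-ring [] (a ∷ b ∷ q ∷ c ∷ r ∷ []) (λ { [] (a ∷ b ∷ q ∷ c ∷ r ∷ []) →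
              E.dot₂ c (r E.⊟ b) ≋ (Κ 1ℤ E.⊖ E.br a r q) ⊗ E.dot₂ c (a E.⊟ b) ⊕ E.dot₂ c (q E.⊟ a) ⊗ E.br a b r ⊕ E.dot₂ c (r E.⊟ a) ⊗ (Κ 1ℤ E.⊖ E.br a b q) }) refl
            ea : dot₂ ca (R j ⊟ a) ≡ t * κa
            ea = trans (coords ca (R j)) (trans (+0* (t * κa + dot₂ ca (q ⊟ a) * br a b (R j)) (dot₂ ca (R j ⊟ a)) (0-from-≡ (sym e)))
                   (+0* (t * κa) (dot₂ ca (q ⊟ a)) e₀))
            eb : dot₂ cb (R j ⊟ b) ≡ (1ℤ - t) * κb
            eb = trans (coords' cb (R j)) (trans (+0* ((1ℤ - t) * κb + dot₂ cb (q ⊟ a) * br a b (R j)) (dot₂ cb (R j ⊟ a)) (0-from-≡ (sym e)))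
                   (+0* ((1ℤ - t) * κb) (dot₂ cb (q ⊟ a)) e₀))

          split : ∀ j → U j ⊎ L j
          split j = by-sign (br a b (R j)) inj₁ (λ e₀ → ⊥-elim (off-line j e₀)) inj₂

          gate : Gate A R U L a b
          gate = record
            { a∈ = a∈ ; b∈ = b∈ ; up = λ p → p ; down = λ p → p
            ; left = λ {u} {l} p q → proj₂ (signs-from-product {br (R u) (R l) a} {dot₂ ca (b ⊟ a)}
                (at ca a (br-aba a b) sa u l p q)) a→b
            ; right = λ {u} {l} p q → proj₁ (signs-from-product {br (R u) (R l) b} {dot₂ cb (b ⊟ a)}
                (at cb b (br-abb a b) sb u l p q)) (0<-resp b→a (flip cb)) }
            where
            flip : ∀ c → - dot₂ c (a ⊟ b) ≡ dot₂ c (b ⊟ a)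
            flip c = by-ring [] (a ∷ b ∷ c ∷ []) (λ { [] (a ∷ b ∷ c ∷ []) → ⊝ E.dot₂ c (a E.⊟ b) ≋ E.dot₂ c (b E.⊟ a) }) refl
            minus-0 : ∀ {p} z → p ≡ 0ℤ → z ≡ z - p
            minus-0 z refl = sym (+-identityʳ z)
            at : ∀ c p → br a b p ≡ 0ℤ → SeparatedFrom c R p → ∀ u l → U u → L l → 0ℤ < br (R u) (R l) p * dot₂ c (b ⊟ a)
            at c p e₀ s u l Uu Ll = 0<-resp
              (0<+ (0<* (0<-resp Uu (minus-0 (br a b (R u)) e₀)) (s l)) (0<* (0<-resp Ll (cong -_ (minus-0 (br a b (R l)) e₀))) (s u)))
              (sym (side-identity c a b p (R u) (R l)))

          ∃U : ∃ U
          ∃U = case ∀-or-∃ (λ j → swap (split j)) of λ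
            { (inj₂ p) → p
            ; (inj₁ all) → ¬neg {x = hbr a b w x} (0<-resp (0<-weighted ws (all i₁) (all i₂) (all i₃))
                (trans (l w₁ w₂ w₃ (br a b (R i₁)) (br a b (R i₂)) (br a b (R i₃))) (cong -_ (sym (hbr-x a b))))) (h₁₂ x∈) }
            where
            l : ∀ w₁ w₂ w₃ x y z → w₁ * - x + w₂ * - y + w₃ * - z ≡ - (w₁ * x + w₂ * y + w₃ * z)
            l = solve-∀

          -- If all of R lies on the side of q, then x/w can only be q.
          ∃L : ∃ L
          ∃L = case ∀-or-∃ split of λ
            { (inj₂ p) → p
            ; (inj₁ all) → 0<0-absurd (0<-resp (separated-x cq q sq) (cong -_ (zero-dot all))) }
            where
            l : ∀ w₁ w₂ w₃ x y z → w₁ * (x - 1ℤ) + w₂ * (y - 1ℤ) + w₃ * (z - 1ℤ) ≡ (w₁ * x + w₂ * y + w₃ * z) - (w₁ + w₂ + w₃)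
            l = solve-∀
            l₂ : ∀ h h' h'' w → h - w ≡ - (h' + h'') + (h' + h'' + h - w * 1ℤ)
            l₂ = solve-∀
            zeros : (∀ j → U j) → 0ℤ ≤ - (hbr b q w x + hbr q a w x)
            zeros all = 0≤-resp (0≤-weighted ws (0<⇒0≤-1 (all i₁)) (0<⇒0≤-1 (all i₂)) (0<⇒0≤-1 (all i₃)))
              (trans (l w₁ w₂ w₃ (br a b (R i₁)) (br a b (R i₂)) (br a b (R i₃)))
              (trans (cong (_- w) (sym (hbr-x a b)))
              (trans (l₂ (hbr a b w x) (hbr b q w x) (hbr q a w x) w)
              (trans (cong (_+_ (- (hbr b q w x + hbr q a w x))) (0-from-≡ (trans (barycentric-hsum a b q w x) (cong (w *_) e))))
                (+-identityʳ (- (hbr b q w x + hbr q a w x)))))))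
            both : ∀ {x y} → 0ℤ ≤ x → 0ℤ ≤ y → 0ℤ ≤ - (x + y) → x ≡ 0ℤ × y ≡ 0ℤ
            both {+0} {+0} _ _ _ = refl , refl
            both {+0} {+[1+ _ ]} _ _ ()
            both {+[1+ _ ]} {+ _} _ _ ()
            zero-dot : (∀ j → U j) → dot₂ cq (x ⊟ w ⊡ q) ≡ 0ℤ
            zero-dot all = trans (sym (*-identityˡ (dot₂ cq (x ⊟ w ⊡ q))))
              (trans (cong (_* dot₂ cq (x ⊟ w ⊡ q)) (sym (trans (br-rotate' a b q) e)))
              (trans (barycentric-dot cq q a b w x)
                (cong₂ (λ y z → y * dot₂ cq (a ⊟ q) + z * dot₂ cq (b ⊟ q)) (proj₁ hs) (proj₂ hs))))
              where
              hs : hbr b q w x ≡ 0ℤ × hbr q a w x ≡ 0ℤ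
              hs = both (h₂₃ x∈) (h₃₁ x∈) (zeros all)
              br-rotate' : ∀ a b q → br q a b ≡ br a b q
              br-rotate' a b q = sym (br-rotate q a b)

      abstract
        common : Common A R
        common = case Walk.walk A R U L {proj₁ ∃U} {proj₁ ∃L} (proj₂ ∃U) (proj₂ ∃L) a b q e gate of λ
          { (inj₁ c) → c
          ; (inj₂ (a₁ , b₁ , q₁ , g₁ , e₁ , A≥0)) →
            -- The second walk leaves `ab` on the side of `q`. Its starting apex is `q` reflected in
            -- the midpoint of `ab`; it only has to complete a lattice basis and need not belong to
            -- `A`.
            case Walk.walk A R L U {proj₁ ∃L} {proj₁ ∃U} (proj₂ ∃L) (proj₂ ∃U) b a (a ⊞ b ⊟ q) (trans (flip a b q) e) (gate-flip gate) of λ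
            { (inj₁ c) → c
            ; (inj₂ (a₂ , b₂ , q₂ , g₂ , e₂ , A≥0')) → ⊥-elim (exits-clash H split ∃U ∃L q₁ q₂ g₁ e₁ A≥0 g₂ e₂ A≥0') } }
          where
          flip : ∀ a b q → br b a (a ⊞ b ⊟ q) ≡ br a b q
          flip a b q = by-ring [] (a ∷ b ∷ q ∷ []) (λ { [] (a ∷ b ∷ q ∷ []) → E.br b a (a E.⊞ b E.⊟ q) ≋ E.br a b q }) refl

    private
      rotate : ∀ {t₁ t₂ t₃} → (w ∷ x ∈△) t₁ t₂ t₃ → (w ∷ x ∈△) t₂ t₃ t₁
      rotate (inside h₁₂ h₂₃ h₃₁) = inside h₂₃ h₃₁ h₁₂

      abstract
        -- If neither other vertex were on the side of `R`, the whole triangle would be on the far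
        -- side of the line, yet `x / w` belongs both to the triangle and to the hull of `R`.
        towards : ∀ c t₁ t₂ t₃ → br t₁ t₂ t₃ ≡ 1ℤ → (w ∷ x ∈△) t₁ t₂ t₃ → SeparatedFrom c R t₁ →
          0ℤ ≤ dot₂ c (t₂ ⊟ t₁) → 0ℤ ≤ dot₂ c (t₃ ⊟ t₁) → ⊥
        towards c t₁ t₂ t₃ e x∈ s p q = ¬neg (separated-x c t₁ s)
          (0≤-resp (0≤+ (0≤* (h₃₁ x∈) p) (0≤* (h₁₂ x∈) q)) (trans (sym (barycentric-dot c t₁ t₂ t₃ w x))
            (trans (cong (_* dot₂ c (x ⊟ w ⊡ t₁)) e) (*-identityˡ (dot₂ c (x ⊟ w ⊡ t₁))))))

        coordinates : ∀ c t₁ t₂ t₃ → br t₁ t₂ t₃ ≡ 1ℤ → SeparatedFrom c R t₁ →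
          0ℤ < - (br t₃ t₁ (R i₁) * dot₂ c (t₂ ⊟ t₁) + br t₁ t₂ (R i₁) * dot₂ c (t₃ ⊟ t₁))
        coordinates c t₁ t₂ t₃ e s = 0<-resp (s i₁) (cong -_ (trans (sym (*-identityˡ (dot₂ c (R i₁ ⊟ t₁))))
          (trans (cong (_* dot₂ c (R i₁ ⊟ t₁)) (sym e)) (barycentric-dot₁ c t₁ t₂ t₃ (R i₁)))))

    module Unimodular {t₁ t₂ t₃ : V2} (t₁∈ : Conv A t₁) (t₂∈ : Conv A t₂) (t₃∈ : Conv A t₃)
      (e₁₂₃ : br t₁ t₂ t₃ ≡ 1ℤ) (x∈ : (w ∷ x ∈△) t₁ t₂ t₃) where

      private
        e₂₃₁ : br t₂ t₃ t₁ ≡ 1ℤ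
        e₂₃₁ = trans (br-rotate t₁ t₂ t₃) e₁₂₃
        e₃₁₂ : br t₃ t₁ t₂ ≡ 1ℤ
        e₃₁₂ = trans (br-rotate t₂ t₃ t₁) e₂₃₁

        abstract
          -- Draw an arrow from a vertex to each vertex that lies on the side of `R` of its
          -- separating line. By `towards` every vertex has an outgoing arrow, so three vertices
          -- contain a mutual pair or form a directed 3-cycle. `cyclic-clash` excludes both
          -- orientations of the cycle, and a mutual pair is a crossed edge.
          mutual-edge : ∀ c₁ c₂ c₃ → SeparatedFrom c₁ R t₁ → SeparatedFrom c₂ R t₂ → SeparatedFrom c₃ R t₃ → Common A R
          mutual-edge c₁ c₂ c₃ s₁ s₂ s₃ = case 0≤⊎ κ₁₂ of λ
            { (inj₂ b₁₂) → case 0≤⊎ κ₂₁ of λ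
              { (inj₂ b₂₁) → edge₁₂ b₁₂ b₂₁
              ; (inj₁ n₂₁) → case 0≤⊎ κ₂₃ of λ
                { (inj₁ n₂₃) → ⊥-elim (towards c₂ t₂ t₃ t₁ e₂₃₁ (rotate x∈) s₂ n₂₃ n₂₁)
                ; (inj₂ b₂₃) → case 0≤⊎ κ₃₂ of λ
                  { (inj₂ b₃₂) → edge₂₃ b₂₃ b₃₂
                  ; (inj₁ n₃₂) → case 0≤⊎ κ₃₁ of λ
                    { (inj₁ n₃₁) → ⊥-elim (towards c₃ t₃ t₁ t₂ e₃₁₂ (rotate (rotate x∈)) s₃ n₃₁ n₃₂)
                    ; (inj₂ b₃₁) → case 0≤⊎ κ₁₃ of λ
                      { (inj₂ b₁₃) → edge₃₁ b₃₁ b₁₃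
                      ; (inj₁ n₁₃) → ⊥-elim (cyclic-clash α₁ α₂ α₃ κ₁₂ κ₁₃ κ₂₃ κ₂₁ κ₃₁ κ₃₂ α-sum b₁₂ n₁₃ b₂₃ n₂₁ b₃₁ n₃₂ k₁ k₂ k₃) } } } } }
            ; (inj₁ n₁₂) → case 0≤⊎ κ₁₃ of λ
              { (inj₁ n₁₃) → ⊥-elim (towards c₁ t₁ t₂ t₃ e₁₂₃ x∈ s₁ n₁₂ n₁₃)
              ; (inj₂ b₁₃) → case 0≤⊎ κ₃₁ of λ
                { (inj₂ b₃₁) → edge₃₁ b₃₁ b₁₃
                ; (inj₁ n₃₁) → case 0≤⊎ κ₃₂ of λ
                  { (inj₁ n₃₂) → ⊥-elim (towards c₃ t₃ t₁ t₂ e₃₁₂ (rotate (rotate x∈)) s₃ n₃₁ n₃₂)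
                  ; (inj₂ b₃₂) → case 0≤⊎ κ₂₃ of λ
                    { (inj₂ b₂₃) → edge₂₃ b₂₃ b₃₂
                    ; (inj₁ n₂₃) → case 0≤⊎ κ₂₁ of λ
                      { (inj₁ n₂₁) → ⊥-elim (towards c₂ t₂ t₃ t₁ e₂₃₁ (rotate x∈) s₂ n₂₃ n₂₁)
                      ; (inj₂ b₂₁) → ⊥-elim (cyclic-clash α₁ α₃ α₂ κ₁₃ κ₁₂ κ₃₂ κ₃₁ κ₂₁ κ₂₃ (trans (swap₂₃ α₁ α₂ α₃) α-sum) b₁₃ n₁₂ b₃₂ n₃₁ b₂₁ n₂₃
                          (+-comm-neg {α₂ * κ₁₂} {α₃ * κ₁₃} k₁) (+-comm-neg {α₁ * κ₃₁} {α₂ * κ₃₂} k₃) (+-comm-neg {α₃ * κ₂₃} {α₁ * κ₂₁} k₂)) } } } } } }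
            where
            κ₁₂ κ₁₃ κ₂₃ κ₂₁ κ₃₁ κ₃₂ α₁ α₂ α₃ : ℤ
            κ₁₂ = dot₂ c₁ (t₂ ⊟ t₁)
            κ₁₃ = dot₂ c₁ (t₃ ⊟ t₁)
            κ₂₃ = dot₂ c₂ (t₃ ⊟ t₂)
            κ₂₁ = dot₂ c₂ (t₁ ⊟ t₂)
            κ₃₁ = dot₂ c₃ (t₁ ⊟ t₃)
            κ₃₂ = dot₂ c₃ (t₂ ⊟ t₃)
            α₁ = br t₂ t₃ (R i₁)
            α₂ = br t₃ t₁ (R i₁)
            α₃ = br t₁ t₂ (R i₁)
            swap₂₃ : ∀ a b c → a + c + b ≡ a + b + c
            swap₂₃ = solve-∀
            α-sum : α₁ + α₂ + α₃ ≡ 1ℤ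
            α-sum = trans (barycentric-sum t₁ t₂ t₃ (R i₁)) e₁₂₃
            k₁ : 0ℤ < - (α₂ * κ₁₂ + α₃ * κ₁₃)
            k₁ = coordinates c₁ t₁ t₂ t₃ e₁₂₃ s₁
            k₂ : 0ℤ < - (α₃ * κ₂₃ + α₁ * κ₂₁)
            k₂ = coordinates c₂ t₂ t₃ t₁ e₂₃₁ s₂
            k₃ : 0ℤ < - (α₁ * κ₃₁ + α₂ * κ₃₂)
            k₃ = coordinates c₃ t₃ t₁ t₂ e₃₁₂ s₃
            edge₁₂ : 0ℤ < - κ₁₂ → 0ℤ < - κ₂₁ → Common A R
            edge₁₂ p q = Edge.common {t₁} {t₂} {t₃} t₁∈ t₂∈ e₁₂₃ x∈ {c₁} {c₂} {c₃} s₁ s₂ s₃ p q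
            edge₂₃ : 0ℤ < - κ₂₃ → 0ℤ < - κ₃₂ → Common A R
            edge₂₃ p q = Edge.common {t₂} {t₃} {t₁} t₂∈ t₃∈ e₂₃₁ (rotate x∈) {c₂} {c₃} {c₁} s₂ s₃ s₁ p q
            edge₃₁ : 0ℤ < - κ₃₁ → 0ℤ < - κ₁₃ → Common A R
            edge₃₁ p q = Edge.common {t₃} {t₁} {t₂} t₃∈ t₁∈ e₃₁₂ (rotate (rotate x∈)) {c₃} {c₁} {c₂} s₃ s₁ s₂ p q

      abstract
        unimodular-common : Common A R
        unimodular-common = case in-or-separated R t₁ of λ
          { (inj₁ p) → t₁ , t₁∈ , p
          ; (inj₂ (c₁ , s₁)) → case in-or-separated R t₂ of λ
            { (inj₁ p) → t₂ , t₂∈ , p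
            ; (inj₂ (c₂ , s₂)) → case in-or-separated R t₃ of λ
              { (inj₁ p) → t₃ , t₃∈ , p
              ; (inj₂ (c₃ , s₃)) → mutual-edge c₁ c₂ c₃ s₁ s₂ s₃ } } }

-- Lattice points in triangles that are not unimodular

module Residues where
  open import Data.Vec using ([]; _∷_)
  open Plane
  open Walks
  open Edges
  open Clashes
  open Barycentric
  open PlaneOps _+_ _*_ -_
  open _∷_∈△

  -- Barycentric coordinates are normalised to have sum N = br t₁ t₂ t₃.
  LatticePointIn△ : (N : ℤ) (t₁ t₂ t₃ : V2) → Set
  LatticePointIn△ N t₁ t₂ t₃ = ∃[ p ] ∃[ b₁ ] ∃[ b₂ ] ∃[ b₃ ]
    ((0ℤ ≤ b₁ × 0ℤ ≤ b₂ × 0ℤ ≤ b₃) × (0ℤ < N - b₁ × 0ℤ < N - b₂ × 0ℤ < N - b₃) × b₁ + b₂ + b₃ ≡ N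
     × comb₂ b₁ t₁ b₂ t₂ b₃ t₃ ≡ (b₁ + b₂ + b₃) ⊡ p)

  abstract
    drop₃ : ∀ y {v₁} v₂ v₃ {k₂ k₃} → v₁ ≡ 0₂ → k₂ ≡ 0ℤ → k₃ ≡ 0ℤ → y ⊞ v₁ ⊞ k₂ ⊡ v₂ ⊞ k₃ ⊡ v₃ ≡ y
    drop₃ y v₂ v₃ refl refl refl = cong₂ _,_ (lem (proj₁ y)) (lem (proj₂ y))
      where
      lem : ∀ x → x + 0ℤ + 0ℤ + 0ℤ ≡ x
      lem = solve-∀

    ⊟-self : ∀ {x y} → x ≡ y → x ⊟ y ≡ 0₂
    ⊟-self {x} refl = cong₂ _,_ (+-inverseʳ (proj₁ x)) (+-inverseʳ (proj₂ x))

    -- The fractional parts of the coordinates X/N, Y/N of a lattice vector v give a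
    -- lattice point of the parallelogram spanned by the triangle; a point of its far
    -- half is reflected into the triangle.
    residue-point : ∀ t₁ t₂ t₃ N v X Y → 0ℤ < N → N ⊡ v ≡ X ⊡ (t₂ ⊟ t₁) ⊞ Y ⊡ (t₃ ⊟ t₁) →
      (∃[ s ] ∃[ s' ] (X ≡ s * N × Y ≡ s' * N)) ⊎ LatticePointIn△ N t₁ t₂ t₃
    residue-point t₁ t₂ t₃ N v X Y N>0 ev = case divide N>0 X of λ { (ρ , s , eX , ρ≥0 , ρ<N) →
      case divide N>0 Y of λ { (σ , s' , eY , σ≥0 , σ<N) → by-sign (ρ + σ)
          (λ pos → inj₂ (case 0≤⊎ (N - (ρ + σ)) of λ
            { (inj₁ near) → near-point s s' ρ σ eX eY ρ≥0 ρ<N σ≥0 σ<N pos near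
            ; (inj₂ far) → far-point s s' ρ σ eX eY ρ<N σ<N far }))
          (λ z → inj₁ (s , s' , trans eX (trans (cong (_+ s * N) (proj₁ (zeros ρ≥0 σ≥0 z))) (+-identityˡ (s * N))) ,
                                trans eY (trans (cong (_+ s' * N) (proj₂ (zeros ρ≥0 σ≥0 z))) (+-identityˡ (s' * N)))))
          (λ neg → ¬neg neg (0≤+ ρ≥0 σ≥0)) } }
      where
      zeros : ∀ {x y} → 0ℤ ≤ x → 0ℤ ≤ y → x + y ≡ 0ℤ → x ≡ 0ℤ × y ≡ 0ℤ
      zeros {+0} {+ _} _ _ e = refl , e
      zeros {+[1+ _ ]} {+ _} _ _ ()
      p p' : ℤ → ℤ → V2
      p s s' = t₁ ⊞ v ⊟ s ⊡ (t₂ ⊟ t₁) ⊟ s' ⊡ (t₃ ⊟ t₁)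
      p' s s' = t₂ ⊞ t₃ ⊟ (t₁ ⊞ v ⊟ s ⊡ (t₂ ⊟ t₁) ⊟ s' ⊡ (t₃ ⊟ t₁))
      l₀ : ∀ N ρ σ → ρ + σ ≡ N - (N - (ρ + σ))
      l₀ = solve-∀
      l₁ : ∀ N ρ σ → N - (ρ + σ) + ρ + σ ≡ N
      l₁ = solve-∀
      l₂ : ∀ N ρ σ → N - ρ + (N - σ) ≡ N - (- (N - (ρ + σ)))
      l₂ = solve-∀
      l₃ : ∀ N ρ σ → - (N - (ρ + σ)) + (N - σ) ≡ N - (N - ρ)
      l₃ = solve-∀
      l₄ : ∀ N ρ σ → - (N - (ρ + σ)) + (N - ρ) ≡ N - (N - σ)
      l₄ = solve-∀
      l₅ : ∀ N ρ σ → - (N - (ρ + σ)) + (N - ρ) + (N - σ) ≡ N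
      l₅ = solve-∀
      near-eq : ∀ s s' ρ σ → X ≡ ρ + s * N → Y ≡ σ + s' * N → comb₂ (N - (ρ + σ)) t₁ ρ t₂ σ t₃ ≡ (N - (ρ + σ) + ρ + σ) ⊡ p s s'
      near-eq s s' ρ σ eX eY = trans (near-id s s' ρ σ)
        (drop₃ ((N - (ρ + σ) + ρ + σ) ⊡ p s s') (t₂ ⊟ t₁) (t₃ ⊟ t₁) (⊟-self (sym ev)) (0-from-≡ (sym eX)) (0-from-≡ (sym eY)))
        where
        near-id : ∀ s s' ρ σ → comb₂ (N - (ρ + σ)) t₁ ρ t₂ σ t₃ ≡
          (N - (ρ + σ) + ρ + σ) ⊡ p s s' ⊞ ((X ⊡ (t₂ ⊟ t₁) ⊞ Y ⊡ (t₃ ⊟ t₁)) ⊟ N ⊡ v)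
            ⊞ (ρ + s * N - X) ⊡ (t₂ ⊟ t₁) ⊞ (σ + s' * N - Y) ⊡ (t₃ ⊟ t₁)
        near-id s s' ρ σ = by-ring² (N ∷ s ∷ s' ∷ ρ ∷ σ ∷ X ∷ Y ∷ []) (t₁ ∷ t₂ ∷ t₃ ∷ v ∷ [])
          (λ { (N ∷ s ∷ s' ∷ ρ ∷ σ ∷ X ∷ Y ∷ []) (t₁ ∷ t₂ ∷ t₃ ∷ v ∷ []) → let d₂ = t₂ E.⊟ t₁ ; d₃ = t₃ E.⊟ t₁ ; b₁ = N E.⊖ (ρ ⊕ σ) in
            (b₁ E.⊡ t₁ E.⊞ ρ E.⊡ t₂) E.⊞ σ E.⊡ t₃ ≋
            ((b₁ ⊕ ρ) ⊕ σ) E.⊡ (t₁ E.⊞ v E.⊟ s E.⊡ d₂ E.⊟ s' E.⊡ d₃) E.⊞ ((X E.⊡ d₂ E.⊞ Y E.⊡ d₃) E.⊟ N E.⊡ v)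
              E.⊞ ((ρ ⊕ s ⊗ N) E.⊖ X) E.⊡ d₂ E.⊞ ((σ ⊕ s' ⊗ N) E.⊖ Y) E.⊡ d₃ }) refl refl
      far-eq : ∀ s s' ρ σ → X ≡ ρ + s * N → Y ≡ σ + s' * N →
        comb₂ (- (N - (ρ + σ))) t₁ (N - ρ) t₂ (N - σ) t₃ ≡ (- (N - (ρ + σ)) + (N - ρ) + (N - σ)) ⊡ p' s s'
      far-eq s s' ρ σ eX eY = trans (far-id s s' ρ σ)
        (drop₃ ((- (N - (ρ + σ)) + (N - ρ) + (N - σ)) ⊡ p' s s') (t₂ ⊟ t₁) (t₃ ⊟ t₁) (⊟-self ev) (0-from-≡ eX) (0-from-≡ eY))
        where
        far-id : ∀ s s' ρ σ → comb₂ (- (N - (ρ + σ))) t₁ (N - ρ) t₂ (N - σ) t₃ ≡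
          (- (N - (ρ + σ)) + (N - ρ) + (N - σ)) ⊡ p' s s'
            ⊞ (N ⊡ v ⊟ (X ⊡ (t₂ ⊟ t₁) ⊞ Y ⊡ (t₃ ⊟ t₁)))
            ⊞ (X - (ρ + s * N)) ⊡ (t₂ ⊟ t₁) ⊞ (Y - (σ + s' * N)) ⊡ (t₃ ⊟ t₁)
        far-id s s' ρ σ = by-ring² (N ∷ s ∷ s' ∷ ρ ∷ σ ∷ X ∷ Y ∷ []) (t₁ ∷ t₂ ∷ t₃ ∷ v ∷ [])
          (λ { (N ∷ s ∷ s' ∷ ρ ∷ σ ∷ X ∷ Y ∷ []) (t₁ ∷ t₂ ∷ t₃ ∷ v ∷ []) →
            let d₂ = t₂ E.⊟ t₁ ; d₃ = t₃ E.⊟ t₁ ; b₁ = ⊝ (N E.⊖ (ρ ⊕ σ)) ; b₂ = N E.⊖ ρ ; b₃ = N E.⊖ σ in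
            (b₁ E.⊡ t₁ E.⊞ b₂ E.⊡ t₂) E.⊞ b₃ E.⊡ t₃ ≋
            ((b₁ ⊕ b₂) ⊕ b₃) E.⊡ (t₂ E.⊞ t₃ E.⊟ (t₁ E.⊞ v E.⊟ s E.⊡ d₂ E.⊟ s' E.⊡ d₃)) E.⊞ (N E.⊡ v E.⊟ (X E.⊡ d₂ E.⊞ Y E.⊡ d₃))
              E.⊞ (X E.⊖ (ρ ⊕ s ⊗ N)) E.⊡ d₂ E.⊞ (Y E.⊖ (σ ⊕ s' ⊗ N)) E.⊡ d₃ }) refl refl
      near-point : ∀ s s' ρ σ → X ≡ ρ + s * N → Y ≡ σ + s' * N → 0ℤ ≤ ρ → 0ℤ < N - ρ → 0ℤ ≤ σ → 0ℤ < N - σ →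
        0ℤ < ρ + σ → 0ℤ ≤ N - (ρ + σ) → LatticePointIn△ N t₁ t₂ t₃
      near-point s s' ρ σ eX eY ρ≥0 ρ<N σ≥0 σ<N pos near = p s s' , N - (ρ + σ) , ρ , σ , (near , ρ≥0 , σ≥0) ,
        (0<-resp pos (l₀ N ρ σ) , ρ<N , σ<N) , l₁ N ρ σ , near-eq s s' ρ σ eX eY
      far-point : ∀ s s' ρ σ → X ≡ ρ + s * N → Y ≡ σ + s' * N → 0ℤ < N - ρ → 0ℤ < N - σ →
        0ℤ < - (N - (ρ + σ)) → LatticePointIn△ N t₁ t₂ t₃
      far-point s s' ρ σ eX eY ρ<N σ<N far = p' s s' , - (N - (ρ + σ)) , N - ρ , N - σ , (0<⇒0≤ far , 0<⇒0≤ ρ<N , 0<⇒0≤ σ<N) ,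
        (0<-resp (0<+ ρ<N σ<N) (l₂ N ρ σ) , 0<-resp (0<+ far σ<N) (l₃ N ρ σ) , 0<-resp (0<+ far ρ<N) (l₄ N ρ σ)) , l₅ N ρ σ ,
        far-eq s s' ρ σ eX eY

    -- If both unit vectors were integer combinations of the two edge vectors, `N` would be
    -- divisible by `N * N`, impossible for `N > 1`. So `residue-point`, applied to one of them,
    -- yields a point.
    non-unimodular-point : ∀ t₁ t₂ t₃ → 0ℤ < br t₁ t₂ t₃ - 1ℤ → LatticePointIn△ (br t₁ t₂ t₃) t₁ t₂ t₃
    non-unimodular-point t₁ t₂ t₃ N>1 =
      case residue-point t₁ t₂ t₃ N (1ℤ , 0ℤ) (proj₂ (t₃ ⊟ t₁)) (- proj₂ (t₂ ⊟ t₁)) N>0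
        (by-ring² [] (t₁ ∷ t₂ ∷ t₃ ∷ []) (λ { [] (t₁ ∷ t₂ ∷ t₃ ∷ []) → let d₂ = t₂ E.⊟ t₁ ; d₃ = t₃ E.⊟ t₁ in
          E.br t₁ t₂ t₃ E.⊡ (Κ 1ℤ , Κ 0ℤ) ≋ proj₂ d₃ E.⊡ d₂ E.⊞ (⊝ proj₂ d₂) E.⊡ d₃ }) refl refl) of λ
      { (inj₂ r) → r
      ; (inj₁ (s₁ , s₂ , e₁ , e₂)) →
        case residue-point t₁ t₂ t₃ N (0ℤ , 1ℤ) (- proj₁ (t₃ ⊟ t₁)) (proj₁ (t₂ ⊟ t₁)) N>0
          (by-ring² [] (t₁ ∷ t₂ ∷ t₃ ∷ []) (λ { [] (t₁ ∷ t₂ ∷ t₃ ∷ []) → let d₂ = t₂ E.⊟ t₁ ; d₃ = t₃ E.⊟ t₁ in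
            E.br t₁ t₂ t₃ E.⊡ (Κ 0ℤ , Κ 1ℤ) ≋ (⊝ proj₁ d₃) E.⊡ d₂ E.⊞ proj₁ d₂ E.⊡ d₃ }) refl refl) of λ
        { (inj₂ r) → r
        ; (inj₁ (s₃ , s₄ , e₃ , e₄)) → ⊥-elim (square-divides N (s₄ * s₁ - s₂ * s₃) N>1
            (trans (lem (proj₁ (t₂ ⊟ t₁)) (proj₂ (t₃ ⊟ t₁)) (proj₂ (t₂ ⊟ t₁)) (proj₁ (t₃ ⊟ t₁)))
              (trans (cong₂ _-_ (cong₂ _*_ e₄ e₁) (cong₂ _*_ e₂ e₃)) (lem' s₁ s₂ s₃ s₄ N)))) } }
      where
      N : ℤ
      N = br t₁ t₂ t₃
      sub : ∀ x → x - 1ℤ + 1ℤ ≡ x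
      sub = solve-∀
      N>0 : 0ℤ < N
      N>0 = 0<-resp (0<+ N>1 (+<+ ℕ.z<s)) (sub N)
      lem : ∀ x y z u → x * y - z * u ≡ x * y - (- z) * (- u)
      lem = solve-∀
      lem' : ∀ s₁ s₂ s₃ s₄ N → s₄ * N * (s₁ * N) - s₂ * N * (s₃ * N) ≡ N * (N * (s₄ * s₁ - s₂ * s₃))
      lem' = solve-∀
      square-divides : ∀ N q → 0ℤ < N - 1ℤ → N ≡ N * (N * q) → ⊥
      square-divides N q N>1 e = 0<0-absurd (0<-resp (0<+≤ (0<* N>1 q>0) (0<⇒0≤-1 q>0)) (trans (l₁ N q) (0-from-≡ (sym Nq≡1))))
        where
        N>0' : 0ℤ < N
        N>0' = 0<-resp (0<+ N>1 (+<+ ℕ.z<s)) (sub N)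
        l₀ : ∀ N q → N * (1ℤ - N * q) ≡ N - N * (N * q)
        l₀ = solve-∀
        l₁ : ∀ N q → (N - 1ℤ) * q + (q - 1ℤ) ≡ N * q - 1ℤ
        l₁ = solve-∀
        Nq≡1 : 1ℤ ≡ N * q
        Nq≡1 = ≡-from-0 (≡0*-cancel N>0' (trans (l₀ N q) (0-from-≡ e)))
        q>0 : 0ℤ < q
        q>0 = 0<*-cancel {N} {q} N>0' (0<-resp (+<+ {0} {1} ℕ.z<s) Nq≡1)

-- Subdivision of triangles and the common lattice point of A and R

module Polygons where
  open import Data.Vec using ([]; _∷_)
  open Plane
  open Convexity
  open Walks
  open Edges
  open Clashes
  open Barycentric
  open Localisation
  open Residues
  open PlaneOps _+_ _*_ -_
  open Weights
  open _∷_∈△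

  abstract
    comb-rotate : ∀ b₁ b₂ b₃ t₁ t₂ t₃ p → comb₂ b₁ t₁ b₂ t₂ b₃ t₃ ≡ (b₁ + b₂ + b₃) ⊡ p →
      comb₂ b₂ t₂ b₃ t₃ b₁ t₁ ≡ (b₂ + b₃ + b₁) ⊡ p
    comb-rotate b₁ b₂ b₃ t₁ t₂ t₃ p e = trans
      (by-ring² (b₁ ∷ b₂ ∷ b₃ ∷ []) (t₁ ∷ t₂ ∷ t₃ ∷ []) (λ { (b₁ ∷ b₂ ∷ b₃ ∷ []) (t₁ ∷ t₂ ∷ t₃ ∷ []) →
        (b₂ E.⊡ t₂ E.⊞ b₃ E.⊡ t₃) E.⊞ b₁ E.⊡ t₁ ≋ (b₁ E.⊡ t₁ E.⊞ b₂ E.⊡ t₂) E.⊞ b₃ E.⊡ t₃ }) refl refl)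
      (trans e (cong (_⊡ p) (rot b₁ b₂ b₃)))
      where
      rot : ∀ a b c → a + b + c ≡ b + c + a
      rot = solve-∀

    hbr-mix : ∀ b₁ b₂ b₃ t₁ t₂ t₃ p w x → comb₂ b₁ t₁ b₂ t₂ b₃ t₃ ≡ (b₁ + b₂ + b₃) ⊡ p →
      (b₁ + b₂ + b₃) * hbr t₁ p w x ≡ b₂ * hbr t₁ t₂ w x - b₃ * hbr t₃ t₁ w x
    hbr-mix b₁ b₂ b₃ t₁ t₂ t₃ p w x e = trans
      (by-ring (b₁ ∷ b₂ ∷ b₃ ∷ w ∷ []) (t₁ ∷ p ∷ x ∷ []) (λ { (b₁ ∷ b₂ ∷ b₃ ∷ w ∷ []) (t₁ ∷ p ∷ x ∷ []) →
        (b₁ ⊕ b₂ ⊕ b₃) ⊗ E.hbr t₁ p w x ≋ E.det ((b₁ ⊕ b₂ ⊕ b₃) E.⊡ p E.⊟ (b₁ ⊕ b₂ ⊕ b₃) E.⊡ t₁) (x E.⊟ w E.⊡ t₁) }) refl)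
      (trans (cong (λ y → det (y ⊟ (b₁ + b₂ + b₃) ⊡ t₁) (x ⊟ w ⊡ t₁)) (sym e))
      (by-ring (b₁ ∷ b₂ ∷ b₃ ∷ w ∷ []) (t₁ ∷ t₂ ∷ t₃ ∷ x ∷ []) (λ { (b₁ ∷ b₂ ∷ b₃ ∷ w ∷ []) (t₁ ∷ t₂ ∷ t₃ ∷ x ∷ []) →
        E.det (((b₁ E.⊡ t₁ E.⊞ b₂ E.⊡ t₂) E.⊞ b₃ E.⊡ t₃) E.⊟ (b₁ ⊕ b₂ ⊕ b₃) E.⊡ t₁) (x E.⊟ w E.⊡ t₁) ≋
        b₂ ⊗ E.hbr t₁ t₂ w x E.⊖ b₃ ⊗ E.hbr t₃ t₁ w x }) refl))

    br-mix : ∀ b₁ b₂ b₃ t₁ t₂ t₃ p → comb₂ b₁ t₁ b₂ t₂ b₃ t₃ ≡ (b₁ + b₂ + b₃) ⊡ p →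
      (b₁ + b₂ + b₃) * br t₁ t₂ p ≡ b₃ * br t₁ t₂ t₃
    br-mix b₁ b₂ b₃ t₁ t₂ t₃ p e = trans
      (by-ring (b₁ ∷ b₂ ∷ b₃ ∷ []) (t₁ ∷ t₂ ∷ p ∷ []) (λ { (b₁ ∷ b₂ ∷ b₃ ∷ []) (t₁ ∷ t₂ ∷ p ∷ []) →
        (b₁ ⊕ b₂ ⊕ b₃) ⊗ E.br t₁ t₂ p ≋ E.det (t₂ E.⊟ t₁) ((b₁ ⊕ b₂ ⊕ b₃) E.⊡ p E.⊟ (b₁ ⊕ b₂ ⊕ b₃) E.⊡ t₁) }) refl)
      (trans (cong (λ y → det (t₂ ⊟ t₁) (y ⊟ (b₁ + b₂ + b₃) ⊡ t₁)) (sym e))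
      (by-ring (b₁ ∷ b₂ ∷ b₃ ∷ []) (t₁ ∷ t₂ ∷ t₃ ∷ []) (λ { (b₁ ∷ b₂ ∷ b₃ ∷ []) (t₁ ∷ t₂ ∷ t₃ ∷ []) →
        E.det (t₂ E.⊟ t₁) (((b₁ E.⊡ t₁ E.⊞ b₂ E.⊡ t₂) E.⊞ b₃ E.⊡ t₃) E.⊟ (b₁ ⊕ b₂ ⊕ b₃) E.⊡ t₁) ≋ b₃ ⊗ E.br t₁ t₂ t₃ }) refl))

    hbr-flip : ∀ a b w x → - hbr a b w x ≡ hbr b a w x
    hbr-flip a b w x = by-ring (w ∷ []) (a ∷ b ∷ x ∷ []) (λ { (w ∷ []) (a ∷ b ∷ x ∷ []) → ⊝ E.hbr a b w x ≋ E.hbr b a w x }) refl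

    -- Replacing t₃ by p keeps x/w in the triangle when b₃ is the dominant coordinate of p relative to those of x/w.
    shrink : ∀ b₁ b₂ b₃ t₁ t₂ t₃ p w x → comb₂ b₁ t₁ b₂ t₂ b₃ t₃ ≡ (b₁ + b₂ + b₃) ⊡ p → 0ℤ < b₁ + b₂ + b₃ →
      0ℤ ≤ b₃ * hbr t₂ t₃ w x - b₁ * hbr t₁ t₂ w x → 0ℤ ≤ b₃ * hbr t₃ t₁ w x - b₂ * hbr t₁ t₂ w x →
      (w ∷ x ∈△) t₁ t₂ t₃ → (w ∷ x ∈△) t₁ t₂ p
    shrink b₁ b₂ b₃ t₁ t₂ t₃ p w x e S>0 c₁ c₂ x∈ = inside (h₁₂ x∈)
      (0≤*-cancel {b₂ + b₃ + b₁} (0<-resp S>0 (rot b₁ b₂ b₃)) (0≤-resp c₁ (sym (hbr-mix b₂ b₃ b₁ t₂ t₃ t₁ p w x (comb-rotate b₁ b₂ b₃ t₁ t₂ t₃ p e)))))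
      (0≤*-cancel {b₁ + b₂ + b₃} S>0 (0≤-resp c₂ (trans (l₁ (b₃ * hbr t₃ t₁ w x) (b₂ * hbr t₁ t₂ w x))
        (trans (cong -_ (sym (hbr-mix b₁ b₂ b₃ t₁ t₂ t₃ p w x e)))
        (trans (l₂ (b₁ + b₂ + b₃) (hbr t₁ p w x)) (cong ((b₁ + b₂ + b₃) *_) (hbr-flip t₁ p w x)))))))
      where
      rot : ∀ a b c → a + b + c ≡ b + c + a
      rot = solve-∀
      l₁ : ∀ x y → x - y ≡ - (y - x)
      l₁ = solve-∀
      l₂ : ∀ x y → - (x * y) ≡ x * (- y)
      l₂ = solve-∀

    -- The vertex that `p` may replace is the one where the ratio of the coordinate of `p` to that
    -- of `x / w` is largest. A vanishing `ξ` with positive `b` counts as an infinite ratio and is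
    -- treated before `best-ratio` applies.
    dominant : (b ξ : Fin 3 → ℤ) → (∀ j → 0ℤ ≤ ξ j) → ¬ (∀ j → 0ℤ ≤ - b j) →
      ∃[ m ] (0ℤ < b m × (∀ j → 0ℤ ≤ b m * ξ j - b j * ξ m))
    dominant b ξ ξ≥0 b≰0 = case ∀-or-∃ zero? of λ
      { (inj₂ (m , ξ≡0 , b>0)) → m , b>0 , λ j → subst (λ z → 0ℤ ≤ b m * ξ j - b j * z) (sym ξ≡0)
          (0≤-resp (0≤* (0<⇒0≤ b>0) (ξ≥0 j)) (lem (b m * ξ j) (b j)))
      ; (inj₁ ok) → case best-ratio b ξ ξ≥0 ok of λ
        { (inj₁ all) → ⊥-elim (b≰0 all)
        ; (inj₂ (m , b>0 , _ , best)) → m , b>0 , best } }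
      where
      lem : ∀ x y → x ≡ x - y * 0ℤ
      lem = solve-∀
      zero? : ∀ j → (ξ j ≡ 0ℤ → 0ℤ ≤ - b j) ⊎ (ξ j ≡ 0ℤ × 0ℤ < b j)
      zero? j = case 0<⊎ (b j) of λ
        { (inj₂ p) → inj₁ λ _ → p
        ; (inj₁ p) → case ξ j ≟ 0ℤ of λ { (yes e) → inj₂ (e , p) ; (no ¬e) → inj₁ λ e → ⊥-elim (¬e e) } }

  module Descent {n} {A R : Fin n → V2} (H : ParallelEdges A R)
    {w₁ w₂ w₃ : ℤ} (ws : Weights w₁ w₂ w₃) (i₁ i₂ i₃ : Fin n) where

    open Located H ws i₁ i₂ i₃

    abstract
      private
        measure : ∀ k N b → 0ℤ ≤ (1ℤ + k) - N → 0ℤ < N - b → 0ℤ ≤ k - b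
        measure k N b p q = 0≤-resp (0≤+ p (0<⇒0≤-1 q)) (lem k N b)
          where
          lem : ∀ k N b → 1ℤ + k - N + (N - b - 1ℤ) ≡ k - b
          lem = solve-∀

        area : ∀ b₁ b₂ b₃ t₁ t₂ t₃ p → comb₂ b₁ t₁ b₂ t₂ b₃ t₃ ≡ (b₁ + b₂ + b₃) ⊡ p → b₁ + b₂ + b₃ ≡ br t₁ t₂ t₃ →
          0ℤ < b₁ + b₂ + b₃ → b₃ ≡ br t₁ t₂ p
        area b₁ b₂ b₃ t₁ t₂ t₃ p e eN S>0 = ≡-from-0 (≡0*-cancel {b₁ + b₂ + b₃} S>0
          (trans (lem (b₁ + b₂ + b₃) b₃ (br t₁ t₂ p)) (0-from-≡ (trans (trans (*-comm (b₁ + b₂ + b₃) b₃) (cong (b₃ *_) eN)) (sym (br-mix b₁ b₂ b₃ t₁ t₂ t₃ p e))))))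
          where
          lem : ∀ S b r → S * (b - r) ≡ S * b - S * r
          lem = solve-∀

      -- Induction on a bound for twice the area. Replacing a vertex by the lattice point `p` turns
      -- the area `N` into the corresponding coordinate of `p`, which is smaller since `p` is not a
      -- vertex of the triangle.
      descend : ∀ k t₁ t₂ t₃ → Conv A t₁ → Conv A t₂ → Conv A t₃ → 0ℤ < br t₁ t₂ t₃ → 0ℤ ≤ + k - br t₁ t₂ t₃ →
        (w ∷ x ∈△) t₁ t₂ t₃ → Common A R

      private
        replace : ∀ k b₁ b₂ b₃ t₁ t₂ t₃ p → Conv A t₁ → Conv A t₂ → Conv A p → comb₂ b₁ t₁ b₂ t₂ b₃ t₃ ≡ (b₁ + b₂ + b₃) ⊡ p →
          b₁ + b₂ + b₃ ≡ br t₁ t₂ t₃ → 0ℤ < b₁ + b₂ + b₃ → 0ℤ < b₃ → 0ℤ ≤ + k - b₃ →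
          0ℤ ≤ b₃ * hbr t₂ t₃ w x - b₁ * hbr t₁ t₂ w x → 0ℤ ≤ b₃ * hbr t₃ t₁ w x - b₂ * hbr t₁ t₂ w x →
          (w ∷ x ∈△) t₁ t₂ t₃ → Common A R
        replace k b₁ b₂ b₃ t₁ t₂ t₃ p t₁∈ t₂∈ p∈ e eN S>0 b₃>0 small c₁ c₂ x∈ =
          descend k t₁ t₂ p t₁∈ t₂∈ p∈ (0<-resp b₃>0 eb) (subst (λ z → 0ℤ ≤ + k - z) eb small)
            (shrink b₁ b₂ b₃ t₁ t₂ t₃ p w x e S>0 c₁ c₂ x∈)
          where
          eb : b₃ ≡ br t₁ t₂ p
          eb = area b₁ b₂ b₃ t₁ t₂ t₃ p e eN S>0

      descend zero t₁ t₂ t₃ _ _ _ N>0 k≥N _ = ¬pos {x = br t₁ t₂ t₃} N>0 (0≤-resp k≥N (+-identityˡ (- br t₁ t₂ t₃)))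
      descend (suc k) t₁ t₂ t₃ t₁∈ t₂∈ t₃∈ N>0 k≥N x∈ = case 0<⊎ (N - 1ℤ) of λ
        { (inj₂ N≤1) → Unimodular.unimodular-common t₁∈ t₂∈ t₃∈ (≡-from-0 (0≤-antisym (0<⇒0≤-1 N>0) N≤1)) x∈
        ; (inj₁ N>1) → case non-unimodular-point t₁ t₂ t₃ N>1 of λ
          { (p , b₁ , b₂ , b₃ , (b₁≥0 , b₂≥0 , b₃≥0) , (b₁<N , b₂<N , b₃<N) , eN , e) →
            subdivide p b₁ b₂ b₃ b₁≥0 b₂≥0 b₃≥0 b₁<N b₂<N b₃<N eN e } }
        where
        N : ℤ
        N = br t₁ t₂ t₃
        subdivide : ∀ p b₁ b₂ b₃ → 0ℤ ≤ b₁ → 0ℤ ≤ b₂ → 0ℤ ≤ b₃ → 0ℤ < N - b₁ → 0ℤ < N - b₂ → 0ℤ < N - b₃ →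
          b₁ + b₂ + b₃ ≡ N → comb₂ b₁ t₁ b₂ t₂ b₃ t₃ ≡ (b₁ + b₂ + b₃) ⊡ p → Common A R
        subdivide p b₁ b₂ b₃ b₁≥0 b₂≥0 b₃≥0 b₁<N b₂<N b₃<N eN e = choose (dominant b ξ ξ≥0 b≰0)
          where
          S>0 : 0ℤ < b₁ + b₂ + b₃
          S>0 = 0<-resp N>0 (sym eN)
          p∈ : Conv A p
          p∈ = mix (weights b₁≥0 b₂≥0 b₃≥0 S>0) t₁∈ t₂∈ t₃∈ e
          b ξ : Fin 3 → ℤ
          b zero = b₁
          b (suc zero) = b₂
          b (suc (suc zero)) = b₃
          ξ zero = hbr t₂ t₃ w x
          ξ (suc zero) = hbr t₃ t₁ w x
          ξ (suc (suc zero)) = hbr t₁ t₂ w x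
          ξ≥0 : ∀ j → 0ℤ ≤ ξ j
          ξ≥0 zero = h₂₃ x∈
          ξ≥0 (suc zero) = h₃₁ x∈
          ξ≥0 (suc (suc zero)) = h₁₂ x∈
          b≰0 : ¬ (∀ j → 0ℤ ≤ - b j)
          b≰0 all = ¬pos {x = b₁ + b₂ + b₃} S>0 (0≤-resp (0≤+ (0≤+ (all zero) (all (suc zero))) (all (suc (suc zero)))) (lem b₁ b₂ b₃))
            where
            lem : ∀ a b c → - a + - b + - c ≡ - (a + b + c)
            lem = solve-∀
          rot : ∀ a b c → b + c + a ≡ a + b + c
          rot = solve-∀
          rot' : ∀ a b c → c + a + b ≡ a + b + c
          rot' = solve-∀
          e' : comb₂ b₂ t₂ b₃ t₃ b₁ t₁ ≡ (b₂ + b₃ + b₁) ⊡ p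
          e' = comb-rotate b₁ b₂ b₃ t₁ t₂ t₃ p e
          choose : ∃[ m ] (0ℤ < b m × (∀ j → 0ℤ ≤ b m * ξ j - b j * ξ m)) → Common A R
          choose (suc (suc zero) , b>0 , best) = replace k b₁ b₂ b₃ t₁ t₂ t₃ p t₁∈ t₂∈ p∈ e eN S>0 b>0 (measure (+ k) N b₃ k≥N b₃<N)
            (best zero) (best (suc zero)) x∈
          choose (zero , b>0 , best) = replace k b₂ b₃ b₁ t₂ t₃ t₁ p t₂∈ t₃∈ p∈ e' (trans (rot b₁ b₂ b₃) (trans eN (sym (br-rotate t₁ t₂ t₃))))
            (0<-resp S>0 (sym (rot b₁ b₂ b₃))) b>0 (measure (+ k) N b₁ k≥N b₁<N) (best (suc zero)) (best (suc (suc zero))) (inside (h₂₃ x∈) (h₃₁ x∈) (h₁₂ x∈))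
          choose (suc zero , b>0 , best) = replace k b₃ b₁ b₂ t₃ t₁ t₂ p t₃∈ t₁∈ p∈ (comb-rotate b₂ b₃ b₁ t₂ t₃ t₁ p e')
            (trans (rot' b₁ b₂ b₃) (trans eN (br-rotate t₃ t₁ t₂)))
            (0<-resp S>0 (sym (rot' b₁ b₂ b₃))) b>0 (measure (+ k) N b₂ k≥N b₂<N) (best (suc (suc zero))) (best zero) (inside (h₃₁ x∈) (h₁₂ x∈) (h₂₃ x∈))

    -- The point `x / w` of the hull of `R`, rewritten with points of `A` and the same total weight.
    -- Their triangle may be degenerate or negatively oriented.
    record Combination (y y' z : V2) : Set where
      constructor combination
      field
        {u₁ u₂ u₃} : ℤ
        u₁≥0 : 0ℤ ≤ u₁
        u₂≥0 : 0ℤ ≤ u₂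
        u₃≥0 : 0ℤ ≤ u₃
        y∈ : Conv A y
        y'∈ : Conv A y'
        z∈ : Conv A z
        sum≡w : u₁ + u₂ + u₃ ≡ w
        comb≡x : comb₂ u₁ y u₂ y' u₃ z ≡ x
    open Combination

    private
      abstract
        rotateᶜ : ∀ {y y' z} → Combination y y' z → Combination y' z y
        rotateᶜ {y} {y'} {z} F = combination (u₂≥0 F) (u₃≥0 F) (u₁≥0 F) (y'∈ F) (z∈ F) (y∈ F) (trans (rot (u₁ F) (u₂ F) (u₃ F)) (sum≡w F))
          (trans (by-ring² (u₁ F ∷ u₂ F ∷ u₃ F ∷ []) (y ∷ y' ∷ z ∷ []) (λ { (b₁ ∷ b₂ ∷ b₃ ∷ []) (t₁ ∷ t₂ ∷ t₃ ∷ []) →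
            (b₂ E.⊡ t₂ E.⊞ b₃ E.⊡ t₃) E.⊞ b₁ E.⊡ t₁ ≋ (b₁ E.⊡ t₁ E.⊞ b₂ E.⊡ t₂) E.⊞ b₃ E.⊡ t₃ }) refl refl) (comb≡x F))
          where
          rot : ∀ a b c → b + c + a ≡ a + b + c
          rot = solve-∀

        swapᶜ : ∀ {y y' z} → Combination y y' z → Combination y' y z
        swapᶜ {y} {y'} {z} F = combination (u₂≥0 F) (u₁≥0 F) (u₃≥0 F) (y'∈ F) (y∈ F) (z∈ F) (trans (cong (_+ u₃ F) (+-comm (u₂ F) (u₁ F))) (sum≡w F))
          (trans (by-ring² (u₁ F ∷ u₂ F ∷ u₃ F ∷ []) (y ∷ y' ∷ z ∷ []) (λ { (b₁ ∷ b₂ ∷ b₃ ∷ []) (t₁ ∷ t₂ ∷ t₃ ∷ []) →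
            (b₂ E.⊡ t₂ E.⊞ b₁ E.⊡ t₁) E.⊞ b₃ E.⊡ t₃ ≋ (b₁ E.⊡ t₁ E.⊞ b₂ E.⊡ t₂) E.⊞ b₃ E.⊡ t₃ }) refl refl) (comb≡x F))

        br-swap : ∀ a b c → - br a b c ≡ br b a c
        br-swap a b c = by-ring [] (a ∷ b ∷ c ∷ []) (λ { [] (a ∷ b ∷ c ∷ []) → ⊝ E.br a b c ≋ E.br b a c }) refl

        br-swap' : ∀ a b c → br a b c ≡ - br b a c
        br-swap' a b c = by-ring [] (a ∷ b ∷ c ∷ []) (λ { [] (a ∷ b ∷ c ∷ []) → E.br a b c ≋ ⊝ E.br b a c }) refl

        -- The homogeneous coordinates of `x / w` in the triangle `y y' s` are combinations of the
        -- given determinants with nonnegative weights. The case `s = z` is the ordinary triangle;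
        -- otherwise `z` is meant to lie on the segment from `y` to `y'`.
        fan : ∀ y y' z s → Combination y y' z → Conv A s → 0ℤ < br y y' s → 0ℤ ≤ br y y' z → 0ℤ ≤ - br y' z s → 0ℤ ≤ - br z y s → Common A R
        fan y y' z s F s∈ N>0 p q r = descend ∣ br y y' s ∣ y y' s (y∈ F) (y'∈ F) s∈ N>0
          (subst (λ t → 0ℤ ≤ t - br y y' s) (sym (0≤i⇒+∣i∣≡i (0<⇒0≤ N>0))) (0≤-≡ (x-x (br y y' s))))
          (inside (located y y' (0≤-resp (0≤* (u₃≥0 F) p) (sym (base (u₁ F) (u₂ F) (u₃ F)))))
                  (located y' s (0≤-resp (0≤+ (0≤* (u₁≥0 F) (0<⇒0≤ N>0)) (0≤* (u₃≥0 F) q)) (sym (right' (u₁ F) (u₂ F) (u₃ F)))))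
                  (located s y (0≤-resp (0≤+ (0≤* (u₂≥0 F) (0<⇒0≤ N>0)) (0≤* (u₃≥0 F) r)) (sym (left' (u₁ F) (u₂ F) (u₃ F))))))
          where
          located : ∀ a b → 0ℤ ≤ hbr a b (u₁ F + u₂ F + u₃ F) (comb₂ (u₁ F) y (u₂ F) y' (u₃ F) z) → 0ℤ ≤ hbr a b w x
          located a b = subst₂ (λ t v → 0ℤ ≤ hbr a b t v) (sum≡w F) (comb≡x F)
          base : ∀ u₁ u₂ u₃ → hbr y y' (u₁ + u₂ + u₃) (comb₂ u₁ y u₂ y' u₃ z) ≡ u₃ * br y y' z
          base u₁ u₂ u₃ = by-ring (u₁ ∷ u₂ ∷ u₃ ∷ []) (y ∷ y' ∷ z ∷ []) (λ { (u₁ ∷ u₂ ∷ u₃ ∷ []) (y ∷ y' ∷ z ∷ []) →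
            E.hbr y y' (u₁ ⊕ u₂ ⊕ u₃) ((u₁ E.⊡ y E.⊞ u₂ E.⊡ y') E.⊞ u₃ E.⊡ z) ≋ u₃ ⊗ E.br y y' z }) refl
          right' : ∀ u₁ u₂ u₃ → hbr y' s (u₁ + u₂ + u₃) (comb₂ u₁ y u₂ y' u₃ z) ≡ u₁ * br y y' s + u₃ * (- br y' z s)
          right' u₁ u₂ u₃ = by-ring (u₁ ∷ u₂ ∷ u₃ ∷ []) (y ∷ y' ∷ z ∷ s ∷ []) (λ { (u₁ ∷ u₂ ∷ u₃ ∷ []) (y ∷ y' ∷ z ∷ s ∷ []) →
            E.hbr y' s (u₁ ⊕ u₂ ⊕ u₃) ((u₁ E.⊡ y E.⊞ u₂ E.⊡ y') E.⊞ u₃ E.⊡ z) ≋ u₁ ⊗ E.br y y' s ⊕ u₃ ⊗ (⊝ E.br y' z s) }) refl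
          left' : ∀ u₁ u₂ u₃ → hbr s y (u₁ + u₂ + u₃) (comb₂ u₁ y u₂ y' u₃ z) ≡ u₂ * br y y' s + u₃ * (- br z y s)
          left' u₁ u₂ u₃ = by-ring (u₁ ∷ u₂ ∷ u₃ ∷ []) (y ∷ y' ∷ z ∷ s ∷ []) (λ { (u₁ ∷ u₂ ∷ u₃ ∷ []) (y ∷ y' ∷ z ∷ s ∷ []) →
            E.hbr s y (u₁ ⊕ u₂ ⊕ u₃) ((u₁ E.⊡ y E.⊞ u₂ E.⊡ y') E.⊞ u₃ E.⊡ z) ≋ u₂ ⊗ E.br y y' s ⊕ u₃ ⊗ (⊝ E.br z y s) }) refl

        nondegenerate : ∀ y y' z → Combination y y' z → 0ℤ < br y y' z → Common A R
        nondegenerate y y' z F N>0 = fan y y' z z F (z∈ F) N>0 (0<⇒0≤ N>0)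
          (0≤-≡ (cong -_ (br-abb y' z))) (0≤-≡ (cong -_ (br-aba z y)))

        module Collinear {s : V2} (s∈ : Conv A s) where

          fan⁺ : ∀ y y' z → Combination y y' z → br y y' z ≡ 0ℤ → 0ℤ < br y y' s → 0ℤ ≤ - br y' z s → 0ℤ ≤ - br z y s → Common A R
          fan⁺ y y' z F e = λ N>0 → fan y y' z s F s∈ N>0 (0≤-≡ e)

          fan⁻ : ∀ y y' z → Combination y y' z → br y y' z ≡ 0ℤ → 0ℤ < - br y y' s → 0ℤ ≤ br y' z s → 0ℤ ≤ br z y s → Common A R
          fan⁻ y y' z F e p q r = fan⁺ y' y z (swapᶜ F) (trans (sym (br-swap y y' z)) (cong -_ e))
            (0<-resp p (br-swap y y' s)) (0≤-resp r (br-swap' z y s)) (0≤-resp q (br-swap' y' z s))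

          other-sign : ∀ a b c → b + c + a ≡ 0ℤ → 0ℤ < a → 0ℤ ≤ b → 0ℤ < - c
          other-sign a b c e p q = 0<-resp (0<+≤ p q) (trans (lem a b c) (trans (cong (_+_ (- c)) e) (+-identityʳ (- c))))
            where
            lem : ∀ a b c → a + b ≡ - c + (b + c + a)
            lem = solve-∀

          other-sign' : ∀ a b c → b + c + a ≡ 0ℤ → 0ℤ < - a → 0ℤ ≤ - b → 0ℤ < c
          other-sign' a b c e p q = 0<-resp (0<+≤ p q) (trans (lem a b c) (trans (cong (λ t → c - t) e) (+-identityʳ c)))
            where
            lem : ∀ a b c → - a + - b ≡ c - (b + c + a)
            lem = solve-∀

          -- For collinear points the three signed areas with apex `s` have sum zero, so one of them
          -- is opposed by the other two. It belongs to the segment that contains the third point,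
          -- and this segment spans with `s` a genuine triangle around `x / w`.
          by-signs : ∀ y y' z → Combination y y' z → br y y' z ≡ 0ℤ →
            ¬ (br y y' s ≡ 0ℤ × br y' z s ≡ 0ℤ) → Common A R
          by-signs y y' z F e ¬0 = by-sign σ₃
            (λ p₃ → case 0<⊎ σ₁ of λ
              { (inj₁ p₁) → neg₂ (other-sign σ₃ σ₁ σ₂ sum p₃ (0<⇒0≤ p₁)) (0<⇒0≤ p₃) (0<⇒0≤ p₁)
              ; (inj₂ n₁) → case 0<⊎ σ₂ of λ
                { (inj₂ n₂) → fan⁺ y y' z F e p₃ n₁ n₂
                ; (inj₁ p₂) → neg₁ (other-sign σ₂ σ₃ σ₁ (trans (rot₂ σ₁ σ₂ σ₃) sum) p₂ (0<⇒0≤ p₃)) (0<⇒0≤ p₂) (0<⇒0≤ p₃) } })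
            (λ e₃ → by-sign σ₁
              (λ p₁ → pos₁ p₁ (0<⇒0≤ (other-sign σ₁ σ₃ σ₂ (trans (rot₁ σ₁ σ₂ σ₃) sum) p₁ (0≤-≡ e₃))) (0≤-≡ (cong -_ e₃)))
              (λ e₁ → ⊥-elim (¬0 (e₃ , e₁)))
              (λ n₁ → neg₁ n₁ (0<⇒0≤ (other-sign' σ₁ σ₃ σ₂ (trans (rot₁ σ₁ σ₂ σ₃) sum) n₁ (0≤-≡ (cong -_ e₃)))) (0≤-≡ e₃)))
            (λ n₃ → case 0≤⊎ σ₁ of λ
              { (inj₂ n₁) → pos₂ (other-sign' σ₃ σ₁ σ₂ sum n₃ (0<⇒0≤ n₁)) (0<⇒0≤ n₃) (0<⇒0≤ n₁)
              ; (inj₁ p₁) → case 0≤⊎ σ₂ of λ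
                { (inj₁ p₂) → fan⁻ y y' z F e n₃ p₁ p₂
                ; (inj₂ n₂) → pos₁ (other-sign' σ₂ σ₃ σ₁ (trans (rot₂ σ₁ σ₂ σ₃) sum) n₂ (0<⇒0≤ n₃)) (0<⇒0≤ n₂) (0<⇒0≤ n₃) } })
            where
            σ₁ σ₂ σ₃ : ℤ
            σ₁ = br y' z s
            σ₂ = br z y s
            σ₃ = br y y' s
            sum : σ₁ + σ₂ + σ₃ ≡ 0ℤ
            sum = trans (barycentric-sum y y' z s) e
            rot₁ : ∀ a b c → c + b + a ≡ a + b + c
            rot₁ = solve-∀
            rot₂ : ∀ a b c → c + a + b ≡ a + b + c
            rot₂ = solve-∀
            e' : br y' z y ≡ 0ℤ
            e' = trans (br-rotate y y' z) e
            e'' : br z y y' ≡ 0ℤ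
            e'' = trans (br-rotate y' z y) e'
            pos₁ : 0ℤ < σ₁ → 0ℤ ≤ - σ₂ → 0ℤ ≤ - σ₃ → Common A R
            pos₁ = fan⁺ y' z y (rotateᶜ F) e'
            pos₂ : 0ℤ < σ₂ → 0ℤ ≤ - σ₃ → 0ℤ ≤ - σ₁ → Common A R
            pos₂ = fan⁺ z y y' (rotateᶜ (rotateᶜ F)) e''
            neg₁ : 0ℤ < - σ₁ → 0ℤ ≤ σ₂ → 0ℤ ≤ σ₃ → Common A R
            neg₁ = fan⁻ y' z y (rotateᶜ F) e'
            neg₂ : 0ℤ < - σ₂ → 0ℤ ≤ σ₃ → 0ℤ ≤ σ₁ → Common A R
            neg₂ = fan⁻ z y y' (rotateᶜ (rotateᶜ F)) e''

        on-line : ∀ y y' → ¬ y ≡ y' → (∀ l → br y y' (A l) ≡ 0ℤ) → ∀ l m k → br (A l) (A m) (A k) ≡ 0ℤ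
        on-line y y' y≢y' all l m k = case sum-of-squares (y' ⊟ y) of λ
          { (inj₂ e) → ⊥-elim (y≢y' (sym (trans (⊟-⊞ y' y) (trans (cong (y ⊞_) e) (cong₂ _,_ (+-identityʳ (proj₁ y)) (+-identityʳ (proj₂ y)))))))
          ; (inj₁ sq) → ≡0*-cancel sq (trans (lem y y' (A l) (A m) (A k))
              (trans (cong₂ (λ s t → s * dot₂ v (A m ⊟ A l) - t * dot₂ v (A k ⊟ A l)) (cong₂ _-_ (all k) (all l)) (cong₂ _-_ (all m) (all l)))
                refl)) }
          where
          v : V2
          v = y' ⊟ y
          lem : ∀ y y' a b c → dot₂ (y' ⊟ y) (y' ⊟ y) * br a b c ≡
            (br y y' c - br y y' a) * dot₂ (y' ⊟ y) (b ⊟ a) - (br y y' b - br y y' a) * dot₂ (y' ⊟ y) (c ⊟ a)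
          lem y y' a b c = by-ring [] (y ∷ y' ∷ a ∷ b ∷ c ∷ []) (λ { [] (y ∷ y' ∷ a ∷ b ∷ c ∷ []) → let v = y' E.⊟ y in
            E.dot₂ v v ⊗ E.br a b c ≋ (E.br y y' c E.⊖ E.br y y' a) ⊗ E.dot₂ v (b E.⊟ a) E.⊖ (E.br y y' b E.⊖ E.br y y' a) ⊗ E.dot₂ v (c E.⊟ a) }) refl

    abstract
      -- When the chosen triple is degenerate, a vertex of `A` off its line supplies the apex of a
      -- triangle. Such a vertex is missing only if the three points coincide, and then `x / w` is
      -- itself a lattice point of `A`.
      common-point : (∃[ l ] ∃[ m ] ∃[ k ] (¬ br (A l) (A m) (A k) ≡ 0ℤ)) →
        comb₂ w₁ (A i₁) w₂ (A i₂) w₃ (A i₃) ≡ x → Common A R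
      common-point (l , m , k , noncollinear) e = by-sign (br y y' z)
        (nondegenerate y y' z F)
        degenerate
        (λ N<0 → nondegenerate y' y z (swapᶜ F) (0<-resp N<0 (br-swap y y' z)))
        where
        y y' z : V2
        y = A i₁
        y' = A i₂
        z = A i₃
        F : Combination y y' z
        F = combination (w₁≥0 ws) (w₂≥0 ws) (w₃≥0 ws) (gen i₁) (gen i₂) (gen i₃) refl e
        zero? : ∀ l → (br y y' (A l) ≡ 0ℤ × br y' z (A l) ≡ 0ℤ) ⊎ ¬ (br y y' (A l) ≡ 0ℤ × br y' z (A l) ≡ 0ℤ)
        zero? l = case br y y' (A l) ≟ 0ℤ of λ
          { (no ¬p) → inj₂ λ p → ¬p (proj₁ p)
          ; (yes p) → case br y' z (A l) ≟ 0ℤ of λ { (no ¬q) → inj₂ λ q → ¬q (proj₂ q) ; (yes q) → inj₁ (p , q) } }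
        all-equal : y ≡ y' → y' ≡ z → Common A R
        all-equal e₁ e₂ = y , gen i₁ , mix ws (gen i₁) (gen i₂) (gen i₃)
          (trans (sym e) (trans (cong₂ (λ a b → comb₂ w₁ y w₂ a w₃ b) (sym e₁) (sym (trans e₁ e₂)))
            (by-ring² (w₁ ∷ w₂ ∷ w₃ ∷ []) (y ∷ []) (λ { (w₁ ∷ w₂ ∷ w₃ ∷ []) (y ∷ []) →
              (w₁ E.⊡ y E.⊞ w₂ E.⊡ y) E.⊞ w₃ E.⊡ y ≋ (w₁ ⊕ w₂ ⊕ w₃) E.⊡ y }) refl refl)))
        degenerate : br y y' z ≡ 0ℤ → Common A R
        degenerate N≡0 = case ∀-or-∃ zero? of λ
          { (inj₂ (l , ¬0)) → Collinear.by-signs (gen l) y y' z F N≡0 ¬0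
          ; (inj₁ all) → case ≡-dec _≟_ _≟_ y y' of λ
            { (no y≢y') → ⊥-elim (noncollinear (on-line y y' y≢y' (proj₁ ∘ all) l m k))
            ; (yes e₁) → case ≡-dec _≟_ _≟_ y' z of λ
              { (no y'≢z) → ⊥-elim (noncollinear (on-line y' z y'≢z (proj₂ ∘ all) l m k))
              ; (yes e₂) → all-equal e₁ e₂ } } }

-- Linear functionals, lexicographic perturbation and vertices

module Vertices where
  open import Data.List using (List; []; _∷_)
  open Plane

  abstract
    dot-+ : ∀ c x y → dot c (x +v y) ≡ dot c x + dot c y
    dot-+ (c₁ , c₂ , c₃) (x₁ , x₂ , x₃) (y₁ , y₂ , y₃) = lem c₁ c₂ c₃ x₁ x₂ x₃ y₁ y₂ y₃
      where
      lem : ∀ c₁ c₂ c₃ x₁ x₂ x₃ y₁ y₂ y₃ → c₁ * (x₁ + y₁) + c₂ * (x₂ + y₂) + c₃ * (x₃ + y₃) ≡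
        c₁ * x₁ + c₂ * x₂ + c₃ * x₃ + (c₁ * y₁ + c₂ * y₂ + c₃ * y₃)
      lem = solve-∀

    dot-- : ∀ c x y → dot c (x -v y) ≡ dot c x - dot c y
    dot-- (c₁ , c₂ , c₃) (x₁ , x₂ , x₃) (y₁ , y₂ , y₃) = lem c₁ c₂ c₃ x₁ x₂ x₃ y₁ y₂ y₃
      where
      lem : ∀ c₁ c₂ c₃ x₁ x₂ x₃ y₁ y₂ y₃ → c₁ * (x₁ - y₁) + c₂ * (x₂ - y₂) + c₃ * (x₃ - y₃) ≡
        c₁ * x₁ + c₂ * x₂ + c₃ * x₃ - (c₁ * y₁ + c₂ * y₂ + c₃ * y₃)
      lem = solve-∀

    dot-· : ∀ c k x → dot c (k ·v x) ≡ k * dot c x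
    dot-· (c₁ , c₂ , c₃) k (x₁ , x₂ , x₃) = lem c₁ c₂ c₃ k x₁ x₂ x₃
      where
      lem : ∀ c₁ c₂ c₃ k x₁ x₂ x₃ → c₁ * (k * x₁) + c₂ * (k * x₂) + c₃ * (k * x₃) ≡ k * (c₁ * x₁ + c₂ * x₂ + c₃ * x₃)
      lem = solve-∀

    +-dot : ∀ c d x → dot (c +v d) x ≡ dot c x + dot d x
    +-dot (c₁ , c₂ , c₃) (d₁ , d₂ , d₃) (x₁ , x₂ , x₃) = lem c₁ c₂ c₃ d₁ d₂ d₃ x₁ x₂ x₃
      where
      lem : ∀ c₁ c₂ c₃ d₁ d₂ d₃ x₁ x₂ x₃ → (c₁ + d₁) * x₁ + (c₂ + d₂) * x₂ + (c₃ + d₃) * x₃ ≡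
        c₁ * x₁ + c₂ * x₂ + c₃ * x₃ + (d₁ * x₁ + d₂ * x₂ + d₃ * x₃)
      lem = solve-∀

    ·-dot : ∀ k c x → dot (k ·v c) x ≡ k * dot c x
    ·-dot k (c₁ , c₂ , c₃) (x₁ , x₂ , x₃) = lem k c₁ c₂ c₃ x₁ x₂ x₃
      where
      lem : ∀ k c₁ c₂ c₃ x₁ x₂ x₃ → k * c₁ * x₁ + k * c₂ * x₂ + k * c₃ * x₃ ≡ k * (c₁ * x₁ + c₂ * x₂ + c₃ * x₃)
      lem = solve-∀

    combination-dot : ∀ k c d x → dot ((k ·v c) +v d) x ≡ k * dot c x + dot d x
    combination-dot k c d x = trans (+-dot (k ·v c) d x) (cong (_+ dot d x) (·-dot k c x))

    dual-basis-dot : ∀ x₁ x₂ x₃ → (dot (1ℤ , 0ℤ , 0ℤ) (x₁ , x₂ , x₃) ≡ x₁) × (dot (0ℤ , 1ℤ , 0ℤ) (x₁ , x₂ , x₃) ≡ x₂) × (dot (0ℤ , 0ℤ , 1ℤ) (x₁ , x₂ , x₃) ≡ x₃)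
    dual-basis-dot x₁ x₂ x₃ = l₁ x₁ x₂ x₃ , l₂ x₁ x₂ x₃ , l₃ x₁ x₂ x₃
      where
      l₁ : ∀ x₁ x₂ x₃ → 1ℤ * x₁ + 0ℤ * x₂ + 0ℤ * x₃ ≡ x₁
      l₁ = solve-∀
      l₂ : ∀ x₁ x₂ x₃ → 0ℤ * x₁ + 1ℤ * x₂ + 0ℤ * x₃ ≡ x₂
      l₂ = solve-∀
      l₃ : ∀ x₁ x₂ x₃ → 0ℤ * x₁ + 0ℤ * x₂ + 1ℤ * x₃ ≡ x₃
      l₃ = solve-∀

  ε₁ ε₂ ε₃ : V3
  ε₁ = 1ℤ , 0ℤ , 0ℤ
  ε₂ = 0ℤ , 1ℤ , 0ℤ
  ε₃ = 0ℤ , 0ℤ , 1ℤ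

  abstract
    ≡-by-coordinates : ∀ x y → dot ε₁ x ≡ dot ε₁ y → dot ε₂ x ≡ dot ε₂ y → dot ε₃ x ≡ dot ε₃ y → x ≡ y
    ≡-by-coordinates (x₁ , x₂ , x₃) (y₁ , y₂ , y₃) e₁ e₂ e₃ = cong₂ _,_
      (trans (sym (proj₁ (dual-basis-dot x₁ x₂ x₃))) (trans e₁ (proj₁ (dual-basis-dot y₁ y₂ y₃))))
      (cong₂ _,_ (trans (sym (proj₁ (proj₂ (dual-basis-dot x₁ x₂ x₃)))) (trans e₂ (proj₁ (proj₂ (dual-basis-dot y₁ y₂ y₃)))))
                 (trans (sym (proj₂ (proj₂ (dual-basis-dot x₁ x₂ x₃)))) (trans e₃ (proj₂ (proj₂ (dual-basis-dot y₁ y₂ y₃))))))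

    ≡-by-dot : ∀ x y → (∀ c → dot c x ≡ dot c y) → x ≡ y
    ≡-by-dot x y h = ≡-by-coordinates x y (h ε₁) (h ε₂) (h ε₃)

    list-argmax : ∀ (c : V3) x V → ∃[ v ] maximises (x ∷ V) c v
    list-argmax c x [] = x , here refl , λ { w (here refl) → ≤-refl }
    list-argmax c x (y ∷ V) = case list-argmax c y V of λ
      { (v , v∈ , v-max) → case ≤-total (dot c x) (dot c v) of λ
        { (inj₁ p) → v , there v∈ , λ { w (here refl) → p ; w (there w∈) → v-max w w∈ }
        ; (inj₂ p) → x , here refl , λ { w (here refl) → ≤-refl ; w (there w∈) → ≤-trans (v-max w w∈) p } } }

    max-exists : ∀ c V → ∃[ x ] (x ∈ V) → ∃[ v ] maximises V c v
    max-exists c (x ∷ V) _ = list-argmax c x V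
    max-exists c [] (_ , ())

    list-bound : ∀ (c : V3) V → ∃[ K ] (0ℤ ≤ K × (∀ v → v ∈ V → 0ℤ ≤ K + dot c v × 0ℤ ≤ K - dot c v))
    list-bound c [] = 0ℤ , ≤-refl , λ v ()
    list-bound c (x ∷ V) = case list-bound c V of λ
      { (K , K≥0 , h) → K + + ∣ dot c x ∣ , 0≤+ K≥0 (+≤+ ℕ.z≤n) , λ
        { v (here refl) → 0≤-resp (0≤+ K≥0 (proj₁ (∣x∣ (dot c v)))) (l₁ K _ (dot c v)) , 0≤-resp (0≤+ K≥0 (proj₂ (∣x∣ (dot c v)))) (l₂ K _ (dot c v))
        ; v (there v∈) → 0≤-resp (0≤+ (proj₁ (h v v∈)) (+≤+ ℕ.z≤n)) (l₃ K (+ ∣ dot c x ∣) (dot c v)) ,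
                         0≤-resp (0≤+ (proj₂ (h v v∈)) (+≤+ ℕ.z≤n)) (l₄ K (+ ∣ dot c x ∣) (dot c v)) } }
      where
      ∣x∣ : ∀ x → 0ℤ ≤ + ∣ x ∣ + x × 0ℤ ≤ + ∣ x ∣ - x
      ∣x∣ (+ n) = +≤+ ℕ.z≤n , 0≤-≡ (+-inverseʳ (+ n))
      ∣x∣ -[1+ n ] = 0≤-≡ (+-inverseˡ -[1+ n ]) , +≤+ ℕ.z≤n
      l₁ : ∀ K a d → K + (a + d) ≡ K + a + d
      l₁ = solve-∀
      l₂ : ∀ K a d → K + (a - d) ≡ K + a - d
      l₂ = solve-∀
      l₃ : ∀ K a d → K + d + a ≡ K + a + d
      l₃ = solve-∀
      l₄ : ∀ K a d → K - d + a ≡ K + a - d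
      l₄ = solve-∀

    -- For large M the functional M c + d orders V first by c and then by d.
    lexicographic : ∀ V (c d : V3) → ∃[ M ] (∀ v w → v ∈ V → w ∈ V → dot c w < dot c v →
      dot ((M ·v c) +v d) w < dot ((M ·v c) +v d) v)
    lexicographic V c d = case list-bound d V of λ
      { (K , K≥0 , h) → K + K + 1ℤ , λ v w v∈ w∈ p → 0<⇒< (0<-resp
          (0<+≤ (0≤+< (0≤* (0≤+ (0≤+ K≥0 K≥0) (+≤+ ℕ.z≤n)) (0<⇒0≤-1 (<⇒0< p))) (+<+ {0} {1} ℕ.z<s))
            (0≤+ (proj₁ (h v v∈)) (proj₂ (h w w∈))))
          (trans (lem K (dot c v) (dot c w) (dot d v) (dot d w))
            (sym (cong₂ _-_ (combination-dot (K + K + 1ℤ) c d v) (combination-dot (K + K + 1ℤ) c d w))))) }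
      where
      lem : ∀ K cv cw dv dw → (K + K + 1ℤ) * (cv - cw - 1ℤ) + 1ℤ + (K + dv + (K - dw)) ≡
        (K + K + 1ℤ) * cv + dv - ((K + K + 1ℤ) * cw + dw)
      lem = solve-∀

  lex : List V3 → V3 → V3 → V3
  lex V c d = (proj₁ (lexicographic V c d) ·v c) +v d

  abstract
    lex-< : ∀ V c d {v w} → v ∈ V → w ∈ V → dot c w < dot c v → dot (lex V c d) w < dot (lex V c d) v
    lex-< V c d {v} {w} = proj₂ (lexicographic V c d) v w

    lex-≤ : ∀ V c d {v w} → v ∈ V → w ∈ V → dot (lex V c d) w ≤ dot (lex V c d) v → dot c w ≤ dot c v
    lex-≤ V c d {v} {w} v∈ w∈ p = case <-cmp (dot c v) (dot c w) of λ
      { (tri< q _ _) → ⊥-elim (<⇒≱ (lex-< V c d w∈ v∈ q) p)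
      ; (tri≈ _ q _) → ≤-reflexive (sym q)
      ; (tri> _ _ q) → <⇒≤ q }

    lex-dot : ∀ V c d x → dot (lex V c d) x ≡ proj₁ (lexicographic V c d) * dot c x + dot d x
    lex-dot V c d x = combination-dot (proj₁ (lexicographic V c d)) c d x

    +-cancelˡ : ∀ {a b} k → k + a ≡ k + b → a ≡ b
    +-cancelˡ {a} {b} k e = trans (sym (l k a)) (trans (cong (λ t → - k + t) e) (l k b))
      where
      l : ∀ k a → - k + (k + a) ≡ a
      l = solve-∀

    lex-≡ : ∀ V c d {v w} → v ∈ V → w ∈ V → dot (lex V c d) w ≡ dot (lex V c d) v → dot c w ≡ dot c v × dot d w ≡ dot d v
    lex-≡ V c d {v} {w} v∈ w∈ e = ec , +-cancelˡ (M * dot c v) (trans (cong (λ t → M * t + dot d w) (sym ec)) (trans (sym (lex-dot V c d w)) (trans e (lex-dot V c d v))))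
      where
      M : ℤ
      M = proj₁ (lexicographic V c d)
      ec : dot c w ≡ dot c v
      ec = ≤-antisym (lex-≤ V c d v∈ w∈ (≤-reflexive e)) (lex-≤ V c d w∈ v∈ (≤-reflexive (sym e)))

    lex-mono : ∀ V c d {v w} → dot c w ≡ dot c v → dot d w ≤ dot d v → dot (lex V c d) w ≤ dot (lex V c d) v
    lex-mono V c d {v} {w} e p = subst₂ _≤_ (sym (trans (lex-dot V c d w) (cong (λ t → M * t + dot d w) e))) (sym (lex-dot V c d v))
      (+-monoʳ-≤ (M * dot c v) p)
      where
      M : ℤ
      M = proj₁ (lexicographic V c d)

    maximisers-≡ : ∀ {V} c {v w} → maximises V c v → maximises V c w → dot c w ≡ dot c v
    maximisers-≡ c {v} {w} (v∈ , v-max) (w∈ , w-max) = ≤-antisym (v-max w w∈) (w-max v v∈)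

    maximises-≡ : ∀ {V} c {v w} → maximises V c v → w ∈ V → dot c w ≡ dot c v → maximises V c w
    maximises-≡ c {v} {w} (v∈ , v-max) w∈ e = w∈ , λ u u∈ → subst (dot c u ≤_) (sym e) (v-max u u∈)

    vertex∈ : ∀ {V v} → isVertex V v → v ∈ V
    vertex∈ (c , (v∈ , _) , _) = v∈

    -- Ties under `c` are broken by the three coordinates in turn. The perturbed functional has a
    -- unique maximiser, which is therefore a vertex.
    vertex-max : ∀ V → ∃[ x ] (x ∈ V) → ∀ c → ∃[ v ] (isVertex V v × maximises V c v)
    vertex-max V ne c = case max-exists c₃ V ne of λ
      { (v , v-max) → v , (c₃ , v-max , λ w w-max → unique v-max w-max) , weaken v-max }
      where
      c₁ c₂ c₃ : V3
      c₁ = lex V c ε₁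
      c₂ = lex V c₁ ε₂
      c₃ = lex V c₂ ε₃
      weaken : ∀ {v} → maximises V c₃ v → maximises V c v
      weaken (v∈ , h) = v∈ , λ w w∈ → lex-≤ V c ε₁ v∈ w∈ (lex-≤ V c₁ ε₂ v∈ w∈ (lex-≤ V c₂ ε₃ v∈ w∈ (h w w∈)))
      unique : ∀ {v w} → maximises V c₃ v → maximises V c₃ w → w ≡ v
      unique {v} {w} m m' = ≡-by-coordinates w v (proj₂ e₁) (proj₂ e₂) (proj₂ e₃)
        where
        v∈ : v ∈ V
        v∈ = proj₁ m
        w∈ : w ∈ V
        w∈ = proj₁ m'
        e₃ : dot c₂ w ≡ dot c₂ v × dot ε₃ w ≡ dot ε₃ v
        e₃ = lex-≡ V c₂ ε₃ v∈ w∈ (maximisers-≡ c₃ m m')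
        e₂ : dot c₁ w ≡ dot c₁ v × dot ε₂ w ≡ dot ε₂ v
        e₂ = lex-≡ V c₁ ε₂ v∈ w∈ (proj₁ e₃)
        e₁ : dot c w ≡ dot c v × dot ε₁ w ≡ dot ε₁ v
        e₁ = lex-≡ V c ε₁ v∈ w∈ (proj₁ e₂)

    max-over-vertices : ∀ {V} c {v} → v ∈ V → (∀ w → isVertex V w → dot c w ≤ dot c v) → maximises V c v
    max-over-vertices {V} c {v} v∈ h = case vertex-max V (v , v∈) c of λ
      { (u , u-vertex , (u∈ , u-max)) → v∈ , λ w w∈ → ≤-trans (u-max w w∈) (h u u-vertex) }

    -- The normal cone of a vertex is full-dimensional.
    vertex-perturb : ∀ {V v} (vx : isVertex V v) d → maximises V (lex V (proj₁ vx) d) v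
    vertex-perturb {V} {v} (c , (v∈ , v-max) , uniq) d = v∈ , λ w w∈ → case <-cmp (dot c w) (dot c v) of λ
      { (tri< p _ _) → <⇒≤ (lex-< V c d v∈ w∈ p)
      ; (tri≈ _ e _) → ≤-reflexive (cong (dot (lex V c d)) (uniq w (maximises-≡ c (v∈ , v-max) w∈ e)))
      ; (tri> _ _ p) → ⊥-elim (<⇒≱ p (v-max w w∈)) }

-- Vertices of equivalent polytopes with the same normal cone

module Mates where
  open import Data.List using (List)
  open Vertices

  -- v and w have the same normal cone.
  record Mate (V W : List V3) (v w : V3) : Set where
    field
      left-vertex : isVertex V v
      right-vertex : isVertex W w
      to : ∀ d → maximises V d v → maximises W d w
      from : ∀ d → maximises W d w → maximises V d v
  open Mate

  mate-sym : ∀ {V W v w} → Mate V W v w → Mate W V w v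
  mate-sym m = record { left-vertex = right-vertex m ; right-vertex = left-vertex m ; to = from m ; from = to m }

  abstract
    mate-unique : ∀ {V W v w w'} → Mate V W v w → Mate V W v w' → w ≡ w'
    mate-unique {w = w} {w'} m m' = case right-vertex m of λ
      { (c , w-max , unique) → sym (unique w' (to m' c (from m c w-max))) }

    equivalence-sym : ∀ {V W} → MinkowskiEquivalent V W → MinkowskiEquivalent W V
    equivalence-sym (f , g) = (λ c → map₂ (λ h d → ⇔-sym (h d)) (g c)) , (λ c → map₂ (λ h d → ⇔-sym (h d)) (f c))
      where
      ⇔-sym : ∀ {A B : Set} → A ⇔ B → B ⇔ A
      ⇔-sym h = mk⇔ (Equivalence.from h) (Equivalence.to h)

    -- Equivalence matches the normal cone of `v` with that of some face of `W`. The cone contains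
    -- `lex V c d` for every `d`, so any two vertices of that face agree under every functional, and
    -- the face is a single vertex.
    mate-exists : ∀ {V W} → MinkowskiEquivalent V W → ∃[ x ] (x ∈ W) → ∀ {v} → isVertex V v → ∃[ w ] Mate V W v w
    mate-exists {V} {W} (equiv , _) ne {v} v-vertex@(c , v-max , unique) = case equiv c of λ
      { (c' , same) → case vertex-max W ne c' of λ
        { (w , w-vertex , w-max) → w , record
          { left-vertex = v-vertex
          ; right-vertex = w-vertex
          ; to = λ d m → Equivalence.to (same d) (cone d m) w w-vertex w-max
          ; from = λ d m → Equivalence.from (same d) (λ u u-vertex u-max →
              subst (maximises W d) (sym (single c' same w-vertex w-max u-vertex u-max)) m) v v-vertex v-max } } }
      where
      cone : ∀ d → maximises V d v → faceLe V c d
      cone d m u u-vertex u-max = subst (maximises V d) (sym (unique u u-max)) m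
      module _ (c' : V3) (same : ∀ d → faceLe V c d ⇔ faceLe W c' d)
        {w u} (w-vertex : isVertex W w) (w-max : maximises W c' w) (u-vertex : isVertex W u) (u-max : maximises W c' u) where
        agree : ∀ d → maximises V d v → dot d u ≡ dot d w
        agree d m = maximisers-≡ d (Equivalence.to (same d) (cone d m) w w-vertex w-max) (Equivalence.to (same d) (cone d m) u u-vertex u-max)
        single : u ≡ w
        single = ≡-by-dot u w λ d → +-cancelˡ (M d * dot c w)
          (trans (cong (λ t → M d * t + dot d u) (sym (agree c v-max)))
          (trans (sym (lex-dot V c d u)) (trans (agree (lex V c d) (vertex-perturb v-vertex d)) (lex-dot V c d w))))
          where
          M : V3 → ℤ
          M d = proj₁ (lexicographic V c d)

    edge-transport : ∀ {V W v₁ v₂ w₁ w₂} → (∀ {w} → isVertex W w → ∃[ v ] Mate V W v w) →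
      Mate V W v₁ w₁ → Mate V W v₂ w₂ → isEdge V v₁ v₂ → isEdge W w₁ w₂
    edge-transport {V} {W} {v₁} {v₂} {w₁} {w₂} mates m₁ m₂ (_ , _ , v₁≢v₂ , c , h) =
      right-vertex m₁ , right-vertex m₂ ,
      (λ e → v₁≢v₂ (mate-unique (mate-sym m₁) (subst (λ w → Mate W V w v₂) (sym e) (mate-sym m₂)))) ,
      c , λ x → mk⇔ (λ p → forward (mates (proj₁ p)) (proj₂ p))
        (λ { (inj₁ refl) → right-vertex m₁ , to m₁ c (proj₂ (Equivalence.from (h v₁) (inj₁ refl)))
           ; (inj₂ refl) → right-vertex m₂ , to m₂ c (proj₂ (Equivalence.from (h v₂) (inj₂ refl))) })
      where
      forward : ∀ {x} → ∃[ v ] Mate V W v x → maximises W c x → x ≡ w₁ ⊎ x ≡ w₂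
      forward {x} (v , m) x-max = case Equivalence.to (h v) (left-vertex m , from m c x-max) of λ
        { (inj₁ e) → inj₁ (mate-unique (subst (λ v → Mate V W v x) e m) m₁)
        ; (inj₂ e) → inj₂ (mate-unique (subst (λ v → Mate V W v x) e m) m₂) }

  -- A polytope with the vertices and the relevant edges of a prism: the two vertices
  -- over j are vx false j and vx true j.
  record Labelled (X : List V3) {n : ℕ} (vx : Bool → Fin n → V3) : Set where
    field
      vertex : ∀ s j → isVertex X (vx s j)
      cover : ∀ {w} → isVertex X w → ∃[ s ] ∃[ j ] (w ≡ vx s j)
      vertical : ∀ s j → isEdge X (vx s j) (vx (not s) j)
      edges : ∀ s j {w} → isEdge X (vx s j) w → w ≡ vx (not s) j ⊎ ∃[ j' ] (w ≡ vx s j')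
      -- Labels come from a list that may repeat a point, so two labels may name one vertex; they
      -- then agree on both sides.
      same-fibre : ∀ s {i j} → vx s i ≡ vx s j → vx (not s) i ≡ vx (not s) j
  open Labelled

  abstract
    labelled-mate : ∀ {V W} {n} {vx vx' : Bool → Fin n → V3} → Labelled V vx → (∀ s j → Mate V W (vx s j) (vx' s j)) →
      (∀ {w} → isVertex W w → ∃[ v ] Mate W V w v) → Labelled W vx'
    labelled-mate {V} {W} {n} {vx} {vx'} L m back = record
      { vertex = λ s j → right-vertex (m s j)
      ; cover = cover'
      ; vertical = λ s j → edge-transport (map₂ mate-sym ∘ back) (m s j) (m (not s) j) (vertical L s j)
      ; edges = λ s j {w} e → case cover' (proj₁ (proj₂ e)) of λ { (s' , j' , refl) → edges' s j s' j' e }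
      ; same-fibre = λ s {i} {j} e → mate-unique (m (not s) i) (subst (λ v → Mate V W v (vx' (not s) j))
          (sym (same-fibre L s (mate-unique (mate-sym (m s i)) (subst (λ w → Mate W V w (vx s j)) (sym e) (mate-sym (m s j)))))) (m (not s) j)) }
      where
      cover' : ∀ {w} → isVertex W w → ∃[ s ] ∃[ j ] (w ≡ vx' s j)
      cover' {w} w-vertex = case back w-vertex of λ { (v , m') → case cover L (right-vertex m') of λ
        { (s , j , e) → s , j , mate-unique (subst (λ v → Mate V W v w) e (mate-sym m')) (m s j) } }
      mates-V : ∀ {v} → isVertex V v → ∃[ w ] Mate W V w v
      mates-V v-vertex = case cover L v-vertex of λ { (s , j , refl) → vx' s j , mate-sym (m s j) }
      edges' : ∀ s j s' j' → isEdge W (vx' s j) (vx' s' j') → vx' s' j' ≡ vx' (not s) j ⊎ ∃[ i ] (vx' s' j' ≡ vx' s i)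
      edges' s j s' j' e = case edges L s j (edge-transport mates-V (mate-sym (m s j)) (mate-sym (m s' j')) e) of λ
        { (inj₁ p) → inj₁ (mate-unique (subst (λ v → Mate V W v (vx' s' j')) p (m s' j')) (m (not s) j))
        ; (inj₂ (i , p)) → inj₂ (i , mate-unique (subst (λ v → Mate V W v (vx' s' j')) p (m s' j')) (m s i)) }

-- The vertices and faces of a prism, transported along the face isomorphism

module Labelling where
  open import Data.Vec using ([]; _∷_; _++_)
  open import Data.List using (List; length; map; lookup; filter)
  open Plane
  open Barycentric using (0<-weighted)
  open Vertices
  open Mates
  open PlaneOps _+_ _*_ -_

  ht : Bool → ℤ
  ht false = + 0
  ht true = + 1

  pt : Bool → V2 → V3
  pt s (x , y) = x , y , ht s

  Vtx : List V2 → V2 → Set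
  Vtx Qs q = q ∈ Qs × ∃[ c ] (∀ q' → q' ∈ Qs → ¬ q' ≡ q → dot₂ c q' < dot₂ c q)

  abstract
    +-cancelʳ-≤ : ∀ k a b → a + k ≤ b + k → a ≤ b
    +-cancelʳ-≤ k a b p = subst₂ _≤_ (l a k) (l b k) (+-monoˡ-≤ (- k) p)
      where
      l : ∀ a k → a + k + - k ≡ a
      l = solve-∀

    +-cancelˡ-≤ : ∀ k a b → k + a ≤ k + b → a ≤ b
    +-cancelˡ-≤ k a b p = +-cancelʳ-≤ k a b (subst₂ _≤_ (+-comm k a) (+-comm k b) p)

    pt∈prism : ∀ {Qs q} s → q ∈ Qs → pt s q ∈ prism Qs
    pt∈prism {Qs} false q∈ = ∈-++⁺ˡ (∈-map⁺ _ q∈)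
    pt∈prism {Qs} true q∈ = ∈-++⁺ʳ _ (∈-map⁺ _ q∈)

    prism∋ : ∀ {Qs x} → x ∈ prism Qs → ∃[ s ] ∃[ q ] (q ∈ Qs × x ≡ pt s q)
    prism∋ {Qs} x∈ = case ∈-++⁻ (map _ Qs) x∈ of λ
      { (inj₁ p) → case ∈-map⁻ _ p of λ { ((a , b) , q∈ , e) → false , (a , b) , q∈ , e }
      ; (inj₂ p) → case ∈-map⁻ _ p of λ { ((a , b) , q∈ , e) → true , (a , b) , q∈ , e } }

    pt-injective : ∀ {s s' q q'} → pt s q ≡ pt s' q' → s ≡ s' × q ≡ q'
    pt-injective {false} {false} refl = refl , refl
    pt-injective {true} {true} refl = refl , refl
    pt-injective {false} {true} ()
    pt-injective {true} {false} ()

    bool-cases : ∀ (s t : Bool) → t ≡ s ⊎ t ≡ not s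
    bool-cases false false = inj₁ refl
    bool-cases false true = inj₂ refl
    bool-cases true false = inj₂ refl
    bool-cases true true = inj₁ refl

    s≢not-s : ∀ {s} → ¬ s ≡ not s
    s≢not-s {false} ()
    s≢not-s {true} ()

    up-sign : Bool → ℤ
    up-sign false = -1ℤ
    up-sign true = 1ℤ

    up-sign-< : ∀ s → up-sign s * ht (not s) < up-sign s * ht s
    up-sign-< false = -<+
    up-sign-< true = +<+ ℕ.z<s

    up-sign-≤ : ∀ s t → up-sign s * ht t ≤ up-sign s * ht s
    up-sign-≤ s t = case bool-cases s t of λ { (inj₁ refl) → ≤-refl ; (inj₂ refl) → <⇒≤ (up-sign-< s) }

    pt-vertex : ∀ {Qs q} s → Vtx Qs q → isVertex (prism Qs) (pt s q)
    pt-vertex {Qs} {q} s (q∈ , (c₁ , c₂) , strict) = (c₁ , c₂ , up-sign s) , (pt∈prism s q∈ , λ w w∈ → case prism∋ {Qs} w∈ of λ { (t , q' , q'∈ , refl) → bound t q' q'∈ }) ,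
        λ w w-max → case prism∋ {Qs} (proj₁ w-max) of λ { (t , q' , q'∈ , refl) → unique t q' q'∈ (proj₂ w-max (pt s q) (pt∈prism s q∈)) }
      where
      bound : ∀ t q' → q' ∈ Qs → dot₂ (c₁ , c₂) q' + up-sign s * ht t ≤ dot₂ (c₁ , c₂) q + up-sign s * ht s
      bound t q' q'∈ = case ≡-dec _≟_ _≟_ q' q of λ
        { (yes refl) → +-monoʳ-≤ (dot₂ (c₁ , c₂) q) (up-sign-≤ s t)
        ; (no q'≢q) → +-mono-≤ (<⇒≤ (strict q' q'∈ q'≢q)) (up-sign-≤ s t) }
      unique : ∀ t q' → q' ∈ Qs → dot₂ (c₁ , c₂) q + up-sign s * ht s ≤ dot₂ (c₁ , c₂) q' + up-sign s * ht t → pt t q' ≡ pt s q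
      unique t q' q'∈ h = case ≡-dec _≟_ _≟_ q' q of λ
        { (no q'≢q) → ⊥-elim (<⇒≱ (+-mono-<-≤ (strict q' q'∈ q'≢q) (up-sign-≤ s t)) h)
        ; (yes refl) → case bool-cases s t of λ
          { (inj₁ refl) → refl
          ; (inj₂ refl) → ⊥-elim (<⇒≱ (+-monoʳ-< (dot₂ (c₁ , c₂) q) (up-sign-< s)) h) } }

    vertex-pt : ∀ {Qs x} → isVertex (prism Qs) x → ∃[ s ] ∃[ q ] (Vtx Qs q × x ≡ pt s q)
    vertex-pt {Qs} ((c₁ , c₂ , c₃) , (x∈ , x-max) , unique) = case prism∋ {Qs} x∈ of λ { (s , q , q∈ , refl) →
      s , q , (q∈ , (c₁ , c₂) , λ q' q'∈ q'≢q → case <-cmp (dot₂ (c₁ , c₂) q') (dot₂ (c₁ , c₂) q) of λ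
        { (tri< p _ _) → p
        ; (tri≈ _ e _) → ⊥-elim (q'≢q (proj₂ (pt-injective {s} {s} (unique (pt s q')
            (pt∈prism s q'∈ , λ w w∈ → ≤-trans (x-max w w∈) (≤-reflexive (cong (_+ c₃ * ht s) (sym e))))))))
        ; (tri> _ _ p) → ⊥-elim (<⇒≱ (+-monoˡ-< (c₃ * ht s) p) (x-max (pt s q') (pt∈prism s q'∈))) }) , refl }

    -- Gordan's alternative for the differences to the other points decides it: a separating
    -- functional exposes `q`, and a balanced triple forbids any. The decision is what allows the
    -- corners of the base to be listed as labels.
    Vtx? : ∀ Qs q → Dec (Vtx Qs q)
    Vtx? Qs q = case DecMembership._∈?_ (≡-dec _≟_ _≟_) q Qs of λ
      { (no q∉) → no (q∉ ∘ proj₁)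
      ; (yes q∈) → case gordan (λ j → lookup others j ⊟ q) of λ
        { (inj₁ (c , h)) → yes (q∈ , c , λ q' q'∈ q'≢q → let m = ∈-filter⁺ other? q'∈ q'≢q in
            0<⇒< (0<-resp (h (index m)) (trans (cong (λ p → - dot₂ c (p ⊟ q)) (sym (lookup-index m))) (lem c q' q))))
        ; (inj₂ (i , j , k , w₁ , w₂ , w₃ , w , e)) → no λ { (_ , c , strict) → 0<0-absurd (0<-resp
            (0<-weighted w (drop c strict i) (drop c strict j) (drop c strict k))
            (trans (sum c w₁ w₂ w₃ (lookup others i ⊟ q) (lookup others j ⊟ q) (lookup others k ⊟ q))
              (trans (cong (λ v → - dot₂ c v) e) (zero-dot c)))) } } }
      where
      other? : ∀ q' → Dec (¬ q' ≡ q)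
      other? q' = ¬? (≡-dec _≟_ _≟_ q' q)
      others : List V2
      others = filter other? Qs
      lem : ∀ c x y → - dot₂ c (x ⊟ y) ≡ dot₂ c y - dot₂ c x
      lem c x y = by-ring [] (c ∷ x ∷ y ∷ []) (λ { [] (c ∷ x ∷ y ∷ []) → ⊝ E.dot₂ c (x E.⊟ y) ≋ E.dot₂ c y E.⊖ E.dot₂ c x }) refl
      drop : ∀ c → (∀ q' → q' ∈ Qs → ¬ q' ≡ q → dot₂ c q' < dot₂ c q) → ∀ i → 0ℤ < - dot₂ c (lookup others i ⊟ q)
      drop c strict i = case ∈-filter⁻ other? {xs = Qs} (∈-lookup i) of λ { (q'∈ , q'≢q) →
        0<-resp (<⇒0< (strict (lookup others i) q'∈ q'≢q)) (sym (lem c (lookup others i) q)) }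
      sum : ∀ c w₁ w₂ w₃ x y z → w₁ * (- dot₂ c x) + w₂ * (- dot₂ c y) + w₃ * (- dot₂ c z) ≡ - dot₂ c (comb₂ w₁ x w₂ y w₃ z)
      sum c w₁ w₂ w₃ x y z = by-ring (w₁ ∷ w₂ ∷ w₃ ∷ []) (c ∷ x ∷ y ∷ z ∷ []) (λ { (w₁ ∷ w₂ ∷ w₃ ∷ []) (c ∷ x ∷ y ∷ z ∷ []) →
        w₁ ⊗ (⊝ E.dot₂ c x) ⊕ w₂ ⊗ (⊝ E.dot₂ c y) ⊕ w₃ ⊗ (⊝ E.dot₂ c z) ≋ ⊝ E.dot₂ c ((w₁ E.⊡ x E.⊞ w₂ E.⊡ y) E.⊞ w₃ E.⊡ z) }) refl
      zero-dot : ∀ c → - dot₂ c 0₂ ≡ 0ℤ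
      zero-dot c = by-ring [] (c ∷ []) (λ { [] (c ∷ []) → ⊝ E.dot₂ c (Κ 0ℤ , Κ 0ℤ) ≋ Κ 0ℤ }) refl

  -- The two-dimensional faces joining an edge of the bottom to the corresponding edge of the top; σ singles out the side s.
  Quad : (V : List V3) {n : ℕ} → (Bool → Fin n → V3) → Set
  Quad V {n} vx = ∀ s σ → (∀ l m → dot σ (vx (not s) l) < dot σ (vx s m)) → (∀ l m → dot σ (vx s l) ≡ dot σ (vx s m)) →
    ∀ c i j → (∀ l → dot c (vx s l) ≤ dot c (vx s i)) → dot c (vx s j) ≡ dot c (vx s i) →
    ∃[ d ] ((∀ t → maximises V d (vx t i)) × (∀ t → maximises V d (vx t j))
      × (∀ l → maximises V d (vx (not s) l) → dot c (vx s l) ≡ dot c (vx s i)))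

  module PrismLabelling (Qs : List V2) {V : List V3} {f : V3 → V3} (iso : FaceIso (prism Qs) V f) where

    private
      T : List V3
      T = prism Qs
      g : V3 → V3
      g = proj₁ iso
      f-vertex : ∀ x → isVertex T x → isVertex V (f x)
      f-vertex = proj₁ (proj₂ iso)
      g-vertex : ∀ y → isVertex V y → isVertex T (g y)
      g-vertex = proj₁ (proj₂ (proj₂ iso))
      gf : ∀ x → isVertex T x → g (f x) ≡ x
      gf = proj₁ (proj₂ (proj₂ (proj₂ iso)))
      fg : ∀ y → isVertex V y → f (g y) ≡ y
      fg = proj₁ (proj₂ (proj₂ (proj₂ (proj₂ iso))))
      faces : ∀ (S : V3 → Set) → (∀ x → S x → isVertex T x) → isFace T S ⇔ isFace V (image f S)
      faces = proj₂ (proj₂ (proj₂ (proj₂ (proj₂ iso))))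

      corners : List V2
      corners = filter (Vtx? Qs) Qs

    n : ℕ
    n = length corners

    corner : Fin n → V2
    corner = lookup corners

    vx : Bool → Fin n → V3
    vx s j = f (pt s (corner j))

    abstract
      corner-Vtx : ∀ j → Vtx Qs (corner j)
      corner-Vtx j = proj₂ (∈-filter⁻ (Vtx? Qs) {xs = Qs} (∈-lookup j))

      corner-index : ∀ {q} → Vtx Qs q → ∃[ j ] (q ≡ corner j)
      corner-index v = let m = ∈-filter⁺ (Vtx? Qs) (proj₁ v) v in index m , lookup-index m

      pt-T : ∀ s j → isVertex T (pt s (corner j))
      pt-T s j = pt-vertex s (corner-Vtx j)

      T-pt : ∀ {x} → isVertex T x → ∃[ s ] ∃[ j ] (x ≡ pt s (corner j))
      T-pt x-vertex = case vertex-pt x-vertex of λ { (s , q , v , e) → case corner-index v of λ { (j , e') → s , j , trans e (cong (pt s) e') } }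

      f-injective : ∀ {x y} → isVertex T x → isVertex T y → f x ≡ f y → x ≡ y
      f-injective {x} {y} xv yv e = trans (sym (gf x xv)) (trans (cong g e) (gf y yv))

      vx-cover : ∀ {w} → isVertex V w → ∃[ s ] ∃[ j ] (w ≡ vx s j)
      vx-cover {w} w-vertex = case T-pt (g-vertex w w-vertex) of λ { (s , j , e) → s , j , trans (sym (fg w w-vertex)) (cong f e) }

      face⁺ : ∀ {S} → (∀ x → S x → isVertex T x) → ∀ {x} → S x → ∀ c → (∀ v → S v ⇔ (isVertex T v × maximises T c v)) →
        ∃[ d ] (∀ v → image f S v ⇔ (isVertex V v × maximises V d v))
      face⁺ {S} S-vertex {x} Sx c h = case Equivalence.to (faces S S-vertex) (inj₂ (c , h)) of λ
        { (inj₁ empty) → ⊥-elim (empty (f x) (x , Sx , refl))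
        ; (inj₂ d) → d }

      face⁻ : ∀ {S} → (∀ x → S x → isVertex T x) → ∀ {x} → S x → ∀ c → (∀ v → image f S v ⇔ (isVertex V v × maximises V c v)) →
        ∃[ d ] (∀ v → S v ⇔ (isVertex T v × maximises T d v))
      face⁻ {S} S-vertex {x} Sx c h = case Equivalence.from (faces S S-vertex) (inj₂ (c , h)) of λ
        { (inj₁ empty) → ⊥-elim (empty x Sx)
        ; (inj₂ d) → d }

      flat-max : ∀ {s t c₁ c₂ c₃ q} → q ∈ Qs → maximises T (c₁ , c₂ , c₃) (pt s q) → maximises T (c₁ , c₂ , 0ℤ) (pt t q)
      flat-max {s} {t} {c₁} {c₂} {c₃} {q} q∈ (_ , m) = pt∈prism t q∈ , λ w w∈ → case prism∋ {Qs} w∈ of λ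
        { (t' , q' , q'∈ , refl) → +-monoˡ-≤ 0ℤ (+-cancelʳ-≤ (c₃ * ht s) (dot₂ (c₁ , c₂) q') (dot₂ (c₁ , c₂) q) (m (pt s q') (pt∈prism s q'∈))) }

      vertical-edge : ∀ s j → isEdge V (vx s j) (vx (not s) j)
      vertical-edge s j = case corner-Vtx j of λ { (q∈ , (c₁ , c₂) , strict) → edge q∈ c₁ c₂ strict }
        where
        q : V2
        q = corner j
        S : V3 → Set
        S x = x ≡ pt s q ⊎ x ≡ pt (not s) q
        S-vertex : ∀ x → S x → isVertex T x
        S-vertex _ (inj₁ refl) = pt-T s j
        S-vertex _ (inj₂ refl) = pt-T (not s) j
        edge : q ∈ Qs → ∀ c₁ c₂ → (∀ q' → q' ∈ Qs → ¬ q' ≡ q → dot₂ (c₁ , c₂) q' < dot₂ (c₁ , c₂) q) → isEdge V (vx s j) (vx (not s) j)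
        edge q∈ c₁ c₂ strict = case face⁺ S-vertex {pt s q} (inj₁ refl) (c₁ , c₂ , 0ℤ) (λ v → mk⇔ (to-max v) (λ p → from-max v (proj₂ p))) of λ
          { (d , h) → f-vertex _ (pt-T s j) , f-vertex _ (pt-T (not s) j) ,
              (λ e → s≢not-s (proj₁ (pt-injective {s} {not s} (f-injective (pt-T s j) (pt-T (not s) j) e)))) ,
              d , λ x → mk⇔ (λ p → out x (Equivalence.from (h x) p)) (λ p → Equivalence.to (h x) (into x p)) }
          where
          at : ∀ t → maximises T (c₁ , c₂ , 0ℤ) (pt t q)
          at t = pt∈prism t q∈ , λ w w∈ → case prism∋ {Qs} w∈ of λ { (t' , q' , q'∈ , refl) → +-monoˡ-≤ 0ℤ (case ≡-dec _≟_ _≟_ q' q of λ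
            { (yes refl) → ≤-refl ; (no q'≢q) → <⇒≤ (strict q' q'∈ q'≢q) }) }
          to-max : ∀ v → S v → isVertex T v × maximises T (c₁ , c₂ , 0ℤ) v
          to-max _ (inj₁ refl) = pt-T s j , at s
          to-max _ (inj₂ refl) = pt-T (not s) j , at (not s)
          from-max : ∀ v → maximises T (c₁ , c₂ , 0ℤ) v → S v
          from-max v (v∈ , v-max) = case prism∋ {Qs} v∈ of λ { (t , q' , q'∈ , refl) → case ≡-dec _≟_ _≟_ q' q of λ
            { (yes refl) → case bool-cases s t of λ { (inj₁ refl) → inj₁ refl ; (inj₂ refl) → inj₂ refl }
            ; (no q'≢q) → ⊥-elim (<⇒≱ (+-monoˡ-< 0ℤ (strict q' q'∈ q'≢q)) (v-max (pt t q) (pt∈prism t q∈))) } }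
          out : ∀ x → image f S x → x ≡ vx s j ⊎ x ≡ vx (not s) j
          out _ (_ , inj₁ refl , e) = inj₁ (sym e)
          out _ (_ , inj₂ refl , e) = inj₂ (sym e)
          into : ∀ x → x ≡ vx s j ⊎ x ≡ vx (not s) j → image f S x
          into _ (inj₁ e) = pt s q , inj₁ refl , sym e
          into _ (inj₂ e) = pt (not s) q , inj₂ refl , sym e

      -- Comparing each of the two maximisers with its partner at the other height gives opposite
      -- inequalities for the height term, so that term is equal at both heights.
      diagonal : ∀ {s q q' c₁ c₂ c₃} → q ∈ Qs → q' ∈ Qs → maximises T (c₁ , c₂ , c₃) (pt s q) → maximises T (c₁ , c₂ , c₃) (pt (not s) q') →
        maximises T (c₁ , c₂ , c₃) (pt (not s) q)
      diagonal {s} {q} {q'} {c₁} {c₂} {c₃} q∈ q'∈ m m' = maximises-≡ (c₁ , c₂ , c₃) m (pt∈prism (not s) q∈)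
        (cong (_+_ (dot₂ (c₁ , c₂) q)) (≤-antisym
          (+-cancelˡ-≤ (dot₂ (c₁ , c₂) q) (c₃ * ht (not s)) (c₃ * ht s) (proj₂ m (pt (not s) q) (pt∈prism (not s) q∈)))
          (+-cancelˡ-≤ (dot₂ (c₁ , c₂) q') (c₃ * ht s) (c₃ * ht (not s)) (proj₂ m' (pt s q') (pt∈prism s q'∈)))))

      -- An edge between the two sides pulls back to a face of the prism. By `diagonal` this face
      -- also contains the partner of its first vertex, so its other end is that partner.
      vx-edges : ∀ s j {w} → isEdge V (vx s j) w → w ≡ vx (not s) j ⊎ ∃[ j' ] (w ≡ vx s j')
      vx-edges s j {w} (_ , w-vertex , _ , c , h) = case vx-cover w-vertex of λ { (t , j' , e) → case bool-cases s t of λ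
          { (inj₁ refl) → inj₂ (j' , e)
          ; (inj₂ refl) → inj₁ (across-edge j' e) } }
        where
        S : V3 → Set
        S x = isVertex T x × (f x ≡ vx s j ⊎ f x ≡ w)
        into : ∀ v → isVertex V v → v ≡ vx s j ⊎ v ≡ w → image f S v
        into v v-vertex (inj₁ e) = g v , (g-vertex v v-vertex , inj₁ (trans (fg v v-vertex) e)) , fg v v-vertex
        into v v-vertex (inj₂ e) = g v , (g-vertex v v-vertex , inj₂ (trans (fg v v-vertex) e)) , fg v v-vertex
        out : ∀ v → image f S v → v ≡ vx s j ⊎ v ≡ w
        out _ (_ , (_ , p) , refl) = p
        across-edge : ∀ j' → w ≡ vx (not s) j' → w ≡ vx (not s) j
        across-edge j' e = case face⁻ {S} (λ _ → proj₁) {pt s (corner j)} (pt-T s j , inj₁ refl) c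
            (λ v → mk⇔ (λ p → Equivalence.from (h v) (out v p)) (λ p → into v (proj₁ p) (Equivalence.to (h v) p))) of λ
          { ((c₁ , c₂ , c₃) , hT) → case Equivalence.from (hT (pt (not s) (corner j))) (pt-T (not s) j ,
              diagonal {s} {corner j} {corner j'} {c₁} {c₂} {c₃} (proj₁ (corner-Vtx j)) (proj₁ (corner-Vtx j'))
                (proj₂ (Equivalence.to (hT (pt s (corner j))) (pt-T s j , inj₁ refl)))
                (proj₂ (Equivalence.to (hT (pt (not s) (corner j'))) (pt-T (not s) j' , inj₂ (sym e))))) of λ
            { (_ , inj₁ p) → ⊥-elim (s≢not-s (sym (proj₁ (pt-injective {not s} {s} (f-injective (pt-T (not s) j) (pt-T s j) p)))))
            ; (_ , inj₂ p) → sym p } }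

      vx-same-fibre : ∀ s {i j} → vx s i ≡ vx s j → vx (not s) i ≡ vx (not s) j
      vx-same-fibre s {i} {j} e = cong (λ q → f (pt (not s) q)) (proj₂ (pt-injective {s} {s} (f-injective (pt-T s i) (pt-T s j) e)))

      labelled : Labelled V vx
      labelled = record { vertex = λ s j → f-vertex _ (pt-T s j) ; cover = vx-cover ; vertical = vertical-edge ; edges = vx-edges ; same-fibre = vx-same-fibre }

      -- `lex V σ c` exposes the face of side `s` on which `c` is maximal. In the prism this becomes
      -- a face of a base, and dropping the height component of its functional exposes the vertical
      -- face over it, which is carried back to `V`. A label found in the vertical face on the other
      -- side already belongs to the original face on side `s`.
      quad : Quad V vx
      quad s σ σ-< σ-≡ c i j c-max c-≡ = case face⁻ {S} (λ _ → proj₁) {pt s (corner i)} (pt-T s i , e-max-i) e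
          (λ v → mk⇔ out (λ p → g v , (g-vertex v (proj₁ p) , subst (maximises V e) (sym (fg v (proj₁ p))) (proj₂ p)) , fg v (proj₁ p))) of λ
        { ((c₁ , c₂ , c₃) , hT) → flatten-face c₁ c₂ c₃ hT }
        where
        e : V3
        e = lex V σ c
        vx∈ : ∀ t l → vx t l ∈ V
        vx∈ t l = vertex∈ (f-vertex _ (pt-T t l))
        e-max-i : maximises V e (vx s i)
        e-max-i = max-over-vertices e (vx∈ s i) λ w w-vertex → case vx-cover w-vertex of λ { (t , l , refl) → case bool-cases s t of λ
          { (inj₁ refl) → lex-mono V σ c (σ-≡ l i) (c-max l)
          ; (inj₂ refl) → <⇒≤ (lex-< V σ c (vx∈ s i) (vx∈ (not s) l) (σ-< l i)) } }
        e-max-j : maximises V e (vx s j)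
        e-max-j = maximises-≡ e e-max-i (vx∈ s j) (≤-antisym (lex-mono V σ c (σ-≡ j i) (≤-reflexive c-≡)) (lex-mono V σ c (σ-≡ i j) (≤-reflexive (sym c-≡))))
        S : V3 → Set
        S x = isVertex T x × maximises V e (f x)
        out : ∀ {v} → image f S v → isVertex V v × maximises V e v
        out (x , (x-vertex , m) , refl) = f-vertex x x-vertex , m
        flatten-face : ∀ c₁ c₂ c₃ → (∀ v → S v ⇔ (isVertex T v × maximises T (c₁ , c₂ , c₃) v)) →
          ∃[ d ] ((∀ t → maximises V d (vx t i)) × (∀ t → maximises V d (vx t j))
            × (∀ l → maximises V d (vx (not s) l) → dot c (vx s l) ≡ dot c (vx s i)))
        flatten-face c₁ c₂ c₃ hT = case face⁺ {S₂} (λ _ → proj₁) (pt-T s i , flat s i e-max-i) (c₁ , c₂ , 0ℤ) (λ v → mk⇔ (λ p → p) (λ p → p)) of λ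
            { (d , hV) → d , (λ t → proj₂ (Equivalence.to (hV (vx t i)) (pt t (corner i) , (pt-T t i , flat t i e-max-i) , refl))) ,
                (λ t → proj₂ (Equivalence.to (hV (vx t j)) (pt t (corner j) , (pt-T t j , flat t j e-max-j) , refl))) ,
                λ l m → back l (Equivalence.from (hV (vx (not s) l)) (f-vertex _ (pt-T (not s) l) , m)) }
          where
          S₂ : V3 → Set
          S₂ x = isVertex T x × maximises T (c₁ , c₂ , 0ℤ) x
          T-max : ∀ l → maximises V e (vx s l) → maximises T (c₁ , c₂ , c₃) (pt s (corner l))
          T-max l m = proj₂ (Equivalence.to (hT (pt s (corner l))) (pt-T s l , m))
          flat : ∀ t l → maximises V e (vx s l) → maximises T (c₁ , c₂ , 0ℤ) (pt t (corner l))
          flat t l m = flat-max {s} {t} {c₁} {c₂} {c₃} (proj₁ (corner-Vtx l)) (T-max l m)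
          back : ∀ l → image f S₂ (vx (not s) l) → dot c (vx s l) ≡ dot c (vx s i)
          back l (x , (x-vertex , m) , p) = proj₂ (lex-≡ V σ c (vx∈ s i) (vx∈ s l) (maximisers-≡ e e-max-i
              (proj₂ (Equivalence.from (hT (pt s (corner l))) (pt-T s l , l-max)))))
            where
            m' : maximises T (c₁ , c₂ , 0ℤ) (pt (not s) (corner l))
            m' = subst (maximises T (c₁ , c₂ , 0ℤ)) (f-injective x-vertex (pt-T (not s) l) p) m
            l-max : maximises T (c₁ , c₂ , c₃) (pt s (corner l))
            l-max = pt∈prism s (proj₁ (corner-Vtx l)) , λ w w∈ → ≤-trans (proj₂ (T-max i e-max-i) w w∈)
              (+-monoˡ-≤ (c₃ * ht s) (+-cancelʳ-≤ 0ℤ (dot₂ (c₁ , c₂) (corner i)) (dot₂ (c₁ , c₂) (corner l))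
                (proj₂ m' (pt s (corner i)) (pt∈prism s (proj₁ (corner-Vtx i))))))

-- Rational convex combinations and bounds by functionals

module RationalHulls where
  open import Data.List using (List; []; _∷_; length; lookup)
  open Plane
  open Weights

  ringℚ : AlmostCommutativeRing _ _
  ringℚ = fromCommutativeRing ℚₚ.+-*-commutativeRing (λ _ → nothing)

  ι : ℤ → ℚ
  ι i = i ℚ./ 1

  abstract
    ιᵘ : ∀ i → ℚ.toℚᵘ (ι i) ℚᵘ.≃ ℚᵘ.mkℚᵘ i 0
    ιᵘ i = ℚₚ.toℚᵘ-fromℚᵘ (ℚᵘ.mkℚᵘ i 0)

    ι-+ : ∀ i j → ι (i + j) ≡ ι i ℚ.+ ι j
    ι-+ i j = ℚₚ.toℚᵘ-injective (ℚᵘₚ.≃-trans (ιᵘ (i + j)) (ℚᵘₚ.≃-trans (ℚᵘ.*≡* (lem i j))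
      (ℚᵘₚ.≃-trans (ℚᵘₚ.+-cong (ℚᵘₚ.≃-sym (ιᵘ i)) (ℚᵘₚ.≃-sym (ιᵘ j))) (ℚᵘₚ.≃-sym (ℚₚ.toℚᵘ-homo-+ (ι i) (ι j))))))
      where
      lem : ∀ i j → (i + j) * 1ℤ ≡ (i * 1ℤ + j * 1ℤ) * 1ℤ
      lem = solve-∀

    ι-* : ∀ i j → ι (i * j) ≡ ι i ℚ.* ι j
    ι-* i j = ℚₚ.toℚᵘ-injective (ℚᵘₚ.≃-trans (ιᵘ (i * j)) (ℚᵘₚ.≃-trans (ℚᵘ.*≡* refl)
      (ℚᵘₚ.≃-trans (ℚᵘₚ.*-cong (ℚᵘₚ.≃-sym (ιᵘ i)) (ℚᵘₚ.≃-sym (ιᵘ j))) (ℚᵘₚ.≃-sym (ℚₚ.toℚᵘ-homo-* (ι i) (ι j))))))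

    ι-mono : ∀ {i j} → i ≤ j → ι i ℚ.≤ ι j
    ι-mono {i} {j} p = ℚₚ.toℚᵘ-cancel-≤ (ℚᵘₚ.≤-respˡ-≃ (ℚᵘₚ.≃-sym (ιᵘ i)) (ℚᵘₚ.≤-respʳ-≃ (ℚᵘₚ.≃-sym (ιᵘ j))
      (ℚᵘ.*≤* (*-monoʳ-≤-nonNeg 1ℤ p))))

    ι-cancel : ∀ {i j} → ι i ℚ.≤ ι j → i ≤ j
    ι-cancel {i} {j} p = case ℚᵘₚ.≤-respˡ-≃ (ιᵘ i) (ℚᵘₚ.≤-respʳ-≃ (ιᵘ j) (ℚₚ.toℚᵘ-mono-≤ p)) of λ
      { (ℚᵘ.*≤* q) → subst₂ _≤_ (*-identityʳ i) (*-identityʳ j) q }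

    0≤*ℚ : ∀ {p q} → 0ℚ ℚ.≤ p → 0ℚ ℚ.≤ q → 0ℚ ℚ.≤ p ℚ.* q
    0≤*ℚ {p} {q} 0≤p 0≤q = subst (ℚ._≤ p ℚ.* q) (ℚₚ.*-zeroʳ p) (ℚₚ.*-monoˡ-≤-nonNeg p {{ℚ.nonNegative 0≤p}} 0≤q)

    inverse : ∀ {N} → 0ℤ < N → ∃[ r ] (0ℚ ℚ.≤ r × r ℚ.* ι N ≡ 1ℚ)
    inverse {+[1+ n ]} _ = r , ι⁻-nonneg , ℚₚ.toℚᵘ-injective (ℚᵘₚ.≃-trans (ℚₚ.toℚᵘ-homo-* r (ι +[1+ n ]))
        (ℚᵘₚ.≃-trans (ℚᵘₚ.*-cong (ℚₚ.toℚᵘ-fromℚᵘ (ℚᵘ.mkℚᵘ 1ℤ n)) (ιᵘ +[1+ n ])) (ℚᵘ.*≡* (lem +[1+ n ]))))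
      where
      r : ℚ
      r = ℚ.fromℚᵘ (ℚᵘ.mkℚᵘ 1ℤ n)
      lem : ∀ d → (1ℤ * d) * 1ℤ ≡ 1ℤ * (d * 1ℤ)
      lem = solve-∀
      ι⁻-nonneg : 0ℚ ℚ.≤ r
      ι⁻-nonneg = ℚₚ.toℚᵘ-cancel-≤ (ℚᵘₚ.≤-respʳ-≃ (ℚᵘₚ.≃-sym (ℚₚ.toℚᵘ-fromℚᵘ (ℚᵘ.mkℚᵘ 1ℤ n))) (ℚᵘ.*≤* (+≤+ ℕ.z≤n)))
    inverse {+0} (+<+ ())

  -- The total weight is a parameter, so that sums and multiples can be formed first and normalised
  -- once at the end.
  WConv : List V3 → ℚ → Q3 → Set
  WConv V s x = Σ (Fin (length V) → ℚ) λ w → (∀ i → 0ℚ ℚ.≤ w i) × (sumFin w ≡ s) × (sumFinQ3 (λ i → w i ·q toQ (lookup V i)) ≡ x)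

  ≡Q3 : ∀ {a b c a' b' c' : ℚ} → a ≡ a' → b ≡ b' → c ≡ c' → (a , b , c) ≡ (a' , b' , c')
  ≡Q3 refl refl refl = refl

  abstract
    +q-identityˡ : ∀ x → 0q +q x ≡ x
    +q-identityˡ (a , b , c) = ≡Q3 (ℚₚ.+-identityˡ a) (ℚₚ.+-identityˡ b) (ℚₚ.+-identityˡ c)

    +q-identityʳ : ∀ x → x +q 0q ≡ x
    +q-identityʳ (a , b , c) = ≡Q3 (ℚₚ.+-identityʳ a) (ℚₚ.+-identityʳ b) (ℚₚ.+-identityʳ c)

    interchange : ∀ a b c d → (a ℚ.+ b) ℚ.+ (c ℚ.+ d) ≡ (a ℚ.+ c) ℚ.+ (b ℚ.+ d)
    interchange = RingTactic.solve-∀ ringℚ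

    +q-interchange : ∀ a b c d → (a +q b) +q (c +q d) ≡ (a +q c) +q (b +q d)
    +q-interchange (a , a' , a'') (b , b' , b'') (c , c' , c'') (d , d' , d'') = ≡Q3 (interchange a b c d) (interchange a' b' c' d') (interchange a'' b'' c'' d'')

    ·q-distribˡ : ∀ k x y → k ·q (x +q y) ≡ (k ·q x) +q (k ·q y)
    ·q-distribˡ k (x , x' , x'') (y , y' , y'') = ≡Q3 (ℚₚ.*-distribˡ-+ k x y) (ℚₚ.*-distribˡ-+ k x' y') (ℚₚ.*-distribˡ-+ k x'' y'')

    ·q-distribʳ : ∀ k l x → (k ℚ.+ l) ·q x ≡ (k ·q x) +q (l ·q x)
    ·q-distribʳ k l (x , x' , x'') = ≡Q3 (ℚₚ.*-distribʳ-+ x k l) (ℚₚ.*-distribʳ-+ x' k l) (ℚₚ.*-distribʳ-+ x'' k l)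

    ·q-assoc : ∀ k l x → (k ℚ.* l) ·q x ≡ k ·q (l ·q x)
    ·q-assoc k l (x , x' , x'') = ≡Q3 (ℚₚ.*-assoc k l x) (ℚₚ.*-assoc k l x') (ℚₚ.*-assoc k l x'')

    sumFin-+ : ∀ {n} (f g : Fin n → ℚ) → sumFin (λ i → f i ℚ.+ g i) ≡ sumFin f ℚ.+ sumFin g
    sumFin-+ {zero} f g = refl
    sumFin-+ {suc n} f g = trans (cong (f zero ℚ.+ g zero ℚ.+_) (sumFin-+ (f ∘ suc) (g ∘ suc)))
      (interchange (f zero) (g zero) (sumFin (f ∘ suc)) (sumFin (g ∘ suc)))

    sumFin-* : ∀ {n} k (f : Fin n → ℚ) → sumFin (λ i → k ℚ.* f i) ≡ k ℚ.* sumFin f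
    sumFin-* {zero} k f = sym (ℚₚ.*-zeroʳ k)
    sumFin-* {suc n} k f = trans (cong (k ℚ.* f zero ℚ.+_) (sumFin-* k (f ∘ suc))) (sym (ℚₚ.*-distribˡ-+ k (f zero) (sumFin (f ∘ suc))))

    sumFin-mono : ∀ {n} {f g : Fin n → ℚ} → (∀ i → f i ℚ.≤ g i) → sumFin f ℚ.≤ sumFin g
    sumFin-mono {zero} h = ℚₚ.≤-refl
    sumFin-mono {suc n} h = ℚₚ.+-mono-≤ (h zero) (sumFin-mono (h ∘ suc))

    sumFin-cong : ∀ {n} {f g : Fin n → ℚ} → (∀ i → f i ≡ g i) → sumFin f ≡ sumFin g
    sumFin-cong {zero} h = refl
    sumFin-cong {suc n} h = cong₂ ℚ._+_ (h zero) (sumFin-cong (h ∘ suc))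

    sumFinQ3-cong : ∀ {n} {f g : Fin n → Q3} → (∀ i → f i ≡ g i) → sumFinQ3 f ≡ sumFinQ3 g
    sumFinQ3-cong {zero} h = refl
    sumFinQ3-cong {suc n} h = cong₂ _+q_ (h zero) (sumFinQ3-cong (h ∘ suc))

    sumFinQ3-+ : ∀ {n} (f g : Fin n → Q3) → sumFinQ3 (λ i → f i +q g i) ≡ sumFinQ3 f +q sumFinQ3 g
    sumFinQ3-+ {zero} f g = refl
    sumFinQ3-+ {suc n} f g = trans (cong ((f zero +q g zero) +q_) (sumFinQ3-+ (f ∘ suc) (g ∘ suc)))
      (+q-interchange (f zero) (g zero) (sumFinQ3 (f ∘ suc)) (sumFinQ3 (g ∘ suc)))

    sumFinQ3-· : ∀ {n} k (f : Fin n → Q3) → sumFinQ3 (λ i → k ·q f i) ≡ k ·q sumFinQ3 f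
    sumFinQ3-· {zero} k f = sym (≡Q3 (ℚₚ.*-zeroʳ k) (ℚₚ.*-zeroʳ k) (ℚₚ.*-zeroʳ k))
    sumFinQ3-· {suc n} k f = trans (cong ((k ·q f zero) +q_) (sumFinQ3-· k (f ∘ suc)))
      (sym (·q-distribˡ k (f zero) (sumFinQ3 (f ∘ suc))))

    WConv-+ : ∀ V {s t x y} → WConv V s x → WConv V t y → WConv V (s ℚ.+ t) (x +q y)
    WConv-+ V (f , f≥0 , es , ex) (g , g≥0 , et , ey) = (λ i → f i ℚ.+ g i) , (λ i → ℚₚ.+-mono-≤ (f≥0 i) (g≥0 i)) ,
      trans (sumFin-+ f g) (cong₂ ℚ._+_ es et) ,
      trans (sumFinQ3-cong (λ i → ·q-distribʳ (f i) (g i) (toQ (lookup V i))))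
        (trans (sumFinQ3-+ (λ i → f i ·q toQ (lookup V i)) (λ i → g i ·q toQ (lookup V i))) (cong₂ _+q_ ex ey))

    WConv-· : ∀ V {s x} k → 0ℚ ℚ.≤ k → WConv V s x → WConv V (k ℚ.* s) (k ·q x)
    WConv-· V k k≥0 (f , f≥0 , es , ex) = (λ i → k ℚ.* f i) , (λ i → 0≤*ℚ k≥0 (f≥0 i)) ,
      trans (sumFin-* k f) (cong (k ℚ.*_) es) ,
      trans (sumFinQ3-cong (λ i → ·q-assoc k (f i) (toQ (lookup V i))))
        (trans (sumFinQ3-· k (λ i → f i ·q toQ (lookup V i))) (cong (k ·q_) ex))

    WConv-0 : ∀ V → WConv V 0ℚ 0q
    WConv-0 [] = (λ ()) , (λ ()) , refl , refl
    WConv-0 (v ∷ V) = case WConv-0 V of λ { (f , f≥0 , es , ex) → (λ { zero → 0ℚ ; (suc i) → f i }) , (λ { zero → ℚₚ.≤-refl ; (suc i) → f≥0 i }) ,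
      trans (ℚₚ.+-identityˡ (sumFin f)) es ,
      trans (cong₂ _+q_ (zero· (toQ v)) ex) (+q-identityˡ 0q) }
      where
      zero· : ∀ x → 0ℚ ·q x ≡ 0q
      zero· (a , b , c) = ≡Q3 (ℚₚ.*-zeroˡ a) (ℚₚ.*-zeroˡ b) (ℚₚ.*-zeroˡ c)

    inConv-vertex : ∀ {V v} → v ∈ V → inConv V (toQ v)
    inConv-vertex {v ∷ V} (here refl) = case WConv-0 V of λ { (f , f≥0 , es , ex) → (λ { zero → 1ℚ ; (suc i) → f i }) ,
      (λ { zero → ι-mono {0ℤ} {1ℤ} (+≤+ ℕ.z≤n) ; (suc i) → f≥0 i }) ,
      trans (cong (1ℚ ℚ.+_) es) (ℚₚ.+-identityʳ 1ℚ) ,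
      trans (cong₂ _+q_ (one· (toQ v)) ex) (+q-identityʳ (toQ v)) }
      where
      one· : ∀ x → 1ℚ ·q x ≡ x
      one· (a , b , c) = ≡Q3 (ℚₚ.*-identityˡ a) (ℚₚ.*-identityˡ b) (ℚₚ.*-identityˡ c)
    inConv-vertex {v ∷ V} {u} (there u∈) = case inConv-vertex u∈ of λ { (f , f≥0 , es , ex) → (λ { zero → 0ℚ ; (suc i) → f i }) , (λ { zero → ℚₚ.≤-refl ; (suc i) → f≥0 i }) ,
      trans (ℚₚ.+-identityˡ (sumFin f)) es ,
      trans (cong₂ _+q_ (zero· (toQ v)) ex) (+q-identityˡ (toQ u)) }
      where
      zero· : ∀ x → 0ℚ ·q x ≡ 0q
      zero· (a , b , c) = ≡Q3 (ℚₚ.*-zeroˡ a) (ℚₚ.*-zeroˡ b) (ℚₚ.*-zeroˡ c)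

    inConv-mix : ∀ V {w₁ w₂ w₃ x y z p} → Weights w₁ w₂ w₃ → inConv V (toQ x) → inConv V (toQ y) → inConv V (toQ z) →
      ((w₁ ·v x) +v (w₂ ·v y)) +v (w₃ ·v z) ≡ (w₁ + w₂ + w₃) ·v p → inConv V (toQ p)
    inConv-mix V {w₁} {w₂} {w₃} {x₁ , x₂ , x₃} {y₁ , y₂ , y₃} {z₁ , z₂ , z₃} {p₁ , p₂ , p₃} w X Y Z e = case inverse (sum>0 w) of λ { (r , r≥0 , er) →
      subst₂ (WConv V)
        (trans (scale r w₁ w₂ w₃) er)
        (≡Q3 (coordinate r er (cong proj₁ e)) (coordinate r er (cong (proj₁ ∘ proj₂) e)) (coordinate r er (cong (proj₂ ∘ proj₂) e)))
        (WConv-· V r r≥0 (WConv-+ V (WConv-+ V (WConv-· V (ι w₁) (ι-mono (w₁≥0 w)) X) (WConv-· V (ι w₂) (ι-mono (w₂≥0 w)) Y)) (WConv-· V (ι w₃) (ι-mono (w₃≥0 w)) Z))) }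
      where
      ι-sum : ∀ a b c → ι (a + b + c) ≡ ι a ℚ.+ ι b ℚ.+ ι c
      ι-sum a b c = trans (ι-+ (a + b) c) (cong (ℚ._+ ι c) (ι-+ a b))
      scale : ∀ r a b c → r ℚ.* (ι a ℚ.* 1ℚ ℚ.+ ι b ℚ.* 1ℚ ℚ.+ ι c ℚ.* 1ℚ) ≡ r ℚ.* ι (a + b + c)
      scale r a b c = cong (r ℚ.*_) (trans (cong₂ ℚ._+_ (cong₂ ℚ._+_ (ℚₚ.*-identityʳ (ι a)) (ℚₚ.*-identityʳ (ι b))) (ℚₚ.*-identityʳ (ι c))) (sym (ι-sum a b c)))
      coordinate : ∀ r → r ℚ.* ι (w₁ + w₂ + w₃) ≡ 1ℚ → ∀ {x y z p} → w₁ * x + w₂ * y + w₃ * z ≡ (w₁ + w₂ + w₃) * p →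
        r ℚ.* (ι w₁ ℚ.* ι x ℚ.+ ι w₂ ℚ.* ι y ℚ.+ ι w₃ ℚ.* ι z) ≡ ι p
      coordinate r er {x} {y} {z} {p} e = trans (cong (r ℚ.*_) (trans (cong₂ ℚ._+_ (cong₂ ℚ._+_ (sym (ι-* w₁ x)) (sym (ι-* w₂ y))) (sym (ι-* w₃ z)))
        (trans (sym (ι-sum (w₁ * x) (w₂ * y) (w₃ * z))) (trans (cong ι e) (ι-* (w₁ + w₂ + w₃) p)))))
        (trans (sym (ℚₚ.*-assoc r (ι (w₁ + w₂ + w₃)) (ι p))) (trans (cong (ℚ._* ι p) er) (ℚₚ.*-identityˡ (ι p))))

  φ : V3 → Q3 → ℚ
  φ (c₁ , c₂ , c₃) (x , y , z) = ι c₁ ℚ.* x ℚ.+ ι c₂ ℚ.* y ℚ.+ ι c₃ ℚ.* z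

  abstract
    φ-+ : ∀ c x y → φ c (x +q y) ≡ φ c x ℚ.+ φ c y
    φ-+ (c₁ , c₂ , c₃) (x₁ , x₂ , x₃) (y₁ , y₂ , y₃) = lem (ι c₁) (ι c₂) (ι c₃) x₁ x₂ x₃ y₁ y₂ y₃
      where
      lem : ∀ c₁ c₂ c₃ x₁ x₂ x₃ y₁ y₂ y₃ → c₁ ℚ.* (x₁ ℚ.+ y₁) ℚ.+ c₂ ℚ.* (x₂ ℚ.+ y₂) ℚ.+ c₃ ℚ.* (x₃ ℚ.+ y₃) ≡
        (c₁ ℚ.* x₁ ℚ.+ c₂ ℚ.* x₂ ℚ.+ c₃ ℚ.* x₃) ℚ.+ (c₁ ℚ.* y₁ ℚ.+ c₂ ℚ.* y₂ ℚ.+ c₃ ℚ.* y₃)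
      lem = RingTactic.solve-∀ ringℚ

    φ-· : ∀ c k x → φ c (k ·q x) ≡ k ℚ.* φ c x
    φ-· (c₁ , c₂ , c₃) k (x₁ , x₂ , x₃) = lem (ι c₁) (ι c₂) (ι c₃) k x₁ x₂ x₃
      where
      lem : ∀ c₁ c₂ c₃ k x₁ x₂ x₃ → c₁ ℚ.* (k ℚ.* x₁) ℚ.+ c₂ ℚ.* (k ℚ.* x₂) ℚ.+ c₃ ℚ.* (k ℚ.* x₃) ≡ k ℚ.* (c₁ ℚ.* x₁ ℚ.+ c₂ ℚ.* x₂ ℚ.+ c₃ ℚ.* x₃)
      lem = RingTactic.solve-∀ ringℚ

    φ-toQ : ∀ c v → φ c (toQ v) ≡ ι (dot c v)
    φ-toQ (c₁ , c₂ , c₃) (x , y , z) = sym (trans (ι-+ (c₁ * x + c₂ * y) (c₃ * z)) (cong₂ ℚ._+_ (trans (ι-+ (c₁ * x) (c₂ * y)) (cong₂ ℚ._+_ (ι-* c₁ x) (ι-* c₂ y))) (ι-* c₃ z)))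

    φ-sum : ∀ c {n} (f : Fin n → Q3) → φ c (sumFinQ3 f) ≡ sumFin (φ c ∘ f)
    φ-sum (c₁ , c₂ , c₃) {zero} f = trans (cong₂ ℚ._+_ (cong₂ ℚ._+_ (ℚₚ.*-zeroʳ (ι c₁)) (ℚₚ.*-zeroʳ (ι c₂))) (ℚₚ.*-zeroʳ (ι c₃))) refl
    φ-sum c {suc n} f = trans (φ-+ c (f zero) (sumFinQ3 (f ∘ suc))) (cong (φ c (f zero) ℚ.+_) (φ-sum c (f ∘ suc)))

    inConv-≤ : ∀ {V v} c {x} → maximises V c v → inConv V x → φ c x ℚ.≤ ι (dot c v)
    inConv-≤ {V} {v} c {x} (_ , v-max) (w , w≥0 , es , ex) = subst (ℚ._≤ ι (dot c v)) (cong (φ c) ex)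
      (subst₂ ℚ._≤_ (sym (trans (φ-sum c (λ i → w i ·q toQ (lookup V i))) (sumFin-cong (λ i → φ-· c (w i) (toQ (lookup V i))))))
        (trans (sumFin-cong (λ i → ℚₚ.*-comm (w i) (ι (dot c v)))) (trans (sumFin-* (ι (dot c v)) w) (trans (cong (ι (dot c v) ℚ.*_) es) (ℚₚ.*-identityʳ (ι (dot c v))))))
        (sumFin-mono (λ i → ℚₚ.*-monoˡ-≤-nonNeg (w i) {{ℚ.nonNegative (w≥0 i)}}
          (subst (ℚ._≤ ι (dot c v)) (sym (φ-toQ c (lookup V i))) (ι-mono (v-max (lookup V i) (∈-lookup i)))))))

    minkowski-≤ : ∀ {V W v v'} c {z} → maximises V c v → maximises W c v' → inMinkowskiSum V W (toQ z) → dot c z ≤ dot c v + dot c v'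
    minkowski-≤ {v = v} {v'} c {z} m m' (p , q , p∈ , q∈ , e) = ι-cancel (subst₂ ℚ._≤_
      (trans (sym (φ-+ c p q)) (trans (cong (φ c) e) (φ-toQ c z))) (sym (ι-+ (dot c v) (dot c v')))
      (ℚₚ.+-mono-≤ (inConv-≤ c m p∈) (inConv-≤ c m' q∈)))

-- Lattice bases at smooth vertices and the length of vertical edges

module Corners where
  open import Data.List using (List)
  open Plane
  open Clashes using (by-sign)
  open Vertices
  open Mates
  open Labelled

  abstract
    basis-rotate : ∀ e₁ e₂ e₃ → isBasis e₁ e₂ e₃ → isBasis e₂ e₃ e₁
    basis-rotate e₁ e₂ e₃ (span , indep) =
      (λ z → case span z of λ { (a , b , c , e) → b , c , a , trans (rot a b c) e }) ,
      (λ a b c e → case indep c a b (trans (sym (rot c a b)) e) of λ { (p , q , r) → q , r , p })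
      where
      rot : ∀ a b c → ((b ·v e₂) +v (c ·v e₃)) +v (a ·v e₁) ≡ ((a ·v e₁) +v (b ·v e₂)) +v (c ·v e₃)
      rot a b c = cong₂ _,_ (lem a b c (proj₁ e₁) (proj₁ e₂) (proj₁ e₃))
        (cong₂ _,_ (lem a b c (proj₁ (proj₂ e₁)) (proj₁ (proj₂ e₂)) (proj₁ (proj₂ e₃))) (lem a b c (proj₂ (proj₂ e₁)) (proj₂ (proj₂ e₂)) (proj₂ (proj₂ e₃))))
        where
        lem : ∀ a b c x y z → b * y + c * z + a * x ≡ a * x + b * y + c * z
        lem = solve-∀

  record DualBasis (e₁ e₂ e₃ : V3) : Set where
    field
      m₁ m₂ m₃ : V3
      expand : ∀ z → ((dot m₁ z ·v e₁) +v (dot m₂ z ·v e₂)) +v (dot m₃ z ·v e₃) ≡ z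
      m₃e₁ : dot m₃ e₁ ≡ 0ℤ
      m₃e₂ : dot m₃ e₂ ≡ 0ℤ
      m₃e₃ : dot m₃ e₃ ≡ 1ℤ

  abstract
    dot-comb₃ : ∀ c a b d x y z → dot c (((a ·v x) +v (b ·v y)) +v (d ·v z)) ≡ a * dot c x + b * dot c y + d * dot c z
    dot-comb₃ c a b d x y z = trans (dot-+ c ((a ·v x) +v (b ·v y)) (d ·v z))
      (cong₂ _+_ (trans (dot-+ c (a ·v x) (b ·v y)) (cong₂ _+_ (dot-· c a x) (dot-· c b y))) (dot-· c d z))

    -- The functionals are the rows of the inverse matrix, read off from the coefficients of the
    -- unit vectors in the basis; linear independence then gives the duality relations.
    dual-basis : ∀ e₁ e₂ e₃ → isBasis e₁ e₂ e₃ → DualBasis e₁ e₂ e₃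
    dual-basis e₁@(x₁ , x₂ , x₃) e₂@(y₁ , y₂ , y₃) e₃@(z₁ , z₂ , z₃) (span , indep) =
      case span ε₁ of λ { (a₁ , b₁ , c₁ , p) → case span ε₂ of λ { (a₂ , b₂ , c₂ , q) → case span ε₃ of λ { (a₃ , b₃ , c₃ , r) →
        build a₁ b₁ c₁ a₂ b₂ c₂ a₃ b₃ c₃ p q r } } }
      where
      lem : ∀ a₁ a₂ a₃ b₁ b₂ b₃ c₁ c₂ c₃ u v w x y z → (a₁ * u + a₂ * v + a₃ * w) * x + (b₁ * u + b₂ * v + b₃ * w) * y + (c₁ * u + c₂ * v + c₃ * w) * z ≡
        u * (a₁ * x + b₁ * y + c₁ * z) + v * (a₂ * x + b₂ * y + c₂ * z) + w * (a₃ * x + b₃ * y + c₃ * z)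
      lem = solve-∀
      l₁ : ∀ u v w → u * 1ℤ + v * 0ℤ + w * 0ℤ ≡ u
      l₁ = solve-∀
      l₂ : ∀ u v w → u * 0ℤ + v * 1ℤ + w * 0ℤ ≡ v
      l₂ = solve-∀
      l₃ : ∀ u v w → u * 0ℤ + v * 0ℤ + w * 1ℤ ≡ w
      l₃ = solve-∀
      build : ∀ a₁ b₁ c₁ a₂ b₂ c₂ a₃ b₃ c₃ →
        ((a₁ ·v e₁) +v (b₁ ·v e₂)) +v (c₁ ·v e₃) ≡ ε₁ → ((a₂ ·v e₁) +v (b₂ ·v e₂)) +v (c₂ ·v e₃) ≡ ε₂ → ((a₃ ·v e₁) +v (b₃ ·v e₂)) +v (c₃ ·v e₃) ≡ ε₃ →
        DualBasis e₁ e₂ e₃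
      build a₁ b₁ c₁ a₂ b₂ c₂ a₃ b₃ c₃ p q r = record
        { m₁ = m₁ ; m₂ = m₂ ; m₃ = m₃ ; expand = expand
        ; m₃e₁ = proj₂ (proj₂ (indep (dot m₁ e₁ - 1ℤ) (dot m₂ e₁) (dot m₃ e₁) (unit₁ (dot m₁ e₁) (dot m₂ e₁) (dot m₃ e₁) (expand e₁))))
        ; m₃e₂ = proj₂ (proj₂ (indep (dot m₁ e₂) (dot m₂ e₂ - 1ℤ) (dot m₃ e₂) (unit₂ (dot m₁ e₂) (dot m₂ e₂) (dot m₃ e₂) (expand e₂))))
        ; m₃e₃ = ≡-from-0 (proj₂ (proj₂ (indep (dot m₁ e₃) (dot m₂ e₃) (dot m₃ e₃ - 1ℤ) (unit₃ (dot m₁ e₃) (dot m₂ e₃) (dot m₃ e₃) (expand e₃))))) }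
        where
        m₁ m₂ m₃ : V3
        m₁ = a₁ , a₂ , a₃
        m₂ = b₁ , b₂ , b₃
        m₃ = c₁ , c₂ , c₃
        expand : ∀ z → ((dot m₁ z ·v e₁) +v (dot m₂ z ·v e₂)) +v (dot m₃ z ·v e₃) ≡ z
        expand (u , v , w) = cong₂ _,_
          (trans (lem a₁ a₂ a₃ b₁ b₂ b₃ c₁ c₂ c₃ u v w x₁ y₁ z₁) (trans (cong₂ _+_ (cong₂ (λ s t → u * s + v * t) (cong proj₁ p) (cong proj₁ q)) (cong (w *_) (cong proj₁ r))) (l₁ u v w)))
          (cong₂ _,_
          (trans (lem a₁ a₂ a₃ b₁ b₂ b₃ c₁ c₂ c₃ u v w x₂ y₂ z₂) (trans (cong₂ _+_ (cong₂ (λ s t → u * s + v * t) (cong (proj₁ ∘ proj₂) p) (cong (proj₁ ∘ proj₂) q)) (cong (w *_) (cong (proj₁ ∘ proj₂) r))) (l₂ u v w)))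
          (trans (lem a₁ a₂ a₃ b₁ b₂ b₃ c₁ c₂ c₃ u v w x₃ y₃ z₃) (trans (cong₂ _+_ (cong₂ (λ s t → u * s + v * t) (cong (proj₂ ∘ proj₂) p) (cong (proj₂ ∘ proj₂) q)) (cong (w *_) (cong (proj₂ ∘ proj₂) r))) (l₃ u v w))))
        s₁ : ∀ a b c x y z → a * x + b * y + c * z ≡ x → (a - 1ℤ) * x + b * y + c * z ≡ 0ℤ
        s₁ a b c x y z e = trans (l a b c x y z) (0-from-≡ e)
          where
          l : ∀ a b c x y z → (a - 1ℤ) * x + b * y + c * z ≡ a * x + b * y + c * z - x
          l = solve-∀
        s₂ : ∀ a b c x y z → a * x + b * y + c * z ≡ y → a * x + (b - 1ℤ) * y + c * z ≡ 0ℤ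
        s₂ a b c x y z e = trans (l a b c x y z) (0-from-≡ e)
          where
          l : ∀ a b c x y z → a * x + (b - 1ℤ) * y + c * z ≡ a * x + b * y + c * z - y
          l = solve-∀
        s₃ : ∀ a b c x y z → a * x + b * y + c * z ≡ z → a * x + b * y + (c - 1ℤ) * z ≡ 0ℤ
        s₃ a b c x y z e = trans (l a b c x y z) (0-from-≡ e)
          where
          l : ∀ a b c x y z → a * x + b * y + (c - 1ℤ) * z ≡ a * x + b * y + c * z - z
          l = solve-∀
        unit₁ : ∀ a b c → ((a ·v e₁) +v (b ·v e₂)) +v (c ·v e₃) ≡ e₁ → (((a - 1ℤ) ·v e₁) +v (b ·v e₂)) +v (c ·v e₃) ≡ 0v
        unit₁ a b c e = cong₂ _,_ (s₁ a b c x₁ y₁ z₁ (cong proj₁ e)) (cong₂ _,_ (s₁ a b c x₂ y₂ z₂ (cong (proj₁ ∘ proj₂) e)) (s₁ a b c x₃ y₃ z₃ (cong (proj₂ ∘ proj₂) e)))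
        unit₂ : ∀ a b c → ((a ·v e₁) +v (b ·v e₂)) +v (c ·v e₃) ≡ e₂ → ((a ·v e₁) +v ((b - 1ℤ) ·v e₂)) +v (c ·v e₃) ≡ 0v
        unit₂ a b c e = cong₂ _,_ (s₂ a b c x₁ y₁ z₁ (cong proj₁ e)) (cong₂ _,_ (s₂ a b c x₂ y₂ z₂ (cong (proj₁ ∘ proj₂) e)) (s₂ a b c x₃ y₃ z₃ (cong (proj₂ ∘ proj₂) e)))
        unit₃ : ∀ a b c → ((a ·v e₁) +v (b ·v e₂)) +v (c ·v e₃) ≡ e₃ → ((a ·v e₁) +v (b ·v e₂)) +v ((c - 1ℤ) ·v e₃) ≡ 0v
        unit₃ a b c e = cong₂ _,_ (s₃ a b c x₁ y₁ z₁ (cong proj₁ e)) (cong₂ _,_ (s₃ a b c x₂ y₂ z₂ (cong (proj₁ ∘ proj₂) e)) (s₃ a b c x₃ y₃ z₃ (cong (proj₂ ∘ proj₂) e)))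

  record Corner (X : List V3) {n : ℕ} (vx : Bool → Fin n → V3) (s : Bool) (j : Fin n) : Set where
    field
      l₁ l₂ : Fin n
      edge₁ : isEdge X (vx s j) (vx s l₁)
      edge₂ : isEdge X (vx s j) (vx s l₂)
      distinct : ¬ vx s l₁ ≡ vx s l₂
      {E₁ E₂ E₃} : V3
      {k₁ k₂ k₃} : ℕ
      along₁ : vx s l₁ -v vx s j ≡ (+ suc k₁) ·v E₁
      along₂ : vx s l₂ -v vx s j ≡ (+ suc k₂) ·v E₂
      along₃ : vx (not s) j -v vx s j ≡ (+ suc k₃) ·v E₃
      basis : isBasis E₁ E₂ E₃

  abstract
    -- The vertical edge is one of the three edges at the vertex, and a cyclic rotation of the basis
    -- puts it last. The other two have different ends, so they must stay on side `s`.
    smooth-corner : ∀ {X n} {vx : Bool → Fin n → V3} → Smooth X → Labelled X vx → ∀ s j → Corner X vx s j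
    smooth-corner {X} {n} {vx} (_ , smooth) L s j = case smooth (vx s j) (vertex L s j) of λ
      { (w₁ , w₂ , w₃ , d₁ , d₂ , d₃ , n₁₂ , n₁₃ , n₂₃ , all , e₁ , e₂ , e₃ , (p₁ , _) , (p₂ , _) , (p₃ , _) , B) →
        case all (vx (not s) j) (vertical L s j) of λ
        { (inj₁ refl) → build d₂ d₃ n₂₃ (n₁₂ ∘ sym) (n₁₃ ∘ sym) p₂ p₃ p₁ (basis-rotate e₁ e₂ e₃ B)
        ; (inj₂ (inj₁ refl)) → build d₃ d₁ (n₁₃ ∘ sym) (n₂₃ ∘ sym) n₁₂ p₃ p₁ p₂ (basis-rotate e₂ e₃ e₁ (basis-rotate e₁ e₂ e₃ B))
        ; (inj₂ (inj₂ refl)) → build d₁ d₂ n₁₂ n₁₃ n₂₃ p₁ p₂ p₃ B } }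
      where
      u : V3
      u = vx (not s) j
      build : ∀ {x y e₁ e₂ e₃} → isEdge X (vx s j) x → isEdge X (vx s j) y → ¬ x ≡ y → ¬ x ≡ u → ¬ y ≡ u →
        ∃[ k ] (x -v vx s j ≡ (+ suc k) ·v e₁) → ∃[ k ] (y -v vx s j ≡ (+ suc k) ·v e₂) → ∃[ k ] (u -v vx s j ≡ (+ suc k) ·v e₃) →
        isBasis e₁ e₂ e₃ → Corner X vx s j
      build {e₁ = e₁} {e₂} {e₃} d₁ d₂ x≢y x≢u y≢u (k₁ , p₁) (k₂ , p₂) (k₃ , p₃) B = case edges L s j d₁ of λ
        { (inj₁ e) → ⊥-elim (x≢u e)
        ; (inj₂ (l₁ , refl)) → case edges L s j d₂ of λ
          { (inj₁ e) → ⊥-elim (y≢u e)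
          ; (inj₂ (l₂ , refl)) → record { l₁ = l₁ ; l₂ = l₂ ; edge₁ = d₁ ; edge₂ = d₂ ; distinct = x≢y ; E₁ = e₁ ; E₂ = e₂ ; E₃ = e₃ ; k₁ = k₁ ; k₂ = k₂ ; k₃ = k₃ ; along₁ = p₁ ; along₂ = p₂ ; along₃ = p₃ ; basis = B } } }

    along-zero : ∀ c k x y E → x -v y ≡ (+ suc k) ·v E → dot c x ≡ dot c y → dot c E ≡ 0ℤ
    along-zero c k x y E e h = ≡0*-cancel {+ suc k} {dot c E} (+<+ ℕ.z<s)
      (trans (sym (dot-· c (+ suc k) E)) (trans (cong (dot c) (sym e)) (trans (dot-- c x y) (0-from-≡ h))))

    along-value : ∀ c k x y E → x -v y ≡ (+ suc k) ·v E → dot c x - dot c y ≡ (+ suc k) * dot c E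
    along-value c k x y E e = trans (sym (dot-- c x y)) (trans (cong (dot c) e) (dot-· c (+ suc k) E))

  module Levels {X : List V3} {n : ℕ} {vx : Bool → Fin n → V3} (smooth : Smooth X) (L : Labelled X vx)
    (ν : V3) (lev : Bool → ℤ) (ν-lev : ∀ s j → dot ν (vx s j) ≡ lev s) {y₀ : V3} (νy₀ : dot ν y₀ ≡ 1ℤ) where

    abstract
      -- `ν` is constant along the two edges within the side. As it takes the value one on the
      -- lattice, it must take a unit value on the third basis vector.
      flat-basis : ∀ s j → (C : Corner X vx s j) → let open Corner C in
        dot ν E₁ ≡ 0ℤ × dot ν E₂ ≡ 0ℤ × (∃[ c ] (c * dot ν E₃ ≡ 1ℤ))
      flat-basis s j C = ν₁ , ν₂ , (case proj₁ basis y₀ of λ { (a , b , c , e) → c ,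
          trans (lem a b (c * dot ν E₃)) (trans (cong₂ (λ p q → a * p + b * q + c * dot ν E₃) (sym ν₁) (sym ν₂))
            (trans (sym (dot-comb₃ ν a b c E₁ E₂ E₃)) (trans (cong (dot ν) e) νy₀))) })
        where
        open Corner C
        ν₁ : dot ν E₁ ≡ 0ℤ
        ν₁ = along-zero ν k₁ (vx s l₁) (vx s j) E₁ along₁ (trans (ν-lev s l₁) (sym (ν-lev s j)))
        ν₂ : dot ν E₂ ≡ 0ℤ
        ν₂ = along-zero ν k₂ (vx s l₂) (vx s j) E₂ along₂ (trans (ν-lev s l₂) (sym (ν-lev s j)))
        lem : ∀ a b c → c ≡ a * 0ℤ + b * 0ℤ + c
        lem = solve-∀

      unit-sign : ∀ c t k → c * t ≡ 1ℤ → 0ℤ ≤ (+ suc k) * t → t ≡ 1ℤ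
      unit-sign c t k e h = by-cases (sgn (t - 1ℤ))
        where
        t≥0 : 0ℤ ≤ t
        t≥0 = 0≤*-cancel {+ suc k} {t} (+<+ ℕ.z<s) h
        t>0 : 0ℤ < t
        t>0 = by-sign t (λ p → p) (λ z → case trans (sym e) (trans (cong (c *_) z) (*-zeroʳ c)) of λ ()) (λ p → ¬neg p t≥0)
        c>0 : 0ℤ < c
        c>0 = 0<*-cancel {t} {c} t>0 (0<-resp (+<+ {0} {1} ℕ.z<s) (trans (sym e) (*-comm c t)))
        lem : ∀ c t → c * (t - 1ℤ) + (c - 1ℤ) ≡ c * t - 1ℤ
        lem = solve-∀
        by-cases : Sgn (t - 1ℤ) → t ≡ 1ℤ
        by-cases (is+ p) = 0<0-absurd (0<-resp (0<+≤ (0<* c>0 p) (0<⇒0≤-1 c>0)) (trans (lem c t) (0-from-≡ e)))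
        by-cases (is0 z) = ≡-from-0 z
        by-cases (is- p) = ¬neg p (0<⇒0≤-1 t>0)

      -- By `flat-basis`, `ν` is a unit on the primitive vertical direction, and the order of the
      -- levels fixes its sign. So the level difference is the lattice length of every vertical
      -- edge.
      vertical-direction : 0ℤ ≤ lev true - lev false → ∀ j → ∃[ e ] (vx true j ≡ vx false j +v ((lev true - lev false) ·v e) × dot ν e ≡ 1ℤ × 0ℤ < lev true - lev false)
      vertical-direction h j = case flat-basis false j C of λ { (_ , _ , c , e) → direction c e }
        where
        C : Corner X vx false j
        C = smooth-corner smooth L false j
        open Corner C
        K≡ : lev true - lev false ≡ (+ suc k₃) * dot ν E₃
        K≡ = trans (cong₂ _-_ (sym (ν-lev true j)) (sym (ν-lev false j))) (along-value ν k₃ (vx true j) (vx false j) E₃ along₃)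
        add-back : ∀ x y → x ≡ y +v (x -v y)
        add-back (x₁ , x₂ , x₃) (y₁ , y₂ , y₃) = cong₂ _,_ (l x₁ y₁) (cong₂ _,_ (l x₂ y₂) (l x₃ y₃))
          where
          l : ∀ x y → x ≡ y + (x - y)
          l = solve-∀
        direction : ∀ c → c * dot ν E₃ ≡ 1ℤ → ∃[ e ] (vx true j ≡ vx false j +v ((lev true - lev false) ·v e) × dot ν e ≡ 1ℤ × 0ℤ < lev true - lev false)
        direction c e = E₃ , trans (add-back (vx true j) (vx false j)) (cong (vx false j +v_) (trans along₃ (cong (_·v E₃) (sym K≡suc)))) , ν₃ ,
            subst (0ℤ <_) (sym K≡suc) (+<+ ℕ.z<s)
          where
          ν₃ : dot ν E₃ ≡ 1ℤ
          ν₃ = unit-sign c (dot ν E₃) k₃ e (subst (0ℤ ≤_) K≡ h)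
          K≡suc : lev true - lev false ≡ + suc k₃
          K≡suc = trans K≡ (trans (cong ((+ suc k₃) *_) ν₃) (*-identityʳ (+ suc k₃)))

-- Bottom and top have the same normal fan

module Fans where
  open import Data.Vec using ([]; _∷_)
  open import Data.List using (List)
  open Plane
  open Clashes using (by-sign)
  open Vertices
  open Mates
  open Labelling
  open Corners
  open Labelled
  open PlaneOps _+_ _*_ -_

  abstract
    perpendicular : ∀ P P' x z → 0ℤ < dot₂ x x → 0ℤ < dot₂ P' P' → dot₂ P x ≡ 0ℤ → dot₂ P' x ≡ 0ℤ → dot₂ P' z ≡ 0ℤ → dot₂ P z ≡ 0ℤ
    perpendicular P P' x z x² P'² Px P'x P'z = ≡0*-cancel {dot₂ P' P'} P'²
      (trans (id₂ P P' z) (trans (cong₂ (λ a b → a * dot₂ P P' - b * det P' z) P'z parallel-P) refl))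
      where
      id₁ : ∀ P P' x → dot₂ x x * det P P' ≡ dot₂ P x * det x P' - dot₂ P' x * det x P
      id₁ P P' x = by-ring [] (P ∷ P' ∷ x ∷ []) (λ { [] (P ∷ P' ∷ x ∷ []) →
        E.dot₂ x x ⊗ E.det P P' ≋ E.dot₂ P x ⊗ E.det x P' E.⊖ E.dot₂ P' x ⊗ E.det x P }) refl
      id₂ : ∀ P P' z → dot₂ P' P' * dot₂ P z ≡ dot₂ P' z * dot₂ P P' - det P P' * det P' z
      id₂ P P' z = by-ring [] (P ∷ P' ∷ z ∷ []) (λ { [] (P ∷ P' ∷ z ∷ []) →
        E.dot₂ P' P' ⊗ E.dot₂ P z ≋ E.dot₂ P' z ⊗ E.dot₂ P P' E.⊖ E.det P P' ⊗ E.det P' z }) refl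
      parallel-P : det P P' ≡ 0ℤ
      parallel-P = ≡0*-cancel {dot₂ x x} x² (trans (id₁ P P' x) (trans (cong₂ (λ a b → a * det x P' - b * det x P) Px P'x) refl))

    ≤⇒0≤ : ∀ {x y} → x ≤ y → 0ℤ ≤ y - x
    ≤⇒0≤ = i≤j⇒0≤j-i

    0≤⇒≤ : ∀ {x y} → 0ℤ ≤ y - x → x ≤ y
    0≤⇒≤ = 0≤i-j⇒j≤i

  module Fan {V : List V3} {n : ℕ} {vx : Bool → Fin n → V3} (smooth : Smooth V) (L : Labelled V vx) (quad : Quad V vx)
    {e₁ e₂ e₃ : V3} (D : DualBasis e₁ e₂ e₃) (lev : Bool → ℤ) (ν-lev : ∀ s j → dot (DualBasis.m₃ D) (vx s j) ≡ lev s)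
    (K>0 : 0ℤ < lev true - lev false) where

    open DualBasis D

    open Levels smooth L m₃ lev ν-lev {e₃} m₃e₃ using (flat-basis)

    plane : V3 → V2
    plane y = dot m₁ y , dot m₂ y

    restrict : V3 → V2
    restrict c = dot c e₁ , dot c e₂

    abstract
      lev-≢ : ∀ t → ¬ lev t ≡ lev (not t)
      lev-≢ true e = 0<0-absurd (0<-resp K>0 (0-from-≡ e))
      lev-≢ false e = 0<0-absurd (0<-resp K>0 (0-from-≡ (sym e)))

      sides-differ : ∀ t i j → ¬ vx t i ≡ vx (not t) j
      sides-differ t i j e = lev-≢ t (trans (sym (ν-lev t i)) (trans (cong (dot m₃) e) (ν-lev (not t) j)))

      side : ∀ t → ∃[ σ ] ((∀ l m → dot σ (vx (not t) l) < dot σ (vx t m)) × (∀ l m → dot σ (vx t l) ≡ dot σ (vx t m)))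
      side true = m₃ , (λ l m → 0<⇒< (0<-resp K>0 (sym (cong₂ _-_ (ν-lev true m) (ν-lev false l))))) , (λ l m → trans (ν-lev true l) (sym (ν-lev true m)))
      side false = -1ℤ ·v m₃ ,
        (λ l m → 0<⇒< (0<-resp K>0 (sym (trans (cong₂ _-_ (neg-lev false m) (neg-lev true l)) (lem (lev false) (lev true)))))) ,
        (λ l m → trans (neg-lev false l) (sym (neg-lev false m)))
        where
        neg-lev : ∀ s j → dot (-1ℤ ·v m₃) (vx s j) ≡ -1ℤ * lev s
        neg-lev s j = trans (·-dot -1ℤ m₃ (vx s j)) (cong (-1ℤ *_) (ν-lev s j))
        lem : ∀ a b → -1ℤ * a - -1ℤ * b ≡ b - a
        lem = solve-∀

      flat : ∀ c y → dot m₃ y ≡ 0ℤ → dot c y ≡ dot₂ (restrict c) (plane y)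
      flat c y e = trans (cong (dot c) (sym (expand y))) (trans (dot-comb₃ c (dot m₁ y) (dot m₂ y) (dot m₃ y) e₁ e₂ e₃)
        (trans (cong (λ t → dot m₁ y * dot c e₁ + dot m₂ y * dot c e₂ + t * dot c e₃) e) (lem (dot m₁ y) (dot m₂ y) (dot c e₁) (dot c e₂) (dot c e₃))))
        where
        lem : ∀ a b x y z → a * x + b * y + 0ℤ * z ≡ x * a + y * b
        lem = solve-∀

      flat-difference : ∀ t i j → dot m₃ (vx t j -v vx t i) ≡ 0ℤ
      flat-difference t i j = trans (dot-- m₃ (vx t j) (vx t i)) (0-from-≡ (trans (ν-lev t j) (sym (ν-lev t i))))

      same-fibre' : ∀ t {i j} → vx (not t) i ≡ vx (not t) j → vx t i ≡ vx t j
      same-fibre' false e = same-fibre L true e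
      same-fibre' true e = same-fibre L false e

    -- c* is constant on an edge of side t, but not on the corresponding edge of the other side.
    module Skew (t : Bool) (i m : Fin n) (c : V3) (far-max : ∀ l → dot c (vx t l) ≤ dot c (vx t i))
      (far-≡ : dot c (vx t m) ≡ dot c (vx t i)) (far-≢ : ¬ vx t m ≡ vx t i)
      (near-< : 0ℤ < dot c (vx (not t) i) - dot c (vx (not t) m)) where

      private
        X Z : V3
        X = vx t m -v vx t i
        Z = vx (not t) m -v vx (not t) i

        abstract
          νZ : dot m₃ Z ≡ 0ℤ
          νZ = flat-difference (not t) i m

          X≢0 : ¬ plane X ≡ 0₂
          X≢0 e = far-≢ (≡-by-dot (vx t m) (vx t i) λ d → ≡-from-0 (trans (sym (dot-- d (vx t m) (vx t i)))
            (trans (flat d X (flat-difference t i m)) (trans (cong (dot₂ (restrict d)) e) (lem (dot d e₁) (dot d e₂))))))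
            where
            lem : ∀ a b → a * 0ℤ + b * 0ℤ ≡ 0ℤ
            lem = solve-∀

          vanish : ∀ d s → dot d (vx s m) ≡ dot d (vx s i) → dot₂ (restrict d) (plane (vx s m -v vx s i)) ≡ 0ℤ
          vanish d s e = trans (sym (flat d (vx s m -v vx s i) (flat-difference s i m))) (trans (dot-- d (vx s m) (vx s i)) (0-from-≡ e))

          Z-nonzero : ¬ dot c Z ≡ 0ℤ
          Z-nonzero e = 0<0-absurd (0<-resp near-< (trans (lem (dot c (vx (not t) i)) (dot c (vx (not t) m)))
            (cong -_ (trans (sym (dot-- c (vx (not t) m) (vx (not t) i))) e))))
            where
            lem : ∀ a b → a - b ≡ - (b - a)
            lem = solve-∀

          constant-case : (∀ l → dot c (vx t l) ≡ dot c (vx t i)) → ⊥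
          constant-case all = case flat-basis t i C of λ { (ν₁ , ν₂ , k , e) → case proj₁ basis Z of λ { (a , b , d , eZ) →
              Z-nonzero (trans (cong (dot c) (sym eZ)) (trans (dot-comb₃ c a b d E₁ E₂ E₃)
                (trans (cong₂ (λ p q → a * p + b * q + d * dot c E₃) c₁ c₂)
                  (trans (cong (λ q → a * 0ℤ + b * 0ℤ + q * dot c E₃) (d≡0 ν₁ ν₂ k e a b d eZ)) (lem a b (dot c E₃)))))) } }
            where
            C : Corner V vx t i
            C = smooth-corner smooth L t i
            open Corner C
            c₁ : dot c E₁ ≡ 0ℤ
            c₁ = along-zero c k₁ (vx t l₁) (vx t i) E₁ along₁ (all l₁)
            c₂ : dot c E₂ ≡ 0ℤ
            c₂ = along-zero c k₂ (vx t l₂) (vx t i) E₂ along₂ (all l₂)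
            lem : ∀ a b x → a * 0ℤ + b * 0ℤ + 0ℤ * x ≡ 0ℤ
            lem = solve-∀
            d≡0 : dot m₃ E₁ ≡ 0ℤ → dot m₃ E₂ ≡ 0ℤ → ∀ k → k * dot m₃ E₃ ≡ 1ℤ → ∀ a b d → ((a ·v E₁) +v (b ·v E₂)) +v (d ·v E₃) ≡ Z → d ≡ 0ℤ
            d≡0 ν₁ ν₂ k e a b d eZ = trans (sym (*-identityʳ d)) (trans (cong (d *_) (sym e)) (trans (l₀ d k (dot m₃ E₃))
              (trans (cong (k *_) (trans (l₁' a b (d * dot m₃ E₃)) (trans (cong₂ (λ p q → a * p + b * q + d * dot m₃ E₃) (sym ν₁) (sym ν₂))
                (trans (sym (dot-comb₃ m₃ a b d E₁ E₂ E₃)) (trans (cong (dot m₃) eZ) νZ))))) (*-zeroʳ k))))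
              where
              l₀ : ∀ d k x → d * (k * x) ≡ k * (d * x)
              l₀ = solve-∀
              l₁' : ∀ a b x → x ≡ a * 0ℤ + b * 0ℤ + x
              l₁' = solve-∀

      abstract
        -- `quad` gives a functional `d` that is constant on both edges joining `i` and `m`. If `d`
        -- is not constant on horizontal directions, the far edge, nonzero and killed by `c` and
        -- `d`, makes their horizontal parts parallel, so `c` kills the near edge too. If it is, all
        -- near vertices maximise `d`, so `c` is constant on the far side; smoothness at a corner
        -- makes `c` vanish on all horizontal directions.
        skew-clash : ⊥
        skew-clash = case side t of λ { (σ , σ-< , σ-≡) → case quad t σ σ-< σ-≡ c i m far-max far-≡ of λ
          { (d , d-max-i , d-max-m , only) → with-face d d-max-i d-max-m only } }
          where
          with-face : ∀ d → (∀ s → maximises V d (vx s i)) → (∀ s → maximises V d (vx s m)) →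
            (∀ l → maximises V d (vx (not t) l) → dot c (vx t l) ≡ dot c (vx t i)) → ⊥
          with-face d d-max-i d-max-m only = case sum-of-squares (plane X) of λ
            { (inj₂ e) → X≢0 e
            ; (inj₁ X²) → case sum-of-squares (restrict d) of λ
              { (inj₁ d²) → Z-nonzero (trans (flat c Z νZ) (perpendicular (restrict c) (restrict d) (plane X) (plane Z) X² d²
                  (vanish c t far-≡) (vanish d t (maximisers-≡ d (d-max-i t) (d-max-m t))) (vanish d (not t) (maximisers-≡ d (d-max-i (not t)) (d-max-m (not t))))))
              ; (inj₂ e) → constant-case (λ l → only l (maximises-≡ d (d-max-i (not t)) (vertex∈ (vertex L (not t) l)) (constant e l))) } }
            where
            constant : restrict d ≡ 0₂ → ∀ l → dot d (vx (not t) l) ≡ dot d (vx (not t) i)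
            constant e l = ≡-from-0 (trans (sym (dot-- d (vx (not t) l) (vx (not t) i)))
              (trans (flat d (vx (not t) l -v vx (not t) i) (flat-difference (not t) i l))
                (trans (cong (λ p → dot₂ p (plane (vx (not t) l -v vx (not t) i))) e) refl)))

    -- Let `d` expose the vertical edge over `i`. If `c` were larger somewhere on the far side, it
    -- could be tilted by `d` just until a vertex `m` ties with `i` there. On the near side the
    -- tilted functional still prefers `i` strictly to `m`, which is the situation excluded by
    -- `Skew`.
    module Far (t : Bool) (c : V3) (i : Fin n) (near-max : ∀ j → 0ℤ ≤ dot c (vx (not t) i) - dot c (vx (not t) j)) where

      private
        abstract
          far-edge : isEdge V (vx t i) (vx (not t) i)
          far-edge = vertical L t i

        d : V3
        d = proj₁ (proj₂ (proj₂ (proj₂ far-edge)))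

        h : ∀ x → (isVertex V x × maximises V d x) ⇔ (x ≡ vx t i ⊎ x ≡ vx (not t) i)
        h = proj₂ (proj₂ (proj₂ (proj₂ far-edge)))

        abstract
          d-far : maximises V d (vx t i)
          d-far = proj₂ (Equivalence.from (h (vx t i)) (inj₁ refl))

          d-near : maximises V d (vx (not t) i)
          d-near = proj₂ (Equivalence.from (h (vx (not t) i)) (inj₂ refl))

          d-only : ∀ s j {v} → maximises V d v → dot d (vx s j) ≡ dot d v → vx s j ≡ vx t i ⊎ vx s j ≡ vx (not t) i
          d-only s j m e = Equivalence.to (h (vx s j)) (vertex L s j , maximises-≡ d m (vertex∈ (vertex L s j)) e)

        C D' : Fin n → ℤ
        C j = dot c (vx t j) - dot c (vx t i)
        D' j = dot d (vx t i) - dot d (vx t j)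

        abstract
          D'≥0 : ∀ j → 0ℤ ≤ D' j
          D'≥0 j = ≤⇒0≤ (proj₂ d-far (vx t j) (vertex∈ (vertex L t j)))

          D'≡0 : ∀ j → D' j ≡ 0ℤ → 0ℤ ≤ - C j
          D'≡0 j e = case d-only t j d-far (sym (≡-from-0 e)) of λ
            { (inj₁ p) → 0≤-≡ (cong -_ (0-from-≡ (cong (dot c) p)))
            ; (inj₂ p) → ⊥-elim (sides-differ t j i p) }

          better : ∀ m → 0ℤ < C m → 0ℤ < D' m → (∀ j → 0ℤ ≤ C m * D' j - C j * D' m) → ⊥
          better m Cm>0 Dm>0 best = Skew.skew-clash t i m c*
              (λ l → 0≤⇒≤ (0≤-resp (best l) (sym (value l))))
              (sym (≡-from-0 (trans (value m) (x-x (C m * D' m)))))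
              far-≢ near-<
            where
            c* : V3
            c* = (D' m ·v c) +v (C m ·v d)
            c*-dot : ∀ x → dot c* x ≡ D' m * dot c x + C m * dot d x
            c*-dot x = trans (+-dot (D' m ·v c) (C m ·v d) x) (cong₂ _+_ (·-dot (D' m) c x) (·-dot (C m) d x))
            lem : ∀ D C ci di cl dl → D * ci + C * di - (D * cl + C * dl) ≡ C * (di - dl) - (cl - ci) * D
            lem = solve-∀
            value : ∀ l → dot c* (vx t i) - dot c* (vx t l) ≡ C m * D' l - C l * D' m
            value l = trans (cong₂ _-_ (c*-dot (vx t i)) (c*-dot (vx t l))) (lem (D' m) (C m) (dot c (vx t i)) (dot d (vx t i)) (dot c (vx t l)) (dot d (vx t l)))
            far-≢ : ¬ vx t m ≡ vx t i
            far-≢ e = 0<0-absurd (0<-resp Cm>0 (0-from-≡ (cong (dot c) e)))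
            d-< : 0ℤ < dot d (vx (not t) i) - dot d (vx (not t) m)
            d-< = by-sign (dot d (vx (not t) i) - dot d (vx (not t) m)) (λ p → p)
              (λ e → case d-only (not t) m d-near (sym (≡-from-0 e)) of λ
                { (inj₁ p) → ⊥-elim (sides-differ t i m (sym p))
                ; (inj₂ p) → ⊥-elim (far-≢ (same-fibre' t p)) })
              (λ p → ¬neg p (≤⇒0≤ (proj₂ d-near (vx (not t) m) (vertex∈ (vertex L (not t) m)))))
            lem' : ∀ D C ci di cl dl → D * (ci - cl) + C * (di - dl) ≡ D * ci + C * di - (D * cl + C * dl)
            lem' = solve-∀
            near-< : 0ℤ < dot c* (vx (not t) i) - dot c* (vx (not t) m)
            near-< = 0<-resp (0≤+< (0≤* (0<⇒0≤ Dm>0) (near-max m)) (0<* Cm>0 d-<))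
              (trans (lem' (D' m) (C m) (dot c (vx (not t) i)) (dot d (vx (not t) i)) (dot c (vx (not t) m)) (dot d (vx (not t) m)))
                (sym (cong₂ _-_ (c*-dot (vx (not t) i)) (c*-dot (vx (not t) m)))))

      abstract
        far-max : ∀ j → 0ℤ ≤ dot c (vx t i) - dot c (vx t j)
        far-max = case best-ratio C D' D'≥0 D'≡0 of λ
          { (inj₁ all) → λ j → 0≤-resp (all j) (lem (dot c (vx t j)) (dot c (vx t i)))
          ; (inj₂ (m , Cm>0 , Dm>0 , best)) → ⊥-elim (better m Cm>0 Dm>0 best) }
          where
          lem : ∀ a b → - (a - b) ≡ b - a
          lem = solve-∀

-- Slices at integer heights and their lift to space

module Slices where
  open import Data.List using (List)
  open Plane
  open Convexity
  open Clashes using (by-sign)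
  open Walks using (Common)
  open Vertices
  open Mates
  open Labelling
  open RationalHulls
  open Corners
  open Fans
  open Labelled
  open PlaneOps _+_ _*_ -_

  argmax-inhabited : ∀ {n} → Fin n → (g : Fin n → ℤ) → ∃[ m ] (∀ j → 0ℤ ≤ g m - g j)
  argmax-inhabited {suc n} _ g = argmax g

  -- A record, so that comparing two such types never unfolds the rational arithmetic of toQ.
  record Hull (V : List V3) (x : V3) : Set where
    constructor hull
    field
      in-hull : inConv V (toQ x)
  open Hull

  affine : V3 → V3 → V3 → V2 → V3
  affine o u v (x , y) = (o +v (x ·v u)) +v (y ·v v)

  abstract
    affine-dot : ∀ c o u v p → dot c (affine o u v p) ≡ dot c o + proj₁ p * dot c u + proj₂ p * dot c v
    affine-dot c o u v (x , y) = trans (dot-+ c (o +v (x ·v u)) (y ·v v)) (cong₂ _+_ (trans (dot-+ c o (x ·v u)) (cong (_+_ (dot c o)) (dot-· c x u))) (dot-· c y v))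

    affine-comb₃ : ∀ o u v w₁ w₂ w₃ x y z p → comb₂ w₁ x w₂ y w₃ z ≡ (w₁ + w₂ + w₃) ⊡ p →
      ((w₁ ·v affine o u v x) +v (w₂ ·v affine o u v y)) +v (w₃ ·v affine o u v z) ≡ (w₁ + w₂ + w₃) ·v affine o u v p
    affine-comb₃ o u v w₁ w₂ w₃ x y z p e = ≡-by-dot _ _ λ c →
      trans (dot-comb₃ c w₁ w₂ w₃ (affine o u v x) (affine o u v y) (affine o u v z))
      (trans (cong₂ _+_ (cong₂ (λ s t → w₁ * s + w₂ * t) (affine-dot c o u v x) (affine-dot c o u v y)) (cong (w₃ *_) (affine-dot c o u v z)))
      (trans (l₁ w₁ w₂ w₃ (dot c o) (dot c u) (dot c v) (proj₁ x) (proj₂ x) (proj₁ y) (proj₂ y) (proj₁ z) (proj₂ z))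
      (trans (cong₂ (λ s t → (w₁ + w₂ + w₃) * dot c o + s * dot c u + t * dot c v) (cong proj₁ e) (cong proj₂ e))
      (trans (l₂ (w₁ + w₂ + w₃) (dot c o) (dot c u) (dot c v) (proj₁ p) (proj₂ p))
      (trans (cong ((w₁ + w₂ + w₃) *_) (sym (affine-dot c o u v p))) (sym (dot-· c (w₁ + w₂ + w₃) (affine o u v p))))))))
      where
      l₁ : ∀ w₁ w₂ w₃ o u v x x' y y' z z' → w₁ * (o + x * u + x' * v) + w₂ * (o + y * u + y' * v) + w₃ * (o + z * u + z' * v) ≡
        (w₁ + w₂ + w₃) * o + (w₁ * x + w₂ * y + w₃ * z) * u + (w₁ * x' + w₂ * y' + w₃ * z') * v
      l₁ = solve-∀
      l₂ : ∀ w o u v p p' → w * o + w * p * u + w * p' * v ≡ w * (o + p * u + p' * v)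
      l₂ = solve-∀

    Conv-lift : ∀ V {n} {A : Fin n → V2} o u v → (∀ i → Hull V (affine o u v (A i))) → ∀ {p} → Conv A p → Hull V (affine o u v p)
    Conv-lift V o u v h (gen i) = h i
    Conv-lift V o u v h (mix {w₁} {w₂} {w₃} {x} {y} {z} {p} w X Y Z e) =
      hull (inConv-mix V {x = affine o u v x} {affine o u v y} {affine o u v z} {affine o u v p} w
        (in-hull (Conv-lift V o u v h X)) (in-hull (Conv-lift V o u v h Y)) (in-hull (Conv-lift V o u v h Z))
        (affine-comb₃ o u v w₁ w₂ w₃ x y z p e))

    Common-lift : ∀ V W {n} {A R : Fin n → V2} {S S' : Fin n → V3} o u v o' u' v' z →
      (∀ i → affine o u v (A i) ≡ S i) → (∀ i → affine o' u' v' (R i) ≡ S' i) → (∀ i → Hull V (S i)) → (∀ i → Hull W (S' i)) →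
      (∀ p → affine o u v p +v affine o' u' v' p ≡ z) → Common A R → ∃[ p ] ∃[ q ] (inConv V (toQ p) × inConv W (toQ q) × (p +v q ≡ z))
    Common-lift V W o u v o' u' v' z S≡ S'≡ in-V in-W sum (p , p∈A , p∈R) =
      affine o u v p , affine o' u' v' p ,
      in-hull (Conv-lift V o u v (λ i → subst (Hull V) (sym (S≡ i)) (in-V i)) p∈A) ,
      in-hull (Conv-lift W o' u' v' (λ i → subst (Hull W) (sym (S'≡ i)) (in-W i)) p∈R) ,
      sum p

  module Slice {X : List V3} {n : ℕ} {vx : Bool → Fin n → V3} (L : Labelled X vx) (ν : V3) (lev : Bool → ℤ)
    (ν-lev : ∀ s j → dot ν (vx s j) ≡ lev s) (K : ℤ) (K≡ : K ≡ lev true - lev false) (K>0 : 0ℤ < K)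
    (e : Fin n → V3) (vertical-e : ∀ j → vx true j ≡ vx false j +v (K ·v e j)) (νe : ∀ j → dot ν (e j) ≡ 1ℤ)
    (h : ℤ) (h≥0 : 0ℤ ≤ h) (h≤K : 0ℤ ≤ K - h) where

    at : Fin n → V3
    at j = vx false j +v (h ·v e j)

    abstract
      dot-at : ∀ c j → dot c (at j) ≡ dot c (vx false j) + h * dot c (e j)
      dot-at c j = trans (dot-+ c (vx false j) (h ·v e j)) (cong (_+_ (dot c (vx false j))) (dot-· c h (e j)))

      dot-top : ∀ c j → dot c (vx true j) ≡ dot c (vx false j) + K * dot c (e j)
      dot-top c j = trans (cong (dot c) (vertical-e j)) (trans (dot-+ c (vx false j) (K ·v e j)) (cong (_+_ (dot c (vx false j))) (dot-· c K (e j))))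

      ν-at : ∀ j → dot ν (at j) ≡ lev false + h
      ν-at j = trans (dot-at ν j) (cong₂ _+_ (ν-lev false j) (trans (cong (h *_) (νe j)) (*-identityʳ h)))

      interpolate : ∀ c j → K * dot c (at j) ≡ (K - h) * dot c (vx false j) + h * dot c (vx true j)
      interpolate c j = trans (cong (K *_) (dot-at c j)) (trans (lem K h (dot c (vx false j)) (dot c (e j))) (cong (λ t → (K - h) * dot c (vx false j) + h * t) (sym (dot-top c j))))
        where
        lem : ∀ K h x e → K * (x + h * e) ≡ (K - h) * x + h * (x + K * e)
        lem = solve-∀

      at-max : ∀ c i l → dot c (vx false l) ≤ dot c (vx false i) → dot c (vx true l) ≤ dot c (vx true i) → dot c (at l) ≤ dot c (at i)
      at-max c i l p q = 0≤⇒≤ (0≤*-cancel {K} K>0 (0≤-resp (0≤+ (0≤* h≤K (≤⇒0≤ p)) (0≤* h≥0 (≤⇒0≤ q)))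
        (trans (lem (K - h) h (dot c (vx false i)) (dot c (vx false l)) (dot c (vx true i)) (dot c (vx true l)))
          (trans (cong₂ _-_ (sym (interpolate c i)) (sym (interpolate c l))) (lem' K (dot c (at i)) (dot c (at l)))))))
        where
        lem : ∀ k h x y x' y' → k * (x - y) + h * (x' - y') ≡ k * x + h * x' - (k * y + h * y')
        lem = solve-∀
        lem' : ∀ K x y → K * x - K * y ≡ K * (x - y)
        lem' = solve-∀

      in-conv : ∀ j → Hull X (at j)
      in-conv j = hull (inConv-mix X {w₁ = K - h} {h} {0ℤ} {vx false j} {vx true j} {vx false j} {at j} (weights h≤K h≥0 ≤-refl (0<-resp K>0 (l₀ K h)))
          (inConv-vertex (vertex∈ (vertex L false j))) (inConv-vertex (vertex∈ (vertex L true j))) (inConv-vertex (vertex∈ (vertex L false j)))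
          (≡-by-dot _ _ λ c → trans (dot-comb₃ c (K - h) h 0ℤ (vx false j) (vx true j) (vx false j))
            (trans (l₁ (K - h) h (dot c (vx false j)) (dot c (vx true j))) (trans (sym (interpolate c j))
              (trans (cong (_* dot c (at j)) (l₀ K h)) (sym (dot-· c (K - h + h + 0ℤ) (at j))))))))
        where
        l₀ : ∀ K h → K ≡ K - h + h + 0ℤ
        l₀ = solve-∀
        l₁ : ∀ k h x y → k * x + h * y + 0ℤ * x ≡ k * x + h * y
        l₁ = solve-∀

      -- `at j` is the mean of the two ends with weights `K - h` and `h`. If a mean of values at
      -- most `B` reaches `B`, so does an end of positive weight.
      tight : ∀ c j B → dot c (vx false j) ≤ B → dot c (vx true j) ≤ B → B ≤ dot c (at j) → dot c (vx false j) ≡ B ⊎ dot c (vx true j) ≡ B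
      tight c j B p q r = by-sign (K - h)
        (λ K-h>0 → inj₁ (sym (≡-from-0 (0≤-antisym (≤⇒0≤ p) (0≤-neg-cancel (K - h) (B - x) K-h>0 first)))))
        (λ z → inj₂ (sym (≡-from-0 (0≤-antisym (≤⇒0≤ q) (0≤-neg-cancel h (B - x') (0<-resp K>0 (≡-from-0 z)) second)))))
        (λ p → ¬neg p h≤K)
        where
        x x' : ℤ
        x = dot c (vx false j)
        x' = dot c (vx true j)
        0≤-neg-cancel : ∀ k y → 0ℤ < k → 0ℤ ≤ - (k * y) → 0ℤ ≤ - y
        0≤-neg-cancel k y k>0 h = 0≤*-cancel {k} { - y} k>0 (0≤-resp h (neg-distribʳ-* k y))
        lem : ∀ K h x x' B → - ((K - h) * (B - x)) ≡ (h * (B - x') + ((K - h) * x + h * x' - K * B))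
        lem = solve-∀
        lem' : ∀ K h x x' B → - (h * (B - x')) ≡ ((K - h) * (B - x) + ((K - h) * x + h * x' - K * B))
        lem' = solve-∀
        excess : 0ℤ ≤ (K - h) * x + h * x' - K * B
        excess = 0≤-resp (0≤* (0<⇒0≤ K>0) (≤⇒0≤ r)) (trans (l K (dot c (at j)) B) (cong (_- K * B) (interpolate c j)))
          where
          l : ∀ K a B → K * (a - B) ≡ K * a - K * B
          l = solve-∀
        first : 0ℤ ≤ - ((K - h) * (B - x))
        first = 0≤-resp (0≤+ (0≤* h≥0 (≤⇒0≤ q)) excess) (sym (lem K h x x' B))
        second : 0ℤ ≤ - (h * (B - x'))
        second = 0≤-resp (0≤+ (0≤* h≤K (≤⇒0≤ p)) excess) (sym (lem' K h x x' B))

      levels-differ : ∀ i j → ¬ vx false i ≡ vx true j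
      levels-differ i j p = 0<0-absurd (0<-resp K>0 (trans K≡ (0-from-≡ (trans (sym (ν-lev true j)) (trans (cong (dot ν) (sym p)) (ν-lev false i))))))

      -- Let `d` expose the vertical edge over `i`. If the slice points coincide, `tight` puts an
      -- end of the edge over `j` into that exposed edge. The levels then force it to be the end
      -- over `i` on the same side.
      at-injective : ∀ i j → ¬ vx false i ≡ vx false j → ¬ at i ≡ at j
      at-injective i j i≢j p = case vertical L false i of λ { (_ , _ , _ , d , face) → contradiction d face }
        where
        contradiction : ∀ d → (∀ x → (isVertex X x × maximises X d x) ⇔ (x ≡ vx false i ⊎ x ≡ vx true i)) → ⊥
        contradiction d face = case tight d j B (proj₂ lo-max (vx false j) (vertex∈ (vertex L false j))) (proj₂ lo-max (vx true j) (vertex∈ (vertex L true j)))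
            (≤-reflexive (trans B≡ (cong (dot d) p))) of λ
          { (inj₁ q) → case only false q of λ { (inj₁ r) → i≢j (sym r) ; (inj₂ r) → levels-differ j i r }
          ; (inj₂ q) → case only true q of λ { (inj₁ r) → levels-differ i j (sym r) ; (inj₂ r) → i≢j (sym (same-fibre L true r)) } }
          where
          B : ℤ
          B = dot d (vx false i)
          lo-max : maximises X d (vx false i)
          lo-max = proj₂ (Equivalence.from (face (vx false i)) (inj₁ refl))
          hi-max : maximises X d (vx true i)
          hi-max = proj₂ (Equivalence.from (face (vx true i)) (inj₂ refl))
          only : ∀ s → dot d (vx s j) ≡ B → vx s j ≡ vx false i ⊎ vx s j ≡ vx true i
          only s q = Equivalence.to (face (vx s j)) (vertex L s j , maximises-≡ d lo-max (vertex∈ (vertex L s j)) q)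
          lem : ∀ K h B → (K - h) * B + h * B ≡ K * B
          lem = solve-∀
          B≡ : B ≡ dot d (at i)
          B≡ = sym (≡-from-0 (≡0*-cancel {K} K>0 (trans (l K (dot d (at i)) B) (0-from-≡ (trans (interpolate d i)
            (trans (cong (λ t → (K - h) * B + h * t) (maximisers-≡ d lo-max hi-max)) (lem K h B)))))))
            where
            l : ∀ K a B → K * (a - B) ≡ K * a - K * B
            l = solve-∀

-- Assembly: from equivalent prismatoids to a pair of slices

open import Data.Vec using ([]; _∷_)
open import Data.List using (List)
open Plane
open Convexity
open Walks
open Edges
open Clashes using (by-sign)
open Polygons
open Vertices
open Mates
open Labelling
open RationalHulls
open Corners
open Fans
open Slices
open Labelled
open PlaneOps _+_ _*_ -_

module Assembly {V W : List V3} {n : ℕ} {vx : Bool → Fin n → V3} (smoothV : Smooth V) (smoothW : Smooth W)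
  (L : Labelled V vx) (quad : Quad V vx) (equiv : MinkowskiEquivalent V W) (j₀ : Fin n)
  {a : V3} {α : Bool → ℤ} (a≢0 : ¬ a ≡ 0v) (a-level : ∀ s j → dot a (vx s j) ≡ α s) where

  private
    C₀ : Corner V vx false j₀
    C₀ = smooth-corner smoothV L false j₀

  open Corner C₀ using (E₁; E₂; E₃; k₁; k₂; k₃; l₁; l₂)

  -- One bottom corner supplies coordinates for everything: `E₁` and `E₂` span the horizontal
  -- directions, and `m₃` is the primitive normal of which `a` is a multiple.
  D : DualBasis E₁ E₂ E₃
  D = dual-basis E₁ E₂ E₃ (Corner.basis C₀)

  open DualBasis D using (m₁; m₂; m₃; expand; m₃e₃)

  lev : Bool → ℤ
  lev s = dot m₃ (vx s j₀)

  K : ℤ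
  K = lev true - lev false

  abstract
    a-factor : ∀ z → dot a z ≡ dot m₃ z * dot a E₃
    a-factor z = trans (cong (dot a) (sym (expand z))) (trans (dot-comb₃ a (dot m₁ z) (dot m₂ z) (dot m₃ z) E₁ E₂ E₃)
      (trans (cong₂ (λ p q → dot m₁ z * p + dot m₂ z * q + dot m₃ z * dot a E₃)
        (along-zero a k₁ (vx false l₁) (vx false j₀) E₁ (Corner.along₁ C₀) (trans (a-level false l₁) (sym (a-level false j₀))))
        (along-zero a k₂ (vx false l₂) (vx false j₀) E₂ (Corner.along₂ C₀) (trans (a-level false l₂) (sym (a-level false j₀)))))
        (lem (dot m₁ z) (dot m₂ z) (dot m₃ z * dot a E₃))))
      where
      lem : ∀ x y z → x * 0ℤ + y * 0ℤ + z ≡ z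
      lem = solve-∀

    aE₃≢0 : ¬ dot a E₃ ≡ 0ℤ
    aE₃≢0 e = a≢0 (≡-by-dot a 0v λ c → trans (dot-comm c a) (trans (a-factor c) (trans (cong (dot m₃ c *_) e) (trans (*-zeroʳ (dot m₃ c)) (sym (dot-0 c))))))
      where
      dot-comm : ∀ x y → dot x y ≡ dot y x
      dot-comm (x₁ , x₂ , x₃) (y₁ , y₂ , y₃) = lem x₁ x₂ x₃ y₁ y₂ y₃
        where
        lem : ∀ x₁ x₂ x₃ y₁ y₂ y₃ → x₁ * y₁ + x₂ * y₂ + x₃ * y₃ ≡ y₁ * x₁ + y₂ * x₂ + y₃ * x₃
        lem = solve-∀
      dot-0 : ∀ c → dot c 0v ≡ 0ℤ
      dot-0 (x₁ , x₂ , x₃) = lem x₁ x₂ x₃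
        where
        lem : ∀ x₁ x₂ x₃ → x₁ * 0ℤ + x₂ * 0ℤ + x₃ * 0ℤ ≡ 0ℤ
        lem = solve-∀

    ν-lev : ∀ s j → dot m₃ (vx s j) ≡ lev s
    ν-lev s j = case i*j≡0⇒i≡0∨j≡0 (dot m₃ (vx s j) - lev s) product of λ
      { (inj₁ e) → ≡-from-0 e
      ; (inj₂ e) → ⊥-elim (aE₃≢0 e) }
      where
      lem : ∀ x y g → (x - y) * g ≡ x * g - y * g
      lem = solve-∀
      product : (dot m₃ (vx s j) - lev s) * dot a E₃ ≡ 0ℤ
      product = trans (lem (dot m₃ (vx s j)) (lev s) (dot a E₃)) (0-from-≡ (trans (sym (a-factor (vx s j)))
        (trans (trans (a-level s j) (sym (a-level s j₀))) (a-factor (vx s j₀)))))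

    K>0 : 0ℤ < K
    K>0 = 0<-resp (+<+ {0} {suc k₃} ℕ.z<s) (sym (trans (along-value m₃ k₃ (vx true j₀) (vx false j₀) E₃ (Corner.along₃ C₀))
      (trans (cong ((+ suc k₃) *_) m₃e₃) (*-identityʳ (+ suc k₃)))))

    V-inhabited : ∃[ x ] (x ∈ V)
    V-inhabited = vx false j₀ , vertex∈ (vertex L false j₀)

    W-inhabited : ∃[ x ] (x ∈ W)
    W-inhabited = case proj₁ smoothW of λ { (x , _ , _ , _ , x∈ , _) → x , x∈ }

    mates : ∀ s j → ∃[ w ] Mate V W (vx s j) w
    mates s j = mate-exists equiv W-inhabited (vertex L s j)

  vx' : Bool → Fin n → V3
  vx' s j = proj₁ (mates s j)

  mate : ∀ s j → Mate V W (vx s j) (vx' s j)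
  mate s j = proj₂ (mates s j)

  lev' : Bool → ℤ
  lev' s = dot m₃ (vx' s j₀)

  K' : ℤ
  K' = lev' true - lev' false

  abstract
    L' : Labelled W vx'
    L' = labelled-mate L mate (mate-exists (equivalence-sym equiv) V-inhabited)

    top-max : ∀ j → maximises V m₃ (vx true j)
    top-max j = max-over-vertices m₃ (vertex∈ (vertex L true j)) λ w w-vertex → case cover L w-vertex of λ
      { (true , l , refl) → ≤-reflexive (trans (ν-lev true l) (sym (ν-lev true j)))
      ; (false , l , refl) → subst₂ _≤_ (sym (ν-lev false l)) (sym (ν-lev true j)) (0≤⇒≤ (0<⇒0≤ K>0)) }

    bottom-max : ∀ j → maximises V (-1ℤ ·v m₃) (vx false j)
    bottom-max j = max-over-vertices (-1ℤ ·v m₃) (vertex∈ (vertex L false j)) λ w w-vertex → case cover L w-vertex of λ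
      { (true , l , refl) → subst₂ _≤_ (sym (neg-lev true l)) (sym (neg-lev false j)) (0≤⇒≤ (0≤-resp (0<⇒0≤ K>0) (lem (lev true) (lev false))))
      ; (false , l , refl) → ≤-reflexive (trans (neg-lev false l) (sym (neg-lev false j))) }
      where
      neg-lev : ∀ s j → dot (-1ℤ ·v m₃) (vx s j) ≡ -1ℤ * lev s
      neg-lev s j = trans (·-dot -1ℤ m₃ (vx s j)) (cong (-1ℤ *_) (ν-lev s j))
      lem : ∀ a b → a - b ≡ -1ℤ * b - -1ℤ * a
      lem = solve-∀

    ν-lev' : ∀ s j → dot m₃ (vx' s j) ≡ lev' s
    ν-lev' true j = maximisers-≡ m₃ (Mate.to (mate true j₀) m₃ (top-max j₀)) (Mate.to (mate true j) m₃ (top-max j))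
    ν-lev' false j = *-cancelˡ-≡ -1ℤ (dot m₃ (vx' false j)) (dot m₃ (vx' false j₀)) (trans (sym (·-dot -1ℤ m₃ (vx' false j)))
      (trans (maximisers-≡ (-1ℤ ·v m₃) (Mate.to (mate false j₀) (-1ℤ ·v m₃) (bottom-max j₀)) (Mate.to (mate false j) (-1ℤ ·v m₃) (bottom-max j)))
        (·-dot -1ℤ m₃ (vx' false j₀))))

    K'≥0 : 0ℤ ≤ K'
    K'≥0 = ≤⇒0≤ (proj₂ (Mate.to (mate true j₀) m₃ (top-max j₀)) (vx' false j₀) (vertex∈ (vertex L' false j₀)))

    directions : ∀ j → ∃[ e ] (vx true j ≡ vx false j +v (K ·v e) × dot m₃ e ≡ 1ℤ × 0ℤ < K)
    directions = Levels.vertical-direction smoothV L m₃ lev ν-lev {E₃} m₃e₃ (0<⇒0≤ K>0)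

    directions' : ∀ j → ∃[ e ] (vx' true j ≡ vx' false j +v (K' ·v e) × dot m₃ e ≡ 1ℤ × 0ℤ < K')
    directions' = Levels.vertical-direction smoothW L' m₃ lev' ν-lev' {E₃} m₃e₃ K'≥0

    K'>0 : 0ℤ < K'
    K'>0 = proj₂ (proj₂ (proj₂ (directions' j₀)))

  dir : Fin n → V3
  dir j = proj₁ (directions j)

  abstract
    dir-V : ∀ j → vx true j ≡ vx false j +v (K ·v dir j)
    dir-V j = proj₁ (proj₂ (directions j))

    νdir : ∀ j → dot m₃ (dir j) ≡ 1ℤ
    νdir j = proj₁ (proj₂ (proj₂ (directions j)))

    -- Let `c` expose the vertical edge over `j`. As `d` is constant on that edge, both ends
    -- maximise `lex V c d` as well as `c`. So do their mates in `W`, and subtracting leaves `d`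
    -- constant on the mate edge.
    edge-parallel : ∀ j d → dot d (vx true j) ≡ dot d (vx false j) → dot d (vx' true j) ≡ dot d (vx' false j)
    edge-parallel j d e = case vertical L false j of λ { (_ , _ , _ , c , face) → go c face }
      where
      go : ∀ c → (∀ x → (isVertex V x × maximises V c x) ⇔ (x ≡ vx false j ⊎ x ≡ vx true j)) → dot d (vx' true j) ≡ dot d (vx' false j)
      go c face = +-cancelˡ (M * dot c (vx' false j)) (trans (cong (λ t → M * t + dot d (vx' true j)) (sym c≡))
          (trans (sym (lex-dot V c d (vx' true j))) (trans (maximisers-≡ (lex V c d) (Mate.to (mate false j) (lex V c d) (lex-max false)) (Mate.to (mate true j) (lex V c d) (lex-max true)))
            (lex-dot V c d (vx' false j)))))
        where
        M : ℤ
        M = proj₁ (lexicographic V c d)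
        c-max : ∀ s → maximises V c (vx s j)
        c-max false = proj₂ (Equivalence.from (face (vx false j)) (inj₁ refl))
        c-max true = proj₂ (Equivalence.from (face (vx true j)) (inj₂ refl))
        c≡ : dot c (vx' true j) ≡ dot c (vx' false j)
        c≡ = maximisers-≡ c (Mate.to (mate false j) c (c-max false)) (Mate.to (mate true j) c (c-max true))
        d≡ : ∀ s t → dot d (vx s j) ≡ dot d (vx t j)
        d≡ false false = refl
        d≡ false true = sym e
        d≡ true false = e
        d≡ true true = refl
        lex-max : ∀ s → maximises V (lex V c d) (vx s j)
        lex-max s = max-over-vertices (lex V c d) (vertex∈ (vertex L s j)) λ w w-vertex → case <-cmp (dot c w) (dot c (vx s j)) of λ
          { (tri< p _ _) → <⇒≤ (lex-< V c d (vertex∈ (vertex L s j)) (vertex∈ w-vertex) p)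
          ; (tri≈ _ p _) → lex-mono V c d p (≤-reflexive (case Equivalence.to (face w) (w-vertex , maximises-≡ c (c-max s) (vertex∈ w-vertex) p) of λ
              { (inj₁ refl) → d≡ false s ; (inj₂ refl) → d≡ true s }))
          ; (tri> _ _ p) → ⊥-elim (<⇒≱ p (proj₂ (c-max s) w (vertex∈ w-vertex))) }

    dir-same : ∀ j → proj₁ (directions' j) ≡ dir j
    dir-same j = ≡-by-dot e' (dir j) λ c → ≡-from-0 (trans (lem (dot c e') (dot c (dir j)))
        (trans (cong (λ t → dot c e' + (- dot c (dir j)) * t) (sym νe')) (trans (sym (d-dot c e')) (d-e' c))))
      where
      e' : V3
      e' = proj₁ (directions' j)
      νe' : dot m₃ e' ≡ 1ℤ
      νe' = proj₁ (proj₂ (proj₂ (directions' j)))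
      -- `d c` is `c` corrected by a multiple of `m₃` so as to vanish on `dir j`. `edge-parallel`
      -- makes it vanish on `e'` too, and `m₃` has the value one on both.
      d : V3 → V3
      d c = c +v ((- dot c (dir j)) ·v m₃)
      d-dot : ∀ c x → dot (d c) x ≡ dot c x + (- dot c (dir j)) * dot m₃ x
      d-dot c x = trans (+-dot c ((- dot c (dir j)) ·v m₃) x) (cong (_+_ (dot c x)) (·-dot (- dot c (dir j)) m₃ x))
      lem : ∀ x y → x - y ≡ x + (- y) * 1ℤ
      lem = solve-∀
      lem' : ∀ x K → x + K * 0ℤ ≡ x
      lem' = solve-∀
      dot-edge : ∀ c {x y e} K → x ≡ y +v (K ·v e) → dot c x ≡ dot c y + K * dot c e
      dot-edge c {x} {y} {e} K p = trans (cong (dot c) p) (trans (dot-+ c y (K ·v e)) (cong (_+_ (dot c y)) (dot-· c K e)))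
      d-dir : ∀ c → dot (d c) (dir j) ≡ 0ℤ
      d-dir c = trans (d-dot c (dir j)) (trans (cong (λ t → dot c (dir j) + (- dot c (dir j)) * t) (νdir j)) (trans (sym (lem (dot c (dir j)) (dot c (dir j)))) (x-x (dot c (dir j)))))
      d-e' : ∀ c → dot (d c) e' ≡ 0ℤ
      d-e' c = ≡0*-cancel {K'} K'>0 (trans (lem'' (dot (d c) (vx' false j)) (K' * dot (d c) e'))
        (trans (cong (_- dot (d c) (vx' false j)) (sym (dot-edge (d c) K' (proj₁ (proj₂ (directions' j))))))
          (0-from-≡ (edge-parallel j (d c) (trans (dot-edge (d c) K (dir-V j)) (trans (cong (λ t → dot (d c) (vx false j) + K * t) (d-dir c)) (lem' (dot (d c) (vx false j)) K)))))))
        where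
        lem'' : ∀ x y → y ≡ x + y - x
        lem'' = solve-∀

    dir-W : ∀ j → vx' true j ≡ vx' false j +v (K' ·v dir j)
    dir-W j = trans (proj₁ (proj₂ (directions' j))) (cong (λ e → vx' false j +v (K' ·v e)) (dir-same j))

  open Fan smoothV L quad D lev ν-lev K>0 using (plane; restrict; module Far)

  module Heights (h h' : ℤ) (h≥0 : 0ℤ ≤ h) (h≤K : 0ℤ ≤ K - h) (h'≥0 : 0ℤ ≤ h') (h'≤K' : 0ℤ ≤ K' - h') where

    module S = Slice L m₃ lev ν-lev K refl K>0 dir dir-V νdir h h≥0 h≤K
    module S' = Slice L' m₃ lev' ν-lev' K' refl K'>0 dir dir-W νdir h' h'≥0 h'≤K'

    -- Maximality on the bottom of `V` is the reference condition: `Far` carries it to the top, and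
    -- `Tilt` to `W` and its slices.
    Low : V3 → Fin n → Set
    Low c i = ∀ l → 0ℤ ≤ dot c (vx false i) - dot c (vx false l)

    abstract
      -- Adding a multiple of the height makes c constant along the edge over i.
      module Tilt (c : V3) (i : Fin n) (low : Low c i) where

        g : ℤ
        g = dot c (dir i)

        c' : V3
        c' = c +v ((- g) ·v m₃)

        c'-dot : ∀ x → dot c x ≡ dot c' x + g * dot m₃ x
        c'-dot x = sym (trans (cong (_+ g * dot m₃ x) (trans (+-dot c ((- g) ·v m₃) x) (cong (_+_ (dot c x)) (·-dot (- g) m₃ x)))) (lem (dot c x) g (dot m₃ x)))
          where
          lem : ∀ x g y → x + - g * y + g * y ≡ x
          lem = solve-∀

        c'-level : ∀ s l → dot c' (vx s l) ≡ dot c (vx s l) - g * lev s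
        c'-level s l = trans (lem (dot c' (vx s l)) (g * dot m₃ (vx s l))) (cong₂ _-_ (sym (c'-dot (vx s l))) (cong (g *_) (ν-lev s l)))
          where
          lem : ∀ x y → x ≡ x + y - y
          lem = solve-∀

        c'-dir : dot c' (dir i) ≡ 0ℤ
        c'-dir = +-cancelʳ-≡ (trans (sym (c'-dot (dir i))) (sym (trans (cong (λ t → 0ℤ + g * t) (νdir i)) (lem g))))
          where
          lem : ∀ g → 0ℤ + g * 1ℤ ≡ g
          lem = solve-∀
          +-cancelʳ-≡ : ∀ {x y k} → x + k ≡ y + k → x ≡ y
          +-cancelʳ-≡ {x} {y} {k} e = +-cancelˡ k (trans (+-comm k x) (trans e (+-comm y k)))

        ends-≡ : dot c' (vx true i) ≡ dot c' (vx false i)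
        ends-≡ = trans (S.dot-top c' i) (trans (cong (λ t → dot c' (vx false i) + K * t) c'-dir) (lem (dot c' (vx false i)) K))
          where
          lem : ∀ x K → x + K * 0ℤ ≡ x
          lem = solve-∀

        high : ∀ l → 0ℤ ≤ dot c (vx true i) - dot c (vx true l)
        high = Far.far-max true c i low

        shift-≤ : ∀ s l → 0ℤ ≤ dot c (vx s i) - dot c (vx s l) → dot c' (vx s l) ≤ dot c' (vx s i)
        shift-≤ s l p = subst₂ _≤_ (sym (c'-level s l)) (sym (c'-level s i)) (+-monoˡ-≤ (- (g * lev s)) (0≤⇒≤ {dot c (vx s l)} {dot c (vx s i)} p))

        max-V : maximises V c' (vx false i)
        max-V = max-over-vertices c' (vertex∈ (vertex L false i)) λ w w-vertex → case cover L w-vertex of λ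
          { (false , l , refl) → shift-≤ false l (low l)
          ; (true , l , refl) → ≤-trans (shift-≤ true l (high l)) (≤-reflexive ends-≡) }

        max-W : maximises W c' (vx' false i)
        max-W = Mate.to (mate false i) c' max-V

        max-W-top : maximises W c' (vx' true i)
        max-W-top = Mate.to (mate true i) c' (maximises-≡ c' max-V (vertex∈ (vertex L true i)) ends-≡)

        slice-W-≤ : ∀ l → dot c (S'.at l) ≤ dot c (S'.at i)
        slice-W-≤ l = subst₂ _≤_ (eq l) (eq i) (+-monoˡ-≤ (g * (lev' false + h')) (S'.at-max c' i l
            (proj₂ max-W (vx' false l) (vertex∈ (vertex L' false l))) (proj₂ max-W-top (vx' true l) (vertex∈ (vertex L' true l)))))
          where
          eq : ∀ l → dot c' (S'.at l) + g * (lev' false + h') ≡ dot c (S'.at l)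
          eq l = sym (trans (c'-dot (S'.at l)) (cong (λ t → dot c' (S'.at l) + g * t) (S'.ν-at l)))

        -- `c'` attains its maximum on both polytopes at label `i` and is constant along the
        -- vertical edges there. The Minkowski bound at the bottom vertices is therefore also the
        -- bound at the slice vertices; the height term is the same on both sides.
        sum-≤ : ∀ z → dot m₃ z ≡ lev false + h + (lev' false + h') → inMinkowskiSum V W (toQ z) → dot c z ≤ dot c (S.at i) + dot c (S'.at i)
        sum-≤ z ez z∈ = subst₂ _≤_ (sym (trans (c'-dot z) (cong (λ t → dot c' z + g * t) ez))) eq
            (+-monoˡ-≤ (g * (lev false + h + (lev' false + h'))) (minkowski-≤ c' max-V max-W z∈))
          where
          flat-at : ∀ x k → dot c' x + k * dot c' (dir i) ≡ dot c' x
          flat-at x k = trans (cong (λ t → dot c' x + k * t) c'-dir) (lem (dot c' x) k)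
            where
            lem : ∀ x k → x + k * 0ℤ ≡ x
            lem = solve-∀
          lem : ∀ x y g a b → x + y + g * (a + b) ≡ x + g * a + (y + g * b)
          lem = solve-∀
          eq : dot c' (vx false i) + dot c' (vx' false i) + g * (lev false + h + (lev' false + h')) ≡ dot c (S.at i) + dot c (S'.at i)
          eq = trans (lem (dot c' (vx false i)) (dot c' (vx' false i)) g (lev false + h) (lev' false + h')) (cong₂ _+_
            (sym (trans (c'-dot (S.at i)) (cong₂ (λ s t → s + g * t) (trans (S.dot-at c' i) (flat-at (vx false i) h)) (S.ν-at i))))
            (sym (trans (c'-dot (S'.at i)) (cong₂ (λ s t → s + g * t) (trans (S'.dot-at c' i) (flat-at (vx' false i) h')) (S'.ν-at i)))))

      low-exists : ∀ c → ∃[ i ] Low c i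
      low-exists c = argmax-inhabited j₀ (λ j → dot c (vx false j))

      -- A maximiser `m` on the bottom is one on the top by `Far`. A slice vertex averages bottom
      -- and top, so maximality of `i` in the slice forces a tie with `m` at an end of positive
      -- weight; from the top, `Far` leads back to the bottom.
      slice-max⇒low : ∀ c i → (∀ l → dot c (S.at l) ≤ dot c (S.at i)) → Low c i
      slice-max⇒low c i i-max = case low-exists c of λ { (m , low) → go m low }
        where
        go : ∀ m → Low c m → Low c i
        go m low = case tight-at of λ
          { (inj₁ e) → λ l → subst (λ t → 0ℤ ≤ t - dot c (vx false l)) e (low l)
          ; (inj₂ e) → Far.far-max false c i (λ l → subst (λ t → 0ℤ ≤ t - dot c (vx true l)) e (Far.far-max true c m low l)) }
          where
          lo-≤ : 0ℤ ≤ dot c (vx false m) - dot c (vx false i)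
          lo-≤ = low i
          hi-≤ : 0ℤ ≤ dot c (vx true m) - dot c (vx true i)
          hi-≤ = Far.far-max true c m low i
          lem : ∀ k h x y x' y' → k * (x - y) + h * (x' - y') ≡ k * x + h * x' - (k * y + h * y')
          lem = solve-∀
          lem' : ∀ K x y → K * x - K * y ≡ - (K * (y - x))
          lem' = solve-∀
          sum≡ : (K - h) * (dot c (vx false m) - dot c (vx false i)) + h * (dot c (vx true m) - dot c (vx true i)) ≡ - (K * (dot c (S.at i) - dot c (S.at m)))
          sum≡ = trans (lem (K - h) h (dot c (vx false m)) (dot c (vx false i)) (dot c (vx true m)) (dot c (vx true i)))
            (trans (cong₂ _-_ (sym (S.interpolate c m)) (sym (S.interpolate c i))) (lem' K (dot c (S.at m)) (dot c (S.at i))))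
          gap : 0ℤ ≤ K * (dot c (S.at i) - dot c (S.at m))
          gap = 0≤* (0<⇒0≤ K>0) (≤⇒0≤ (i-max m))
          zero-product : ∀ {x y z} → 0ℤ ≤ x → 0ℤ ≤ y → 0ℤ ≤ z → x + y ≡ - z → x ≡ 0ℤ × y ≡ 0ℤ
          zero-product {+0} {+0} _ _ _ _ = refl , refl
          zero-product {+0} {+[1+ _ ]} {+0} _ _ _ ()
          zero-product {+0} {+[1+ _ ]} {+[1+ _ ]} _ _ _ ()
          zero-product {+[1+ _ ]} {+ _} {+0} _ _ _ ()
          zero-product {+[1+ _ ]} {+ _} {+[1+ _ ]} _ _ _ ()
          zeros : (K - h) * (dot c (vx false m) - dot c (vx false i)) ≡ 0ℤ × h * (dot c (vx true m) - dot c (vx true i)) ≡ 0ℤ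
          zeros = zero-product (0≤* h≤K lo-≤) (0≤* h≥0 hi-≤) gap sum≡
          tight-at : dot c (vx false m) ≡ dot c (vx false i) ⊎ dot c (vx true m) ≡ dot c (vx true i)
          tight-at = by-sign (K - h)
            (λ p → inj₁ (≡-from-0 (≡0*-cancel {K - h} p (proj₁ zeros))))
            (λ z → inj₂ (≡-from-0 (≡0*-cancel {h} (0<-resp K>0 (≡-from-0 z)) (proj₂ zeros))))
            (λ p → ¬neg p h≤K)

    A B : Fin n → V2
    A j = plane (S.at j)
    B j = plane (S'.at j)

    lift : V2 → V3
    lift (c₁ , c₂) = (c₁ ·v m₁) +v (c₂ ·v m₂)

    abstract
      lift-dot : ∀ c y → dot (lift c) y ≡ dot₂ c (plane y)
      lift-dot (c₁ , c₂) y = trans (+-dot (c₁ ·v m₁) (c₂ ·v m₂) y) (cong₂ _+_ (·-dot c₁ m₁ y) (·-dot c₂ m₂ y))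

      plane-injective : ∀ x y → dot m₃ x ≡ dot m₃ y → plane x ≡ plane y → x ≡ y
      plane-injective x y e₃ e = trans (sym (expand x)) (trans (cong₂ (λ p t → ((proj₁ p ·v E₁) +v (proj₂ p ·v E₂)) +v (t ·v E₃)) e e₃) (expand y))

      A-≢ : ∀ {i j} → ¬ A i ≡ A j → ¬ vx false i ≡ vx false j
      A-≢ {i} {j} Ai≢Aj e = Ai≢Aj (cong plane (≡-by-dot (S.at i) (S.at j) λ c → trans (S.dot-at c i) (trans (cong₂ (λ s t → s + h * t) (cong (dot c) e) (dir≡ c)) (sym (S.dot-at c j)))))
        where
        lem : ∀ x y → x + y - x ≡ y
        lem = solve-∀
        K-dir : ∀ c j → K * dot c (dir j) ≡ dot c (vx true j) - dot c (vx false j)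
        K-dir c j = sym (trans (cong (_- dot c (vx false j)) (S.dot-top c j)) (lem (dot c (vx false j)) (K * dot c (dir j))))
        dist : ∀ K x y → K * (x - y) ≡ K * x - K * y
        dist = solve-∀
        dir≡ : ∀ c → dot c (dir i) ≡ dot c (dir j)
        dir≡ c = ≡-from-0 (≡0*-cancel {K} K>0 (trans (dist K (dot c (dir i)) (dot c (dir j))) (0-from-≡ (trans (K-dir c i)
          (trans (cong₂ _-_ (cong (dot c) (same-fibre L false e)) (cong (dot c) e)) (sym (K-dir c j)))))))

      B-≢ : ∀ {i j} → ¬ vx false i ≡ vx false j → ¬ B i ≡ B j
      B-≢ {i} {j} i≢j e = S'.at-injective i j
        (λ p → i≢j (mate-unique (mate-sym (mate false i)) (subst (λ w → Mate W V w (vx false j)) (sym p) (mate-sym (mate false j)))))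
        (plane-injective (S'.at i) (S'.at j) (trans (S'.ν-at i) (sym (S'.ν-at j))) e)

    module Target (z : V3) (z-level : dot m₃ z ≡ lev false + h + (lev' false + h')) (z∈ : inMinkowskiSum V W (toQ z)) where

      R : Fin n → V2
      R j = plane z ⊟ B j

      abstract
        -- The labels `i` and `j` maximise `lift c` on the slice of `V`, hence on the bottom, hence
        -- on the slice of `W`; the reflection in `R` turns maxima into minima.
        parallel-edges : ParallelEdges A R
        parallel-edges c i j i≢j i-max j≡i =
            (λ e → B-≢ (A-≢ i≢j) (cancel (B i) (B j) e)) ,
            (λ l → 0≤-resp (≤⇒0≤ (subst₂ _≤_ (lift-dot c (S'.at l)) (lift-dot c (S'.at i)) (Tilt.slice-W-≤ c₃ i low-i l))) (sym (difference c (B i) (B l)))) ,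
            ≡-from-0 (trans (difference c (B i) (B j)) (0-from-≡ (≤-antisym
              (subst₂ _≤_ (lift-dot c (S'.at i)) (lift-dot c (S'.at j)) (Tilt.slice-W-≤ c₃ j low-j i))
              (subst₂ _≤_ (lift-dot c (S'.at j)) (lift-dot c (S'.at i)) (Tilt.slice-W-≤ c₃ i low-i j)))))
          where
          c₃ : V3
          c₃ = lift c
          cancel : ∀ x y → plane z ⊟ x ≡ plane z ⊟ y → x ≡ y
          cancel x y e = trans (involution (plane z) x) (trans (cong (plane z ⊟_) e) (sym (involution (plane z) y)))
            where
            involution : ∀ z x → x ≡ z ⊟ (z ⊟ x)
            involution z x = by-ring² [] (z ∷ x ∷ []) (λ { [] (z ∷ x ∷ []) → x ≋ z E.⊟ (z E.⊟ x) }) refl refl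
          difference : ∀ c x y → dot₂ c (plane z ⊟ y) - dot₂ c (plane z ⊟ x) ≡ dot₂ c x - dot₂ c y
          difference c x y = by-ring [] (c ∷ x ∷ y ∷ plane z ∷ []) (λ { [] (c ∷ x ∷ y ∷ z ∷ []) →
            E.dot₂ c (z E.⊟ y) E.⊖ E.dot₂ c (z E.⊟ x) ≋ E.dot₂ c x E.⊖ E.dot₂ c y }) refl
          A-≤ : ∀ l → dot c₃ (S.at l) ≤ dot c₃ (S.at i)
          A-≤ l = subst₂ _≤_ (sym (lift-dot c (S.at l))) (sym (lift-dot c (S.at i))) (0≤⇒≤ (i-max l))
          low-i : Low c₃ i
          low-i = slice-max⇒low c₃ i A-≤
          low-j : Low c₃ j
          low-j = slice-max⇒low c₃ j λ l → subst (dot c₃ (S.at l) ≤_) (trans (lift-dot c (S.at i)) (trans (sym j≡i) (sym (lift-dot c (S.at j))))) (A-≤ l)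

        -- A functional separating `z` from all `A j ⊞ B j` would violate `sum-≤` at a label where
        -- it is maximal. The other alternative is one relation, and moving the `B` terms across it
        -- gives equal combinations of `A` and `R`.
        start : ∃[ i ] ∃[ j ] ∃[ k ] ∃[ w₁ ] ∃[ w₂ ] ∃[ w₃ ]
          (Weights w₁ w₂ w₃ × comb₂ w₁ (A i) w₂ (A j) w₃ (A k) ≡ comb₂ w₁ (R i) w₂ (R j) w₃ (R k))
        start = case gordan (λ j → (A j ⊞ B j) ⊟ plane z) of λ
          { (inj₁ (c , sep)) → ⊥-elim (separated c sep)
          ; (inj₂ (i , j , k , w₁ , w₂ , w₃ , w , e)) → i , j , k , w₁ , w₂ , w₃ , w , balance w₁ w₂ w₃ (A i) (A j) (A k) (B i) (B j) (B k) e }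
          where
          separated : ∀ c → (∀ j → 0ℤ < - dot₂ c ((A j ⊞ B j) ⊟ plane z)) → ⊥
          separated c sep = case low-exists (lift c) of λ { (i , low) → ¬pos {x = dot₂ c (plane z) - (dot₂ c (A i) + dot₂ c (B i))}
            (0<-resp (sep i) (lem c (A i) (B i) (plane z)))
            (0≤-resp (≤⇒0≤ (Tilt.sum-≤ (lift c) i low z z-level z∈)) (trans (cong₂ _-_ (cong₂ _+_ (lift-dot c (S.at i)) (lift-dot c (S'.at i))) (lift-dot c z))
              (lem' (dot₂ c (A i) + dot₂ c (B i)) (dot₂ c (plane z))))) }
            where
            lem : ∀ c x y z → - dot₂ c ((x ⊞ y) ⊟ z) ≡ dot₂ c z - (dot₂ c x + dot₂ c y)
            lem c x y z = by-ring [] (c ∷ x ∷ y ∷ z ∷ []) (λ { [] (c ∷ x ∷ y ∷ z ∷ []) →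
              ⊝ E.dot₂ c ((x E.⊞ y) E.⊟ z) ≋ E.dot₂ c z E.⊖ (E.dot₂ c x ⊕ E.dot₂ c y) }) refl
            lem' : ∀ x y → x - y ≡ - (y - x)
            lem' = solve-∀
          balance : ∀ w₁ w₂ w₃ a₁ a₂ a₃ b₁ b₂ b₃ → comb₂ w₁ ((a₁ ⊞ b₁) ⊟ plane z) w₂ ((a₂ ⊞ b₂) ⊟ plane z) w₃ ((a₃ ⊞ b₃) ⊟ plane z) ≡ 0₂ →
            comb₂ w₁ a₁ w₂ a₂ w₃ a₃ ≡ comb₂ w₁ (plane z ⊟ b₁) w₂ (plane z ⊟ b₂) w₃ (plane z ⊟ b₃)
          balance w₁ w₂ w₃ a₁ a₂ a₃ b₁ b₂ b₃ e = trans (by-ring² (w₁ ∷ w₂ ∷ w₃ ∷ []) (a₁ ∷ a₂ ∷ a₃ ∷ b₁ ∷ b₂ ∷ b₃ ∷ plane z ∷ [])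
            (λ { (w₁ ∷ w₂ ∷ w₃ ∷ []) (a₁ ∷ a₂ ∷ a₃ ∷ b₁ ∷ b₂ ∷ b₃ ∷ z ∷ []) →
              (w₁ E.⊡ a₁ E.⊞ w₂ E.⊡ a₂) E.⊞ w₃ E.⊡ a₃ ≋
              ((w₁ E.⊡ (z E.⊟ b₁) E.⊞ w₂ E.⊡ (z E.⊟ b₂)) E.⊞ w₃ E.⊡ (z E.⊟ b₃)) E.⊞
              ((w₁ E.⊡ ((a₁ E.⊞ b₁) E.⊟ z) E.⊞ w₂ E.⊡ ((a₂ E.⊞ b₂) E.⊟ z)) E.⊞ w₃ E.⊡ ((a₃ E.⊞ b₃) E.⊟ z)) }) refl refl)
            (trans (cong (comb₂ w₁ (plane z ⊟ b₁) w₂ (plane z ⊟ b₂) w₃ (plane z ⊟ b₃) ⊞_) e)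
              (cong₂ _,_ (+-identityʳ (proj₁ (comb₂ w₁ (plane z ⊟ b₁) w₂ (plane z ⊟ b₂) w₃ (plane z ⊟ b₃))))
                (+-identityʳ (proj₂ (comb₂ w₁ (plane z ⊟ b₁) w₂ (plane z ⊟ b₂) w₃ (plane z ⊟ b₃))))))

        -- Let `d` expose the edge from `j₀` to `l₁`. If `l₂` were collinear with these two in the
        -- slice, it would maximise `d` there, hence on the bottom, and the edge would contain a
        -- third vertex.
        noncollinear : ∃[ l ] ∃[ m ] ∃[ k ] (¬ br (A l) (A m) (A k) ≡ 0ℤ)
        noncollinear = j₀ , l₁ , l₂ , λ e → case Corner.edge₁ C₀ of λ { (_ , _ , j₀≢l₁ , d , face) → go d face j₀≢l₁ e }
          where
          go : ∀ d → (∀ x → (isVertex V x × maximises V d x) ⇔ (x ≡ vx false j₀ ⊎ x ≡ vx false l₁)) → ¬ vx false j₀ ≡ vx false l₁ →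
            br (A j₀) (A l₁) (A l₂) ≡ 0ℤ → ⊥
          go d face j₀≢l₁ e = case sum-of-squares u of λ
            { (inj₂ u≡0) → S.at-injective j₀ l₁ j₀≢l₁ (plane-injective (S.at j₀) (S.at l₁) (trans (S.ν-at j₀) (sym (S.ν-at l₁)))
                (sym (trans (⊟-⊞ (A l₁) (A j₀)) (trans (cong (A j₀ ⊞_) u≡0) (cong₂ _,_ (+-identityʳ (proj₁ (A j₀))) (+-identityʳ (proj₂ (A j₀))))))))
            ; (inj₁ u²) → not-max (≡-from-0 (trans (sym (restricted l₂)) (≡0*-cancel {dot₂ u u} u² (trans (binet P u v)
                (trans (cong₂ (λ s t → s * dot₂ u v + t * det u P) (trans (restricted l₁) (0-from-≡ first)) e) refl))))) }
            where
            P u v : V2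
            P = restrict d
            u = A l₁ ⊟ A j₀
            v = A l₂ ⊟ A j₀
            d-max : maximises V d (vx false j₀)
            d-max = proj₂ (Equivalence.from (face (vx false j₀)) (inj₁ refl))
            d-max₁ : maximises V d (vx false l₁)
            d-max₁ = proj₂ (Equivalence.from (face (vx false l₁)) (inj₂ refl))
            low₀ : Low d j₀
            low₀ l = ≤⇒0≤ (proj₂ d-max (vx false l) (vertex∈ (vertex L false l)))
            low₁ : Low d l₁
            low₁ l = ≤⇒0≤ (proj₂ d-max₁ (vx false l) (vertex∈ (vertex L false l)))
            at-≤ : ∀ i → Low d i → ∀ l → dot d (S.at l) ≤ dot d (S.at i)
            at-≤ i low l = S.at-max d i l (0≤⇒≤ (low l)) (0≤⇒≤ (Far.far-max true d i low l))
            first : dot d (S.at l₁) ≡ dot d (S.at j₀)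
            first = ≤-antisym (at-≤ j₀ low₀ l₁) (at-≤ l₁ low₁ j₀)
            not-max : dot d (S.at l₂) ≡ dot d (S.at j₀) → ⊥
            not-max p = case Equivalence.to (face (vx false l₂)) (vertex L false l₂ , maximises-≡ d d-max (vertex∈ (vertex L false l₂))
                (≤-antisym (0≤⇒≤ (low₀ l₂)) (0≤⇒≤ (slice-max⇒low d l₂ (λ l → subst (dot d (S.at l) ≤_) (sym p) (at-≤ j₀ low₀ l)) j₀)))) of λ
              { (inj₁ q) → proj₁ (proj₂ (proj₂ (Corner.edge₂ C₀))) (sym q)
              ; (inj₂ q) → Corner.distinct C₀ (sym q) }
            plane-⊟ : ∀ c x y → dot₂ c (plane x ⊟ plane y) ≡ dot₂ c (plane (x -v y))
            plane-⊟ c x y = cong (dot₂ c) (cong₂ _,_ (sym (dot-- m₁ x y)) (sym (dot-- m₂ x y)))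
            restricted : ∀ l → dot₂ P (A l ⊟ A j₀) ≡ dot d (S.at l) - dot d (S.at j₀)
            restricted l = trans (plane-⊟ P (S.at l) (S.at j₀)) (trans (sym (Fan.flat smoothV L quad D lev ν-lev K>0 d (S.at l -v S.at j₀)
              (trans (dot-- m₃ (S.at l) (S.at j₀)) (0-from-≡ (trans (S.ν-at l) (sym (S.ν-at j₀))))))) (dot-- d (S.at l) (S.at j₀)))
            binet : ∀ P u v → dot₂ u u * dot₂ P v ≡ dot₂ P u * dot₂ u v + det u v * det u P
            binet P u v = by-ring [] (P ∷ u ∷ v ∷ []) (λ { [] (P ∷ u ∷ v ∷ []) →
              E.dot₂ u u ⊗ E.dot₂ P v ≋ E.dot₂ P u ⊗ E.dot₂ u v ⊕ E.det u v ⊗ E.det u P }) refl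

        common : Common A R
        common = case start of λ { (i , j , k , w₁ , w₂ , w₃ , w , e) → Descent.common-point parallel-edges w i j k noncollinear e }

        expand-dot : ∀ c x → dot c x ≡ dot m₁ x * dot c E₁ + dot m₂ x * dot c E₂ + dot m₃ x * dot c E₃
        expand-dot c x = trans (cong (dot c) (sym (expand x))) (dot-comb₃ c (dot m₁ x) (dot m₂ x) (dot m₃ x) E₁ E₂ E₃)

        decompose : ∃[ p ] ∃[ q ] (inConv V (toQ p) × inConv W (toQ q) × (p +v q ≡ z))
        decompose = Common-lift V W {A = A} {R} {S.at} {S'.at} o E₁ E₂ o' u' v' z F-A F'-R S.in-conv S'.in-conv F+F' common
          where
          t : ℤ
          t = lev false + h
          -- The two parametrisations run in opposite directions, so that their values at the same
          -- plane point always add up to `z`.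
          o o' : V3
          o = t ·v E₃
          o' = z -v (t ·v E₃)
          u' v' : V3
          u' = -1ℤ ·v E₁
          v' = -1ℤ ·v E₂
          F-dot : ∀ c x y → dot c (affine o E₁ E₂ (x , y)) ≡ t * dot c E₃ + x * dot c E₁ + y * dot c E₂
          F-dot c x y = trans (affine-dot c o E₁ E₂ (x , y)) (cong (λ s → s + x * dot c E₁ + y * dot c E₂) (dot-· c t E₃))
          F'-dot : ∀ c x y → dot c (affine o' u' v' (x , y)) ≡ dot c z - t * dot c E₃ + x * (-1ℤ * dot c E₁) + y * (-1ℤ * dot c E₂)
          F'-dot c x y = trans (affine-dot c o' u' v' (x , y)) (cong₂ _+_ (cong₂ (λ s r → s + x * r)
            (trans (dot-- c z (t ·v E₃)) (cong (λ s → dot c z - s) (dot-· c t E₃))) (dot-· c -1ℤ E₁)) (cong (y *_) (dot-· c -1ℤ E₂)))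
          F-A : ∀ i → affine o E₁ E₂ (A i) ≡ S.at i
          F-A i = ≡-by-dot (affine o E₁ E₂ (A i)) (S.at i) (value (S.at i) (S.ν-at i))
            where
            lem : ∀ t x y z → t * x + y + z ≡ y + z + t * x
            lem = solve-∀
            value : ∀ y → dot m₃ y ≡ t → ∀ c → dot c (affine o E₁ E₂ (dot m₁ y , dot m₂ y)) ≡ dot c y
            value y e c = trans (F-dot c (dot m₁ y) (dot m₂ y)) (trans (lem t (dot c E₃) (dot m₁ y * dot c E₁) (dot m₂ y * dot c E₂))
              (trans (cong (λ s → dot m₁ y * dot c E₁ + dot m₂ y * dot c E₂ + s * dot c E₃) (sym e)) (sym (expand-dot c y))))
          F'-R : ∀ i → affine o' u' v' (R i) ≡ S'.at i
          F'-R i = ≡-by-dot (affine o' u' v' (R i)) (S'.at i) (value (S'.at i) (S'.ν-at i))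
            where
            lem : ∀ t m m' m'' b b' x y z → m * x + m' * y + m'' * z - t * z + (m - b) * (-1ℤ * x) + (m' - b') * (-1ℤ * y) ≡ b * x + b' * y + (m'' - t) * z
            lem = solve-∀
            lem' : ∀ t s → t + s - t ≡ s
            lem' = solve-∀
            value : ∀ y → dot m₃ y ≡ lev' false + h' → ∀ c → dot c (affine o' u' v' (dot m₁ z - dot m₁ y , dot m₂ z - dot m₂ y)) ≡ dot c y
            value y e c = trans (F'-dot c (dot m₁ z - dot m₁ y) (dot m₂ z - dot m₂ y))
              (trans (cong (λ s → s - t * dot c E₃ + (dot m₁ z - dot m₁ y) * (-1ℤ * dot c E₁) + (dot m₂ z - dot m₂ y) * (-1ℤ * dot c E₂)) (expand-dot c z))
              (trans (lem t (dot m₁ z) (dot m₂ z) (dot m₃ z) (dot m₁ y) (dot m₂ y) (dot c E₁) (dot c E₂) (dot c E₃))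
              (trans (cong (λ s → dot m₁ y * dot c E₁ + dot m₂ y * dot c E₂ + s * dot c E₃)
                (trans (cong (_- t) z-level) (trans (lem' t (lev' false + h')) (sym e)))) (sym (expand-dot c y)))))
          F+F' : ∀ p → affine o E₁ E₂ p +v affine o' u' v' p ≡ z
          F+F' (x , y) = ≡-by-dot (affine o E₁ E₂ (x , y) +v affine o' u' v' (x , y)) z λ c → trans (dot-+ c (affine o E₁ E₂ (x , y)) (affine o' u' v' (x , y))) (trans (cong₂ _+_ (F-dot c x y) (F'-dot c x y))
            (lem t (dot c z) x y (dot c E₁) (dot c E₂) (dot c E₃)))
            where
            lem : ∀ t cz a b x y z → t * z + a * x + b * y + (cz - t * z + a * (-1ℤ * x) + b * (-1ℤ * y)) ≡ cz
            lem = solve-∀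

  abstract
    idp : IDP V W
    -- `H` is the height of `z` above the sum of the bottoms. `P` absorbs as much of it as its own
    -- height `K` allows, and `P'` gets the rest.
    idp z z∈ = case 0≤⊎ (K - H) of λ
      { (inj₁ p) → Heights.Target.decompose H 0ℤ H≥0 p ≤-refl (0≤-resp K'≥0 (r₀ K')) z (r₁ (dot m₃ z) (lev false) (lev' false)) z∈
      ; (inj₂ p) → Heights.Target.decompose K (H - K) (0<⇒0≤ K>0) (0≤-≡ (x-x K)) (0≤-resp (0<⇒0≤ p) (r₂ K H)) (0≤-resp H≤ (r₃ K K' H)) z
          (r₄ (dot m₃ z) (lev false) (lev' false) K) z∈ }
      where
      H : ℤ
      H = dot m₃ z - (lev false + lev' false)
      r₀ : ∀ x → x ≡ x - 0ℤ
      r₀ = solve-∀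
      r₁ : ∀ x a b → x ≡ a + (x - (a + b)) + (b + 0ℤ)
      r₁ = solve-∀
      r₂ : ∀ K H → - (K - H) ≡ H - K
      r₂ = solve-∀
      r₃ : ∀ K K' H → K + K' - H ≡ K' - (H - K)
      r₃ = solve-∀
      r₄ : ∀ x a b K → x ≡ a + K + (b + (x - (a + b) - K))
      r₄ = solve-∀
      H≥0 : 0ℤ ≤ H
      H≥0 = 0≤-resp (≤⇒0≤ (minkowski-≤ (-1ℤ ·v m₃) (bottom-max j₀) (Mate.to (mate false j₀) (-1ℤ ·v m₃) (bottom-max j₀)) z∈))
        (trans (cong₂ _-_ (cong₂ _+_ (·-dot -1ℤ m₃ (vx false j₀)) (·-dot -1ℤ m₃ (vx' false j₀))) (·-dot -1ℤ m₃ z)) (lem (lev false) (lev' false) (dot m₃ z)))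
        where
        lem : ∀ a b x → -1ℤ * a + -1ℤ * b - -1ℤ * x ≡ x - (a + b)
        lem = solve-∀
      H≤ : 0ℤ ≤ K + K' - H
      H≤ = 0≤-resp (≤⇒0≤ (minkowski-≤ m₃ (top-max j₀) (Mate.to (mate true j₀) m₃ (top-max j₀)) z∈)) (lem (lev true) (lev' true) (lev false) (lev' false) (dot m₃ z))
        where
        lem : ∀ a b c d x → a + b - x ≡ a - c + (b - d) - (x - (c + d))
        lem = solve-∀

theorem4p5 : (P P' : List V3) → Smooth P → Smooth P' → Prismatoid P → Prismatoid P'
    → MinkowskiEquivalent P P' → IDP P P'
theorem4p5 P P' smooth smooth' (Qs , full , f , iso , a , α , β , a≢0 , top , bottom) _ equiv =
  Assembly.idp smooth smooth' labelled quad equiv j₀ {a} {levels} a≢0 level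
  where
  open PrismLabelling Qs iso
  j₀ : Fin n
  j₀ = case full of λ { (x , _ , _ , _ , x∈ , _) → case vertex-max (prism Qs) (x , x∈) 0v of λ
    { (v , v-vertex , _) → case T-pt v-vertex of λ { (_ , j , _) → j } } }
  levels : Bool → ℤ
  levels true = α
  levels false = β
  level : ∀ s j → dot a (vx s j) ≡ levels s
  level true j = top (pt true (corner j)) (pt-T true j) refl
  level false j = bottom (pt false (corner j)) (pt-T false j) refl
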